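{- Consider the random graph process $(G_t(n))_{t=0}^{\binom n2}$. Let $\tau_{\mathcal N}$ be the smallest $t$ such that $G_t(n)$ is connected and has no NAC-colouring, and let $\tau_{\mathcal T}$ be the smallest $t$ such that every vertex of $G_t(n)$ lies in a triangle. Then asymptotically almost surely $\tau_{\mathcal N}=\tau_{\mathcal T}$.
   Context: The random graph process starts with $G_0(n)$ the empty graph on $n$ vertices, and for each $t\ge1$, $G_t(n)$ is obtained from $G_{t-1}(n)$ by adding an edge chosen uniformly at random among the non-edges of $G_{t-1}(n)$, independently of previous choices. A NAC-colouring of a graph $G$ is a surjective map $E(G)\to\{\text{red},\text{blue}\}$ such that no cycle of $G$ contains exactly one red edge or exactly one blue edge. (The property of being connected with no NAC-colouring is monotone under adding edges, so $G_t(n)$ has it iff $t\ge\tau_{\mathcal N}$.) "Asymptotically almost surely" means with probability tending to $1$ as $n\to\infty$. -}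

module Defs where

open import Data.Nat using (ℕ; zero; suc; _<_; _<ᵇ_; _≤_; _*_)
open import Data.Nat.Base using (_!)
open import Data.Nat.Combinatorics using (_C_)
open import Data.Bool using (Bool; true; false; if_then_else_)
open import Data.Fin using (Fin; toℕ)
open import Data.List using (List; []; _∷_; _++_; [_]; take; length; allFin; concatMap; filter; zip)
open import Data.List.Membership.Propositional using (_∈_)
open import Data.List.Relation.Unary.All using (All)
open import Data.List.Relation.Unary.Unique.Propositional using (Unique)
open import Data.List.Relation.Binary.Permutation.Propositional using (_↭_)
open import Data.Product using (_×_; _,_; Σ; ∃; ∃-syntax)
open import Data.Sum using (_⊎_)
open import Relation.Nullary using (¬_)
open import Relation.Binary.PropositionalEquality using (_≡_)
open import Relation.Binary.Construct.Closure.ReflexiveTransitive using (Star)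
open import Data.Nat.Properties using (_<?_)

-- An edge of K_n is stored as an ordered pair (i , j) with toℕ i < toℕ j.
Edge : ℕ → Set
Edge n = Fin n × Fin n

allEdges : (n : ℕ) → List (Edge n)
allEdges n = concatMap (λ i → concatMap (λ j → if toℕ i <ᵇ toℕ j then [ (i , j) ] else []) (allFin n)) (allFin n)

Graph : ℕ → Set
Graph n = List (Edge n)

Adj : ∀ {n} → Graph n → Fin n → Fin n → Set
Adj G u v = ((u , v) ∈ G) ⊎ ((v , u) ∈ G)

Connected : ∀ {n} → Graph n → Set
Connected {n} G = (u v : Fin n) → Star (Adj G) u v

EveryVertexInTriangle : ∀ {n} → Graph n → Set
EveryVertexInTriangle {n} G = (v : Fin n) → ∃[ a ] ∃[ b ] (Adj G v a × Adj G v b × Adj G a b)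

-- A colouring assigns a colour (true = red, false = blue) to each ordered pair;
-- only its values on the (normalised) edges of G matter.
Colouring : ℕ → Set
Colouring n = Edge n → Bool

colourOf : ∀ {n} → Colouring n → Fin n → Fin n → Bool
colourOf c a b = if toℕ a <ᵇ toℕ b then c (a , b) else c (b , a)

cycleEdges : ∀ {n} → List (Fin n) → List (Fin n × Fin n)
cycleEdges [] = []
cycleEdges (v ∷ vs) = zip (v ∷ vs) (vs ++ [ v ])

IsCycle : ∀ {n} → Graph n → List (Fin n) → Set
IsCycle G vs = (3 ≤ length vs) × Unique vs × All (λ e → Adj G (Data.Product.proj₁ e) (Data.Product.proj₂ e)) (cycleEdges vs)

countColour : ∀ {n} → Colouring n → Bool → List (Fin n × Fin n) → ℕ
countColour c b [] = 0
countColour c true ((x , y) ∷ es) = (if colourOf c x y then 1 else 0) Data.Nat.+ countColour c true es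
countColour c false ((x , y) ∷ es) = (if colourOf c x y then 0 else 1) Data.Nat.+ countColour c false es

IsNAC : ∀ {n} → Graph n → Colouring n → Set
IsNAC G c =
  (∃[ e ] (e ∈ G × c e ≡ true)) ×
  (∃[ e ] (e ∈ G × c e ≡ false)) ×
  (∀ vs → IsCycle G vs → ¬ (countColour c true (cycleEdges vs) ≡ 1) × ¬ (countColour c false (cycleEdges vs) ≡ 1))

HasNAC : ∀ {n} → Graph n → Set
HasNAC {n} G = ∃[ c ] IsNAC {n} G c

ConnectedNoNAC : ∀ {n} → Graph n → Set
ConnectedNoNAC G = Connected G × ¬ HasNAC G

-- An ordering of all edges of K_n; G_t is the graph of its first t edges.
-- The random graph process is exactly the uniformly random such ordering.
IsOrdering : (n : ℕ) → List (Edge n) → Set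
IsOrdering n σ = σ ↭ allEdges n

HittingTime : ∀ {n} → (Graph n → Set) → List (Edge n) → ℕ → Set
HittingTime P σ t = P (take t σ) × (∀ s → s < t → ¬ P (take s σ))

Bad : (n : ℕ) → List (Edge n) → Set
Bad n σ = IsOrdering n σ × ¬ (∃[ t ] (HittingTime ConnectedNoNAC σ t × HittingTime EveryVertexInTriangle σ t))

numOrderings : ℕ → ℕ
numOrderings n = (n C 2) !

-- Let τ be the first time at which every vertex lies in a triangle. With n ≈ r^2130, τ lies between
-- m₀ ≈ n^(4/3) / r⁴ and m₁ ≈ n^(4/3) r⁵ for all but few orderings. A NAC-colouring gives two partitions of
-- the vertices, into red and into blue components, and every edge lies inside a class of exactly one of them.
-- After m₀ edges any two sets of about n^(2/3) r⁸ vertices are joined by an edge, which forces one class to be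
-- almost everything; its complement S is small, nonempty and closed: every triangle meeting S has at least two
-- vertices in S. A disconnected graph yields such an S as well. Let F be the edges inside S that lie in triangles
-- at time τ. Deleting F uncovers all endpoints of F but only O(|F|) vertices in total, so the remaining edges
-- determine a small vertex set containing F, although all of F occurs before time m₁; moreover a positive
-- proportion of F closes triangles with edges revealed earlier. Summed over all sizes of F this is too unlikely.
-- Conversely, before τ a connected graph has a NAC-colouring: colour the edges at an uncovered vertex red.

module Submission where

open import Defs
open import Data.Bool using (Bool; true; false; T; not; if_then_else_)
open import Data.Empty using (⊥; ⊥-elim)
open import Data.Fin using (Fin; toℕ; fromℕ<) renaming (zero to fzero; suc to fsuc)
import Data.Fin.Properties as Fin
open import Data.List using (List; []; _∷_; _++_; [_]; take; drop; length; allFin; concatMap; filter; zip; map; replicate; upTo; applyUpTo; deduplicate)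
open import Data.List.Properties using (length-map; length-++; length-take; length-drop; length-replicate; length-tabulate; length-applyUpTo; length-upTo; take++drop≡id; filter-++; length-filter; ++-assoc; ++-identityʳ; filter-none; ≡-dec)
open import Data.List.Membership.Propositional using (_∈_; _∉_; find; lose)
open import Data.List.Membership.Propositional.Properties using (∈-map⁺; ∈-map⁻; ∈-++⁺ˡ; ∈-++⁺ʳ; ∈-++⁻; ∈-filter⁺; ∈-filter⁻; ∈-∃++; ∈-insert; ∈-allFin; ∈-upTo⁺; ∈-applyUpTo⁻; ∈-deduplicate⁺; ∈-deduplicate⁻; ∈-length)
open import Data.List.Relation.Unary.All as All using (All; []; _∷_)
open import Data.List.Relation.Unary.All.Properties using (¬Any⇒All¬)
open import Data.List.Relation.Unary.AllPairs using ([]; _∷_)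
open import Data.List.Relation.Unary.Any as Any using (Any; here; there)
open import Data.List.Relation.Unary.Unique.Propositional using (Unique)
import Data.List.Relation.Unary.Unique.Propositional.Properties as Unique
open import Data.List.Relation.Unary.Unique.DecPropositional.Properties using (deduplicate-!)
open import Data.List.Relation.Binary.Permutation.Propositional using (_↭_; ↭-sym; ↭⇒↭ₛ)
import Data.List.Relation.Binary.Permutation.Setoid.Properties as PermSetoid
open import Data.List.Relation.Binary.Permutation.Propositional.Properties using (↭-length; ∈-resp-↭)
open import Data.Nat
open import Data.Nat.Combinatorics using (_C_; nCk+nC[k+1]≡[n+1]C[k+1]; nC1≡n)
open import Data.Nat.Properties
open import Data.Nat.Tactic.RingSolver using (solve-∀)
open import Data.Product using (_×_; _,_; ∃-syntax; proj₁; proj₂)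
open import Data.Product.Properties using () renaming (≡-dec to ×-≡-dec)
open import Data.Sum using (_⊎_; inj₁; inj₂; [_,_]′)
open import Data.Unit using (tt)
open import Function using (_∘_; id)
open import Relation.Binary.Construct.Closure.ReflexiveTransitive using (Star; ε; _◅_; _◅◅_)
open import Relation.Binary.Definitions using (DecidableEquality; tri<; tri≈; tri>)
open import Relation.Binary.PropositionalEquality using (_≡_; _≢_; refl; sym; trans; cong; cong₂; subst; subst₂; module ≡-Reasoning; setoid)
open import Relation.Nullary using (¬_; Dec; yes; no; ¬?; contradiction; does)
open import Relation.Nullary.Decidable using (_×-dec_; _⊎-dec_; decidable-stable; dec-true; dec-false)
open import Relation.Unary using (Decidable)

-- Probability is counting: an event is rare when the orderings in it belong to a generated list
-- that is short compared with all orderings. Entries are revealed in a convenient order of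
-- positions, and each step needs only a bound on the number of candidates given what is already
-- revealed. No estimate is made of how many vertices are uncovered at a given time between m₀ and
-- m₁. Instead a stopping rule that sees only the edges outside F and the number |F|, and not τ,
-- yields at most 10|F| vertices containing all ends of F. F may have about n^(2/3) r^27 edges, so
-- confining them to pairs inside that set can still lose a power of r per edge. An edge that closes
-- a triangle has only about |F| n^(1/3) candidates, up to a power r^50, instead of |F|^2. At least
-- one edge of F in 17 = 1 + 2 * 8 is of this kind, because codegrees are at most 8, and the gain on
-- it amounts to r^40 per edge of F. The exponent 2130 = 3 * 710 leaves room for this, as 17 * 40 =
-- 680.

module _ {A : Set} where

  ∈-remove : ∀ {x y : A} ys {zs} → x ∈ ys ++ y ∷ zs → x ≢ y → x ∈ ys ++ zs
  ∈-remove ys x∈ x≢y with ∈-++⁻ ys x∈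
  ... | inj₁ x∈ys         = ∈-++⁺ˡ x∈ys
  ... | inj₂ (here x≡y)   = contradiction x≡y x≢y
  ... | inj₂ (there x∈zs) = ∈-++⁺ʳ ys x∈zs

  Unique-⊆-length : ∀ {xs ys : List A} → Unique xs → (∀ {x} → x ∈ xs → x ∈ ys) → length xs ≤ length ys
  Unique-⊆-length {[]} _ _ = z≤n
  Unique-⊆-length {x ∷ xs} (x∉ ∷ u) xs⊆ with ∈-∃++ (xs⊆ (here refl))
  ... | ys , zs , refl = begin
      suc (length xs)           ≤⟨ s≤s (Unique-⊆-length u λ {y} y∈ → ∈-remove ys (xs⊆ (there y∈)) λ y≡x → All.lookup x∉ y∈ (sym y≡x)) ⟩
      suc (length (ys ++ zs))   ≡⟨ cong suc (length-++ ys) ⟩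
      suc (length ys + length zs) ≡⟨ sym (+-suc (length ys) (length zs)) ⟩
      length ys + suc (length zs) ≡⟨ sym (length-++ ys) ⟩
      length (ys ++ x ∷ zs) ∎
    where open ≤-Reasoning

  length-concatMap-≤ : ∀ {B : Set} (f : A → List B) {c} xs → (∀ {x} → x ∈ xs → length (f x) ≤ c) →
                       length (concatMap f xs) ≤ length xs * c
  length-concatMap-≤ f [] _ = z≤n
  length-concatMap-≤ f {c} (x ∷ xs) h = begin
    length (f x ++ concatMap f xs)          ≡⟨ length-++ (f x) ⟩
    length (f x) + length (concatMap f xs)  ≤⟨ +-mono-≤ (h (here refl)) (length-concatMap-≤ f xs (h ∘ there)) ⟩
    c + length xs * c ∎
    where open ≤-Reasoning

  ∈-concatMap-intro : ∀ {B : Set} (f : A → List B) {x y xs} → x ∈ xs → y ∈ f x → y ∈ concatMap f xs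
  ∈-concatMap-intro f (here refl) y∈ = ∈-++⁺ˡ y∈
  ∈-concatMap-intro f {xs = x ∷ xs} (there x∈) y∈ = ∈-++⁺ʳ (f x) (∈-concatMap-intro f x∈ y∈)

  ∈-concatMap-elim : ∀ {B : Set} (f : A → List B) {y} xs → y ∈ concatMap f xs → ∃[ x ] (x ∈ xs × y ∈ f x)
  ∈-concatMap-elim f (x ∷ xs) y∈ with ∈-++⁻ (f x) y∈
  ... | inj₁ y∈fx = x , here refl , y∈fx
  ... | inj₂ y∈r with ∈-concatMap-elim f xs y∈r
  ...   | z , z∈ , y∈z = z , there z∈ , y∈z

  take-⊆ : ∀ {x : A} m xs → x ∈ take m xs → x ∈ xs
  take-⊆ m xs x∈ = subst (_ ∈_) (take++drop≡id m xs) (∈-++⁺ˡ x∈)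

  take-mono-⊆ : ∀ {x : A} {m m′} xs → m ≤ m′ → x ∈ take m xs → x ∈ take m′ xs
  take-mono-⊆ {m = suc m} {suc m′} (y ∷ xs) (s≤s p) (here q) = here q
  take-mono-⊆ {m = suc m} {suc m′} (y ∷ xs) (s≤s p) (there q) = there (take-mono-⊆ xs p q)

  length-take-≤ : ∀ m (xs : List A) → length (take m xs) ≤ m
  length-take-≤ m xs = ≤-trans (≤-reflexive (length-take m xs)) (m⊓n≤m m (length xs))

  length-take-exact : ∀ {m} (xs : List A) → m ≤ length xs → length (take m xs) ≡ m
  length-take-exact {m} xs m≤ = trans (length-take m xs) (m≤n⇒m⊓n≡m m≤)

  take-all : ∀ {m} {xs : List A} → length xs ≤ m → take m xs ≡ xs
  take-all {zero} {[]} _ = refl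
  take-all {suc m} {[]} _ = refl
  take-all {suc m} {x ∷ xs} (s≤s p) = cong (x ∷_) (take-all p)

  Unique-++⁻ : ∀ (xs : List A) {ys} → Unique (xs ++ ys) → Unique xs × Unique ys × (∀ {x} → x ∈ xs → x ∉ ys)
  Unique-++⁻ [] u = [] , u , λ ()
  Unique-++⁻ (x ∷ xs) (x∉ ∷ u) with Unique-++⁻ xs u
  ... | ux , uy , d = (All.tabulate (λ {y} y∈ → All.lookup x∉ (∈-++⁺ˡ y∈)) ∷ ux) , uy ,
        λ { (here refl) y∈ → All.lookup x∉ (∈-++⁺ʳ xs y∈) refl ; (there p) → d p }

  Unique-++⁺ : ∀ {xs ys : List A} → Unique xs → Unique ys → (∀ {x} → x ∈ xs → x ∉ ys) → Unique (xs ++ ys)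
  Unique-++⁺ ux uy d = Unique.++⁺ ux uy λ { (p , q) → d p q }

  last-satisfying : ∀ {P : A → Set} → Decidable P → ∀ {xs} → Any P xs →
                    ∃[ as ] ∃[ x ] ∃[ bs ] (xs ≡ as ++ x ∷ bs × P x × (∀ {y} → y ∈ bs → ¬ P y))
  last-satisfying P? {x ∷ xs} a with Any.any? P? xs
  ... | yes a′ with last-satisfying P? a′
  ...   | as , y , bs , refl , py , none = x ∷ as , y , bs , refl , py , none
  last-satisfying P? {x ∷ xs} (here px) | no ¬a = [] , x , xs , refl , px , λ y∈ py → ¬a (Any.map (λ { refl → py }) y∈)
  last-satisfying P? {x ∷ xs} (there a) | no ¬a = contradiction a ¬a

lists : ∀ {A : Set} → List A → ℕ → List (List A)
lists xs zero = [ [] ]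
lists xs (suc m) = concatMap (λ x → map (x ∷_) (lists xs m)) xs

length-lists : ∀ {A : Set} (xs : List A) m → length (lists xs m) ≤ length xs ^ m
length-lists xs zero = ≤-refl
length-lists xs (suc m) = length-concatMap-≤ _ xs λ {x} _ → ≤-trans (≤-reflexive (length-map (x ∷_) (lists xs m))) (length-lists xs m)

∈-lists : ∀ {A : Set} {xs : List A} (ys : List A) → (∀ {y} → y ∈ ys → y ∈ xs) → ys ∈ lists xs (length ys)
∈-lists [] _ = here refl
∈-lists {xs = xs} (y ∷ ys) h = ∈-concatMap-intro (λ x → map (x ∷_) (lists xs (length ys))) (h (here refl)) (∈-map⁺ (y ∷_) (∈-lists ys (h ∘ there)))

-- Position sets and enumeration of orderings

∏ : (ℕ → ℕ) → ℕ → ℕ → ℕ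
∏ c i zero    = 1
∏ c i (suc m) = c i * ∏ c (suc i) m

falling-! : ∀ M i g → i + g ≤ M → ∏ (M ∸_) i g * (M ∸ (i + g)) ! ≡ (M ∸ i) !
falling-! M i zero p rewrite +-identityʳ i = +-identityʳ _
falling-! M i (suc g) p = begin
    (M ∸ i) * ∏ (M ∸_) (suc i) g * (M ∸ (i + suc g)) !       ≡⟨ cong (λ t → (M ∸ i) * ∏ (M ∸_) (suc i) g * (M ∸ t) !) (+-suc i g) ⟩
    (M ∸ i) * ∏ (M ∸_) (suc i) g * (M ∸ (suc i + g)) !       ≡⟨ *-assoc (M ∸ i) _ _ ⟩
    (M ∸ i) * (∏ (M ∸_) (suc i) g * (M ∸ (suc i + g)) !)     ≡⟨ cong ((M ∸ i) *_) (falling-! M (suc i) g (subst (_≤ M) (+-suc i g) p)) ⟩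
    (M ∸ i) * (M ∸ suc i) !                                  ≡⟨ cong (λ t → t * (M ∸ suc i) !) i<M ⟩
    suc (M ∸ suc i) * (M ∸ suc i) !                          ≡⟨ cong _! (sym i<M) ⟩
    (M ∸ i) ! ∎
  where
  open ≡-Reasoning
  i<M : M ∸ i ≡ suc (M ∸ suc i)
  i<M = +-∸-assoc 1 {M} {suc i} (≤-trans (≤-trans (≤-reflexive (+-comm 1 i)) (+-monoʳ-≤ i (s≤s z≤n))) p)

falling-all : ∀ M i → i ≤ M → ∏ (M ∸_) i (M ∸ i) ≡ (M ∸ i) !
falling-all M i p = trans (sym (*-identityʳ _)) (trans (cong (λ t → ∏ (M ∸_) i (M ∸ i) * t !) (sym eq)) (falling-! M i (M ∸ i) (≤-reflexive (m+[n∸m]≡n p))))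
  where
  eq : M ∸ (i + (M ∸ i)) ≡ 0
  eq = trans (cong (M ∸_) (m+[n∸m]≡n p)) (n∸n≡0 M)

^-*-!-≤ : ∀ x f → x ^ f * x ! ≤ (x + f) !
^-*-!-≤ x zero = ≤-reflexive (trans (+-identityʳ _) (cong _! (sym (+-identityʳ x))))
^-*-!-≤ x (suc f) = begin
    x * x ^ f * x !      ≡⟨ *-assoc x (x ^ f) _ ⟩
    x * (x ^ f * x !)    ≤⟨ *-mono-≤ (≤-trans (m≤m+n x f) (n≤1+n _)) (^-*-!-≤ x f) ⟩
    suc (x + f) * (x + f) ! ≡⟨ cong _! (sym (+-suc x f)) ⟩
    (x + suc f) ! ∎
  where open ≤-Reasoning

trues falses : List Bool → ℕ
trues [] = 0
trues (true ∷ w) = suc (trues w)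
trues (false ∷ w) = trues w
falses [] = 0
falses (true ∷ w) = falses w
falses (false ∷ w) = suc (falses w)

falses+trues : ∀ w → falses w + trues w ≡ length w
falses+trues [] = refl
falses+trues (true ∷ w) = trans (+-suc _ _) (cong suc (falses+trues w))
falses+trues (false ∷ w) = cong suc (falses+trues w)

module _ {A : Set} where

  pick₁ pick₀ : List Bool → List A → List A
  pick₁ (true ∷ w) (x ∷ xs) = x ∷ pick₁ w xs
  pick₁ (false ∷ w) (x ∷ xs) = pick₁ w xs
  pick₁ _ _ = []
  pick₀ (true ∷ w) (x ∷ xs) = pick₀ w xs
  pick₀ (false ∷ w) (x ∷ xs) = x ∷ pick₀ w xs
  pick₀ _ _ = []

  merge : List Bool → List A → List A → List A
  merge (true ∷ w) ρ (x ∷ φ) = x ∷ merge w ρ φ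
  merge (false ∷ w) (x ∷ ρ) φ = x ∷ merge w ρ φ
  merge _ _ _ = []

  merge-pick : ∀ w xs → length xs ≡ length w → merge w (pick₀ w xs) (pick₁ w xs) ≡ xs
  merge-pick [] [] _ = refl
  merge-pick (true ∷ w) (x ∷ xs) p = cong (x ∷_) (merge-pick w xs (suc-injective p))
  merge-pick (false ∷ w) (x ∷ xs) p = cong (x ∷_) (merge-pick w xs (suc-injective p))

  length-pick₁ : ∀ w (xs : List A) → length xs ≡ length w → length (pick₁ w xs) ≡ trues w
  length-pick₁ [] [] _ = refl
  length-pick₁ (true ∷ w) (x ∷ xs) p = cong suc (length-pick₁ w xs (suc-injective p))
  length-pick₁ (false ∷ w) (x ∷ xs) p = length-pick₁ w xs (suc-injective p)

  length-pick₀ : ∀ w (xs : List A) → length xs ≡ length w → length (pick₀ w xs) ≡ falses w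
  length-pick₀ [] [] _ = refl
  length-pick₀ (true ∷ w) (x ∷ xs) p = length-pick₀ w xs (suc-injective p)
  length-pick₀ (false ∷ w) (x ∷ xs) p = cong suc (length-pick₀ w xs (suc-injective p))

  ∈-pick₁ : ∀ w {xs} {e : A} → e ∈ pick₁ w xs → e ∈ xs
  ∈-pick₁ (true ∷ w) {x ∷ xs} (here p) = here p
  ∈-pick₁ (true ∷ w) {x ∷ xs} (there p) = there (∈-pick₁ w p)
  ∈-pick₁ (false ∷ w) {x ∷ xs} p = there (∈-pick₁ w p)

  ∈-pick₀ : ∀ w {xs} {e : A} → e ∈ pick₀ w xs → e ∈ xs
  ∈-pick₀ (false ∷ w) {x ∷ xs} (here p) = here p
  ∈-pick₀ (false ∷ w) {x ∷ xs} (there p) = there (∈-pick₀ w p)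
  ∈-pick₀ (true ∷ w) {x ∷ xs} p = there (∈-pick₀ w p)

  Unique-pick : ∀ w {xs : List A} → Unique xs → Unique (pick₁ w xs) × Unique (pick₀ w xs) × (∀ {e} → e ∈ pick₀ w xs → e ∉ pick₁ w xs)
  Unique-pick [] u = [] , [] , λ ()
  Unique-pick (true ∷ w) {[]} u = [] , [] , λ ()
  Unique-pick (false ∷ w) {[]} u = [] , [] , λ ()
  Unique-pick (true ∷ w) {x ∷ xs} (x∉ ∷ u) with Unique-pick w u
  ... | u₁ , u₀ , d = (All.tabulate (λ p → All.lookup x∉ (∈-pick₁ w p)) ∷ u₁) , u₀ ,
        λ { p (here refl) → All.lookup x∉ (∈-pick₀ w p) refl ; p (there q) → d p q }
  Unique-pick (false ∷ w) {x ∷ xs} (x∉ ∷ u) with Unique-pick w u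
  ... | u₁ , u₀ , d = u₁ , (All.tabulate (λ p → All.lookup x∉ (∈-pick₀ w p)) ∷ u₀) ,
        λ { (here refl) q → All.lookup x∉ (∈-pick₁ w q) refl ; (there p) q → d p q }

  module _ {P : A → Set} (P? : Decidable P) where
    mask : List A → List Bool
    mask = map (λ x → does (P? x))

    pick₁-mask : ∀ xs → pick₁ (mask xs) xs ≡ filter P? xs
    pick₁-mask [] = refl
    pick₁-mask (x ∷ xs) with does (P? x)
    ... | true  = cong (x ∷_) (pick₁-mask xs)
    ... | false = pick₁-mask xs

    pick₀-mask : ∀ xs → pick₀ (mask xs) xs ≡ filter (λ x → ¬? (P? x)) xs
    pick₀-mask [] = refl
    pick₀-mask (x ∷ xs) with does (P? x)
    ... | true  = pick₀-mask xs
    ... | false = cong (x ∷_) (pick₀-mask xs)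

-- `length (masks m f)` is the binomial coefficient C(m,f). The bounds below, (m - f)^f ≤ C(m,f) f!
-- ≤ m^f, come from Pascal's rule and the two Bernoulli inequalities.
masks : ℕ → ℕ → List (List Bool)
masks zero zero = [ [] ]
masks zero (suc f) = []
masks (suc m) zero = map (false ∷_) (masks m zero)
masks (suc m) (suc f) = map (true ∷_) (masks m f) ++ map (false ∷_) (masks m (suc f))

∈-masks : ∀ w → w ∈ masks (length w) (trues w)
∈-masks [] = here refl
∈-masks (true ∷ w) = ∈-++⁺ˡ (∈-map⁺ _ (∈-masks w))
∈-masks (false ∷ w) with trues w | ∈-masks w
... | zero  | p = ∈-map⁺ _ p
... | suc f | p = ∈-++⁺ʳ (map (true ∷_) (masks (length w) f)) (∈-map⁺ _ p)

masks-sound : ∀ m f {w} → w ∈ masks m f → length w ≡ m × trues w ≡ f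
masks-sound zero zero (here refl) = refl , refl
masks-sound (suc m) zero p with ∈-map⁻ (false ∷_) p
... | w , w∈ , refl with masks-sound m zero w∈
...   | q , r = cong suc q , r
masks-sound (suc m) (suc f) p with ∈-++⁻ (map (true ∷_) (masks m f)) p
... | inj₁ q with ∈-map⁻ (true ∷_) q
...   | w , w∈ , refl with masks-sound m f w∈
...     | a , b = cong suc a , cong suc b
masks-sound (suc m) (suc f) p | inj₂ q with ∈-map⁻ (false ∷_) q
...   | w , w∈ , refl with masks-sound m (suc f) w∈
...     | a , b = cong suc a , b

Bernoulli : ∀ m f → m ^ suc f + suc f * m ^ f ≤ suc m ^ suc f
Bernoulli m zero = ≤-reflexive (lem m)
  where
  lem : ∀ m → m * 1 + 1 ≡ suc (m * 1)
  lem = solve-∀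
Bernoulli m (suc f) = begin
    m * m ^ suc f + suc (suc f) * m ^ suc f ≤⟨ m≤m+n _ (suc f * m ^ f) ⟩
    m * m ^ suc f + suc (suc f) * m ^ suc f + suc f * m ^ f ≡⟨ lem m (m ^ f) f ⟩
    suc m * (m ^ suc f + suc f * m ^ f)  ≤⟨ *-monoʳ-≤ (suc m) (Bernoulli m f) ⟩
    suc m * suc m ^ suc f ∎
  where
  open ≤-Reasoning
  lem : ∀ m p f → m * (m * p) + suc (suc f) * (m * p) + suc f * p ≡ suc m * (m * p + suc f * p)
  lem = solve-∀

masks-pascal : ∀ m f → length (masks (suc m) (suc f)) ≡ length (masks m f) + length (masks m (suc f))
masks-pascal m f = trans (length-++ (map (true ∷_) (masks m f))) (cong₂ _+_ (length-map _ (masks m f)) (length-map _ (masks m (suc f))))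

masks-0 : ∀ m → length (masks m 0) ≡ 1
masks-0 zero = refl
masks-0 (suc m) = trans (length-map _ (masks m 0)) (masks-0 m)

masks-upper : ∀ m f → length (masks m f) * f ! ≤ m ^ f
masks-upper m zero = ≤-reflexive (cong (_* 1) (masks-0 m))
masks-upper zero (suc f) = z≤n
masks-upper (suc m) (suc f) = begin
    length (masks (suc m) (suc f)) * (suc f * f !)   ≡⟨ cong (_* (suc f * f !)) (masks-pascal m f) ⟩
    (a + b) * (suc f * f !)                          ≡⟨ lem a b (suc f) (f !) ⟩
    b * (suc f * f !) + suc f * (a * f !)            ≤⟨ +-mono-≤ (masks-upper m (suc f)) (*-monoʳ-≤ (suc f) (masks-upper m f)) ⟩
    m ^ suc f + suc f * m ^ f                        ≤⟨ Bernoulli m f ⟩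
    suc m ^ suc f ∎
  where
  open ≤-Reasoning
  a = length (masks m f)
  b = length (masks m (suc f))
  lem : ∀ a b s p → (a + b) * (s * p) ≡ b * (s * p) + s * (a * p)
  lem = solve-∀

Bernoulli′ : ∀ x f → suc x ^ suc f ≤ x ^ suc f + suc f * suc x ^ f
Bernoulli′ x zero = ≤-reflexive (lem x)
  where
  lem : ∀ x → suc (x * 1) ≡ x * 1 + 1
  lem = solve-∀
Bernoulli′ x (suc f) = begin
    suc x * suc x ^ suc f                                ≡⟨⟩
    suc x ^ suc f + x * suc x ^ suc f                    ≤⟨ +-monoʳ-≤ (suc x ^ suc f) (*-monoʳ-≤ x (Bernoulli′ x f)) ⟩
    suc x ^ suc f + x * (x ^ suc f + suc f * suc x ^ f)  ≤⟨ m≤m+n _ (suc f * suc x ^ f) ⟩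
    suc x ^ suc f + x * (x ^ suc f + suc f * suc x ^ f) + suc f * suc x ^ f ≡⟨ lem x (suc x ^ f) (x ^ suc f) f ⟩
    x * x ^ suc f + suc (suc f) * suc x ^ suc f ∎
  where
  open ≤-Reasoning
  lem : ∀ x p q f → suc x * p + x * (q + suc f * p) + suc f * p ≡ x * q + suc (suc f) * (suc x * p)
  lem = solve-∀

masks-lower : ∀ m f → (m ∸ f) ^ f ≤ length (masks m f) * f !
masks-lower m zero = ≤-reflexive (sym (cong (_* 1) (masks-0 m)))
masks-lower zero (suc f) = z≤n
masks-lower (suc m) (suc f) = begin
    (m ∸ f) ^ suc f                                        ≤⟨ step (m ∸ f) (sym (pred[m∸n]≡m∸[1+n] m f)) ⟩
    (m ∸ suc f) ^ suc f + suc f * (m ∸ f) ^ f              ≤⟨ +-mono-≤ (masks-lower m (suc f)) (*-monoʳ-≤ (suc f) (masks-lower m f)) ⟩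
    b * (suc f * f !) + suc f * (a * f !)                  ≡⟨ sym (lem a b (suc f) (f !)) ⟩
    (a + b) * (suc f * f !)                                ≡⟨ cong (_* (suc f * f !)) (sym (masks-pascal m f)) ⟩
    length (masks (suc m) (suc f)) * (suc f * f !) ∎
  where
  open ≤-Reasoning
  a = length (masks m f)
  b = length (masks m (suc f))
  lem : ∀ a b s p → (a + b) * (s * p) ≡ b * (s * p) + s * (a * p)
  lem = solve-∀
  -- Truncated subtraction: if `m ∸ f` is 0, so is `m ∸ suc f`, and the left side vanishes.
  step : ∀ d {e} → e ≡ pred d → d ^ suc f ≤ e ^ suc f + suc f * d ^ f
  step zero _ = z≤n
  step (suc d) refl = Bernoulli′ d f

masks-2^ : ∀ m f → length (masks m f) ≤ 2 ^ m
masks-2^ zero zero = ≤-refl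
masks-2^ zero (suc f) = z≤n
masks-2^ (suc m) zero = ≤-trans (≤-reflexive (trans (length-map _ (masks m 0)) (masks-0 m))) (m^n>0 2 (suc m))
masks-2^ (suc m) (suc f) = begin
  length (masks (suc m) (suc f)) ≡⟨ masks-pascal m f ⟩
  length (masks m f) + length (masks m (suc f)) ≤⟨ +-mono-≤ (masks-2^ m f) (≤-trans (masks-2^ m (suc f)) (m≤m+n _ 0)) ⟩
  2 ^ suc m ∎
  where open ≤-Reasoning

-- Counting masks of length 2f with f marks gives f^f ≤ C(2f,f) f! ≤ 4^f f!.
^-self-≤ : ∀ f → f ^ f ≤ 4 ^ f * f !
^-self-≤ f = begin
  f ^ f                           ≡⟨ cong (_^ f) (sym (m+n∸n≡m f f)) ⟩
  (f + f ∸ f) ^ f                 ≤⟨ masks-lower (f + f) f ⟩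
  length (masks (f + f) f) * f !  ≤⟨ *-monoˡ-≤ (f !) (masks-2^ (f + f) f) ⟩
  2 ^ (f + f) * f !               ≡⟨ cong (_* f !) (trans (cong (2 ^_) (lem f)) (sym (^-*-assoc 2 2 f))) ⟩
  4 ^ f * f ! ∎
  where
  open ≤-Reasoning
  lem : ∀ f → f + f ≡ 2 * f
  lem = solve-∀

^-distribʳ-* : ∀ a b f → (a * b) ^ f ≡ a ^ f * b ^ f
^-distribʳ-* a b zero = refl
^-distribʳ-* a b (suc f) = trans (cong (a * b *_) (^-distribʳ-* a b f)) (lem a b (a ^ f) (b ^ f))
  where
  lem : ∀ a b p q → a * b * (p * q) ≡ a * p * (b * q)
  lem = solve-∀

-- In other words C(m,f) ≤ (4m/f)^f. The division by f^f later pays for candidate sets whose size is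
-- proportional to f.
masks-bound : ∀ m f → length (masks m f) * f ^ f ≤ (4 * m) ^ f
masks-bound m f = begin
  length (masks m f) * f ^ f           ≤⟨ *-monoʳ-≤ (length (masks m f)) (^-self-≤ f) ⟩
  length (masks m f) * (4 ^ f * f !)   ≡⟨ lem (length (masks m f)) (4 ^ f) (f !) ⟩
  4 ^ f * (length (masks m f) * f !)   ≤⟨ *-monoʳ-≤ (4 ^ f) (masks-upper m f) ⟩
  4 ^ f * m ^ f                        ≡⟨ sym (^-distribʳ-* 4 m f) ⟩
  (4 * m) ^ f ∎
  where
  open ≤-Reasoning
  lem : ∀ a b c → a * (b * c) ≡ b * (a * c)
  lem = solve-∀

module _ {A : Set} where

  -- The tree of continuations of `π` in which each entry is drawn from `Q` of everything revealed
  -- so far. When the size of `Q` is bounded in terms of the position alone, `length-gen` is the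
  -- chain rule for conditional probabilities.
  gen : (List A → List A) → ℕ → List A → List (List A)
  gen Q zero π = [ [] ]
  gen Q (suc m) π = concatMap (λ e → map (e ∷_) (gen Q m (π ++ [ e ]))) (Q π)

  length-gen : ∀ {Q c} → (∀ π → length (Q π) ≤ c (length π)) → ∀ m π → length (gen Q m π) ≤ ∏ c (length π) m
  length-gen h zero π = ≤-refl
  length-gen {Q} {c} h (suc m) π = begin
      length (gen Q (suc m) π)             ≤⟨ length-concatMap-≤ _ (Q π) (λ {e} _ → step e) ⟩
      length (Q π) * ∏ c (suc (length π)) m ≤⟨ *-monoˡ-≤ _ (h π) ⟩
      ∏ c (length π) (suc m) ∎
    where
    open ≤-Reasoning
    step : ∀ e → length (map (e ∷_) (gen Q m (π ++ [ e ]))) ≤ ∏ c (suc (length π)) m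
    step e = begin
      length (map (e ∷_) (gen Q m (π ++ [ e ]))) ≡⟨ length-map (e ∷_) (gen Q m (π ++ [ e ])) ⟩
      length (gen Q m (π ++ [ e ]))              ≤⟨ length-gen h m (π ++ [ e ]) ⟩
      ∏ c (length (π ++ [ e ])) m                ≡⟨ cong (λ t → ∏ c t m) (trans (length-++ π) (+-comm (length π) 1)) ⟩
      ∏ c (suc (length π)) m ∎

  gen-length : ∀ {Q} m π {σ} → σ ∈ gen Q m π → length σ ≡ m
  gen-length zero π (here refl) = refl
  gen-length {Q} (suc m) π σ∈ with ∈-concatMap-elim (λ e → map (e ∷_) (gen Q m (π ++ [ e ]))) (Q π) σ∈
  ... | e , _ , q with ∈-map⁻ (e ∷_) q
  ...   | τ , τ∈ , refl = cong suc (gen-length m (π ++ [ e ]) τ∈)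

  ∈-gen : ∀ {Q} σ π → (∀ α e β → σ ≡ α ++ e ∷ β → e ∈ Q (π ++ α)) → σ ∈ gen Q (length σ) π
  ∈-gen [] π h = here refl
  ∈-gen {Q} (e ∷ σ) π h = ∈-concatMap-intro (λ e → map (e ∷_) (gen Q (length σ) (π ++ [ e ])))
    (subst (λ t → e ∈ Q t) (++-identityʳ π) (h [] e σ refl))
    (∈-map⁺ (e ∷_) (∈-gen σ (π ++ [ e ]) λ α e′ β eq →
      subst (λ t → e′ ∈ Q t) (sym (++-assoc π [ e ] α)) (h (e ∷ α) e′ β (cong (e ∷_) eq))))

-- Rare properties of orderings

module Orderings {A : Set} (_≟ᴬ_ : DecidableEquality A) (pool : List A) (pool! : Unique pool) where

  open import Data.List.Membership.DecPropositional _≟ᴬ_ using (_∈?_)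

  M : ℕ
  M = length pool

  ordering-Unique : ∀ {σ} → σ ↭ pool → Unique σ
  ordering-Unique p = PermSetoid.Unique-resp-↭ (setoid A) (↭⇒↭ₛ (↭-sym p)) pool!

  ordering-⊆ : ∀ {σ e} → σ ↭ pool → e ∈ σ → e ∈ pool
  ordering-⊆ p = ∈-resp-↭ p

  -- The take discards nothing when π ++ Z is duplicate-free; it makes the length bound hold for every π.
  fresh : List A → List A → List A
  fresh Z π = take (M ∸ length π ∸ length Z) (filter (λ e → ¬? (e ∈? π ++ Z)) pool)

  length-fresh : ∀ Z π → length (fresh Z π) ≤ M ∸ length π ∸ length Z
  length-fresh Z π = length-take-≤ _ (filter (λ e → ¬? (e ∈? π ++ Z)) pool)

  ∈-fresh : ∀ Z π {e} → Unique (π ++ Z) → (∀ {x} → x ∈ π ++ Z → x ∈ pool) → e ∈ pool → e ∉ π ++ Z → e ∈ fresh Z π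
  ∈-fresh Z π {e} u ⊆pool e∈ e∉ = subst (e ∈_) (sym (take-all len)) (∈-filter⁺ (λ e → ¬? (e ∈? π ++ Z)) e∈ e∉)
    where
    open ≤-Reasoning
    rest = filter (λ e → ¬? (e ∈? π ++ Z)) pool
    total : length rest + length (π ++ Z) ≤ M
    total = ≤-trans (≤-reflexive (sym (length-++ rest)))
      (Unique-⊆-length (Unique-++⁺ (Unique.filter⁺ _ pool!) u λ p → proj₂ (∈-filter⁻ (λ e → ¬? (e ∈? π ++ Z)) {xs = pool} p))
        λ p → [ proj₁ ∘ ∈-filter⁻ _ , ⊆pool ]′ (∈-++⁻ rest p))
    len : length rest ≤ M ∸ length π ∸ length Z
    len = begin
      length rest                            ≤⟨ m+n≤o⇒m≤o∸n (length rest) total ⟩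
      M ∸ length (π ++ Z)                    ≡⟨ cong (M ∸_) (length-++ π) ⟩
      M ∸ (length π + length Z)              ≡⟨ sym (∸-+-assoc M (length π) (length Z)) ⟩
      M ∸ length π ∸ length Z ∎

  -- "P has probability at most Y / X": the orderings satisfying P are enumerated by a list of length ≤ (Y / X) · M!.
  record Rare (X Y : ℕ) (P : List A → Set) : Set where
    constructor rare
    field
      cover      : List (List A)
      cover-size : X * length cover ≤ Y * M !
      cover-∈    : ∀ {σ} → σ ↭ pool → P σ → σ ∈ cover

  Rare-map : ∀ {X Y P Q} → (∀ {σ} → σ ↭ pool → P σ → Q σ) → Rare X Y Q → Rare X Y P
  Rare-map f (rare B b m) = rare B b λ p q → m p (f p q)

  Rare-weaken : ∀ {X Y X′ Y′ P} → 0 < X → Y * X′ ≤ Y′ * X → Rare X Y P → Rare X′ Y′ P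
  Rare-weaken {X} {Y} {X′} {Y′} X>0 h (rare B b m) = rare B (*-cancelʳ-≤ _ _ X {{>-nonZero X>0}} (begin
      X′ * length B * X     ≡⟨ l₁ X′ (length B) X ⟩
      X * length B * X′     ≤⟨ *-monoˡ-≤ X′ b ⟩
      Y * M ! * X′          ≡⟨ l₂ Y (M !) X′ ⟩
      Y * X′ * M !          ≤⟨ *-monoˡ-≤ (M !) h ⟩
      Y′ * X * M !          ≡⟨ l₂ Y′ X (M !) ⟩
      Y′ * M ! * X ∎)) m
    where
    open ≤-Reasoning
    l₁ : ∀ a b c → a * b * c ≡ c * b * a
    l₁ = solve-∀
    l₂ : ∀ a b c → a * b * c ≡ a * c * b
    l₂ = solve-∀

  Rare-⊎ : ∀ {X Y Y′ P Q} → Rare X Y P → Rare X Y′ Q → Rare X (Y + Y′) (λ σ → P σ ⊎ Q σ)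
  Rare-⊎ {X} {Y} {Y′} (rare B b m) (rare B′ b′ m′) = rare (B ++ B′) (begin
      X * length (B ++ B′)              ≡⟨ cong (X *_) (length-++ B) ⟩
      X * (length B + length B′)        ≡⟨ *-distribˡ-+ X _ _ ⟩
      X * length B + X * length B′      ≤⟨ +-mono-≤ b b′ ⟩
      Y * M ! + Y′ * M !                ≡⟨ sym (*-distribʳ-+ (M !) Y Y′) ⟩
      (Y + Y′) * M ! ∎) λ p → [ ∈-++⁺ˡ ∘ m p , ∈-++⁺ʳ B ∘ m′ p ]′
    where open ≤-Reasoning

  Rare-∃ : ∀ {X Y} {J : Set} (I : List J) {P : J → List A → Set} → (∀ {j} → j ∈ I → Rare X Y (P j)) →
           Rare X (length I * Y) (λ σ → ∃[ j ] (j ∈ I × P j σ))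
  Rare-∃ {X} [] h = rare [] (≤-reflexive (*-zeroʳ X)) λ { _ (_ , () , _) }
  Rare-∃ (i ∷ I) h = Rare-map (λ { _ (j , here refl , q) → inj₁ q ; _ (j , there j∈ , q) → inj₂ (j , j∈ , q) })
    (Rare-⊎ (h (here refl)) (Rare-∃ I (h ∘ there)))

  -- The bounds 1/(k 2^f) sum to less than 1/k. Over the common denominator `k * 2 ^ G` the partial
  -- sum has numerator exactly `2 ^ G ∸ 1`, so the induction loses nothing.
  Rare-geometric : ∀ {k} {P : ℕ → List A → Set} F → 0 < k → (∀ f → 1 ≤ f → f ≤ F → Rare (k * 2 ^ f) 1 (P f)) →
                   Rare k 1 (λ σ → ∃[ f ] (1 ≤ f × f ≤ F × P f σ))
  Rare-geometric {k} {P} F k>0 h = Rare-weaken (*-mono-≤ k>0 (m^n>0 2 F))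
      (≤-trans (≤-reflexive (*-comm (2 ^ F ∸ 1) k)) (≤-trans (*-monoʳ-≤ k (m∸n≤m (2 ^ F) 1)) (≤-reflexive (sym (*-identityˡ _))))) (go F ≤-refl)
    where
    Sum : ℕ → List A → Set
    Sum G σ = ∃[ f ] (1 ≤ f × f ≤ G × P f σ)
    go : ∀ G → G ≤ F → Rare (k * 2 ^ G) (2 ^ G ∸ 1) (Sum G)
    go zero G≤ = rare [] (≤-reflexive (*-zeroʳ (k * 1))) λ { _ (f , 1≤ , ≤0 , _) → contradiction (≤-trans 1≤ ≤0) λ () }
    go (suc G) G≤ = Rare-map split (Rare-⊎-double (go G (≤-trans (n≤1+n G) G≤)) (h (suc G) (s≤s z≤n) G≤))
      where
      split : ∀ {σ} → σ ↭ pool → Sum (suc G) σ → Sum G σ ⊎ P (suc G) σ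
      split _ (f , 1≤ , ≤G , q) with m≤n⇒m<n∨m≡n ≤G
      ... | inj₁ (s≤s f≤) = inj₁ (f , 1≤ , f≤ , q)
      ... | inj₂ refl = inj₂ q
      arith : ∀ t → 1 ≤ t → (t ∸ 1) * 2 + 1 ≡ 2 * t ∸ 1
      arith (suc t) _ = l t
        where
        l : ∀ t → t * 2 + 1 ≡ t + suc (t + 0)
        l = solve-∀
      Rare-⊎-double : ∀ {P Q} → Rare (k * 2 ^ G) (2 ^ G ∸ 1) P → Rare (k * 2 ^ suc G) 1 Q → Rare (k * 2 ^ suc G) (2 ^ suc G ∸ 1) (λ σ → P σ ⊎ Q σ)
      Rare-⊎-double {P} {Q} (rare B b m) rq = subst (λ Y → Rare (k * 2 ^ suc G) Y (λ σ → P σ ⊎ Q σ)) (arith (2 ^ G) (m^n>0 2 G))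
        (Rare-⊎ (rare B (≤-trans (≤-reflexive (l₁ k (2 ^ G) (length B))) (≤-trans (*-monoˡ-≤ 2 b) (≤-reflexive (l₂ (2 ^ G ∸ 1) (M !))))) m) rq)
        where
        l₁ : ∀ a b c → a * (2 * b) * c ≡ a * b * c * 2
        l₁ = solve-∀
        l₂ : ∀ a b → a * b * 2 ≡ a * 2 * b
        l₂ = solve-∀

  ∈-fresh-next : ∀ {Z} π {e} β → Unique (π ++ e ∷ β) → Unique Z → (∀ {x} → x ∈ π ++ e ∷ β → x ∈ pool) → (∀ {x} → x ∈ Z → x ∈ pool) →
                 (∀ {x} → x ∈ π ++ [ e ] → x ∉ Z) → e ∈ fresh Z π
  ∈-fresh-next {Z} π {e} β u uZ ⊆pool Z⊆ avoid with Unique-++⁻ π u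
  ... | uπ , _ , d = ∈-fresh Z π (Unique-++⁺ uπ uZ (avoid ∘ ∈-++⁺ˡ))
        (λ p → [ ⊆pool ∘ ∈-++⁺ˡ , Z⊆ ]′ (∈-++⁻ π p)) (⊆pool (∈-insert π))
        (λ p → [ (λ q → d q (here refl)) , avoid (∈-insert π) ]′ (∈-++⁻ π p))

  tail-∈-gen : ∀ π τ → Unique (π ++ τ) → (∀ {x} → x ∈ π ++ τ → x ∈ pool) → τ ∈ gen (fresh []) (length τ) π
  tail-∈-gen π τ u ⊆pool = ∈-gen τ π λ { α e β refl →
    let eq = ++-assoc π α (e ∷ β) in
    ∈-fresh-next (π ++ α) β (subst Unique (sym eq) u) [] (λ p → ⊆pool (subst (_ ∈_) eq p)) (λ ()) (λ _ ()) }

  length-fresh-[] : ∀ π → length (fresh [] π) ≤ M ∸ length π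
  length-fresh-[] π = length-fresh [] π

  module _ (w : List Bool) (w≤M : length w ≤ M) (R : List A → List A → List A) (q : ℕ → ℕ)
           (R-bound : ∀ ρ α → length (R ρ α) ≤ q (length α)) where

    Picked : List A → Set
    Picked σ = ∀ α e β → pick₁ w (take (length w) σ) ≡ α ++ e ∷ β → e ∈ R (pick₀ w (take (length w) σ)) α

    -- The marked positions are revealed after the unmarked ones of the first length w and before all others.
    Rare-hit : Rare ((M ∸ length w) ^ trues w) (∏ q 0 (trues w)) Picked
    Rare-hit = rare B bound member
      where
      m = length w
      f = trues w
      g = falses w
      x = M ∸ m
      inner : List A → List A → List (List A)
      inner ρ φ = map (merge w ρ φ ++_) (gen (fresh []) x (ρ ++ φ))
      mid : List A → List (List A)
      mid ρ = concatMap (inner ρ) (gen (R ρ) f [])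
      B = concatMap mid (gen (fresh []) g [])
      g≤M : g ≤ M
      g≤M = ≤-trans (≤-trans (m≤m+n g f) (≤-reflexive (falses+trues w))) w≤M
      M-eq : x + f ≡ M ∸ g
      M-eq = +-cancelʳ-≡ g (x + f) (M ∸ g) (begin
          x + f + g       ≡⟨ trans (+-assoc x f g) (cong (x +_) (trans (+-comm f g) (falses+trues w))) ⟩
          x + m           ≡⟨ m∸n+n≡m w≤M ⟩
          M               ≡⟨ sym (m∸n+n≡m g≤M) ⟩
          M ∸ g + g ∎)
        where open ≡-Reasoning
      len-inner : ∀ ρ φ → length ρ ≡ g → length φ ≡ f → length (inner ρ φ) ≤ x !
      len-inner ρ φ a b = begin
        length (inner ρ φ)                      ≡⟨ length-map _ (gen (fresh []) x (ρ ++ φ)) ⟩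
        length (gen (fresh []) x (ρ ++ φ))      ≤⟨ length-gen length-fresh-[] x (ρ ++ φ) ⟩
        ∏ (M ∸_) (length (ρ ++ φ)) x            ≡⟨ cong (λ t → ∏ (M ∸_) t x) (trans (length-++ ρ) (trans (cong₂ _+_ a b) (falses+trues w))) ⟩
        ∏ (M ∸_) m x                            ≡⟨ falling-all M m w≤M ⟩
        x ! ∎
        where open ≤-Reasoning
      len-mid : ∀ ρ → length ρ ≡ g → length (mid ρ) ≤ ∏ q 0 f * x !
      len-mid ρ a = ≤-trans (length-concatMap-≤ (inner ρ) (gen (R ρ) f []) (λ {φ} φ∈ → len-inner ρ φ a (gen-length f [] φ∈)))
        (*-monoˡ-≤ (x !) (length-gen {c = q} (R-bound ρ) f []))
      bound : x ^ f * length B ≤ ∏ q 0 f * M !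
      bound = begin
          x ^ f * length B                                   ≤⟨ *-monoʳ-≤ (x ^ f) (length-concatMap-≤ mid (gen (fresh []) g []) (λ {ρ} ρ∈ → len-mid ρ (gen-length g [] ρ∈))) ⟩
          x ^ f * (length (gen (fresh []) g []) * (∏ q 0 f * x !)) ≤⟨ *-monoʳ-≤ (x ^ f) (*-monoˡ-≤ _ (length-gen length-fresh-[] g [])) ⟩
          x ^ f * (∏ (M ∸_) 0 g * (∏ q 0 f * x !))           ≡⟨ l (x ^ f) (∏ (M ∸_) 0 g) (∏ q 0 f) (x !) ⟩
          ∏ q 0 f * (∏ (M ∸_) 0 g * (x ^ f * x !))           ≤⟨ *-monoʳ-≤ (∏ q 0 f) (*-monoʳ-≤ (∏ (M ∸_) 0 g) (^-*-!-≤ x f)) ⟩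
          ∏ q 0 f * (∏ (M ∸_) 0 g * (x + f) !)               ≡⟨ cong (λ t → ∏ q 0 f * (∏ (M ∸_) 0 g * t !)) M-eq ⟩
          ∏ q 0 f * (∏ (M ∸_) 0 g * (M ∸ g) !)               ≡⟨ cong (∏ q 0 f *_) (falling-! M 0 g g≤M) ⟩
          ∏ q 0 f * M ! ∎
        where
        open ≤-Reasoning
        l : ∀ a b c d → a * (b * (c * d)) ≡ c * (b * (a * d))
        l = solve-∀
      member : ∀ {σ} → σ ↭ pool → Picked σ → σ ∈ B
      member {σ} σ↭ h = ∈-concatMap-intro mid
            (subst (λ t → ρ ∈ gen (fresh []) t []) (length-pick₀ w σ₁ len₁)
              (tail-∈-gen [] ρ uρ (⊆σ ∘ take-⊆ m σ ∘ ∈-pick₀ w)))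
          (∈-concatMap-intro (inner ρ)
            (subst (λ t → φ ∈ gen (R ρ) t []) (length-pick₁ w σ₁ len₁) (∈-gen φ [] h))
            (subst (_∈ inner ρ φ) eq (∈-map⁺ (merge w ρ φ ++_)
              (subst (λ t → σ₂ ∈ gen (fresh []) t (ρ ++ φ)) (trans (length-drop m σ) (cong (_∸ m) (↭-length σ↭)))
                (tail-∈-gen (ρ ++ φ) σ₂ u-all λ p → ⊆σ ([ take-⊆ m σ ∘ back , (λ r → subst (_ ∈_) (take++drop≡id m σ) (∈-++⁺ʳ σ₁ r)) ]′ (∈-++⁻ (ρ ++ φ) p)))))))
        where
        σ₁ = take m σ
        σ₂ = drop m σ
        ρ = pick₀ w σ₁
        φ = pick₁ w σ₁
        uσ = ordering-Unique σ↭
        ⊆σ : ∀ {e} → e ∈ σ → e ∈ pool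
        ⊆σ = ordering-⊆ σ↭
        len₁ : length σ₁ ≡ length w
        len₁ = length-take-exact σ (≤-trans w≤M (≤-reflexive (sym (↭-length σ↭))))
        u₁₂ = Unique-++⁻ σ₁ (subst Unique (sym (take++drop≡id m σ)) uσ)
        up = Unique-pick w (proj₁ u₁₂)
        uρ = proj₁ (proj₂ up)
        back : ∀ {e} → e ∈ ρ ++ φ → e ∈ σ₁
        back p = [ ∈-pick₀ w , ∈-pick₁ w ]′ (∈-++⁻ ρ p)
        u-all : Unique ((ρ ++ φ) ++ σ₂)
        u-all = Unique-++⁺ (Unique-++⁺ uρ (proj₁ up) (proj₂ (proj₂ up))) (proj₁ (proj₂ u₁₂)) (proj₂ (proj₂ u₁₂) ∘ back)
        eq : merge w ρ φ ++ σ₂ ≡ σ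
        eq = trans (cong (_++ σ₂) (merge-pick w σ₁ len₁)) (take++drop≡id m σ)

  record Avoids (Z : List A → List A) (z m ℓ : ℕ) (σ : List A) : Set where
    constructor avoids
    field
      Z!     : Unique (Z (take m σ))
      Z⊆pool : ∀ {e} → e ∈ Z (take m σ) → e ∈ pool
      Z-size : z ≤ length (Z (take m σ))
      avoid  : ∀ {e} → e ∈ take (m + ℓ) σ → e ∉ Z (take m σ)

  -- As none of the z forbidden elements has appeared yet, position i has at most M - i - z
  -- candidates instead of M - i, and this ratio is at most (M - z)/M. The forbidden set may depend
  -- on the first `m` entries, which are revealed before it is used.
  Rare-avoid : ∀ Z z m ℓ → m + ℓ ≤ M → Rare (M ^ ℓ) ((M ∸ z) ^ ℓ) (Avoids Z z m ℓ)
  Rare-avoid Z z m ℓ m+ℓ≤M = rare B bound member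
    where
    x = M ∸ (m + ℓ)
    -- The forbidden set of an arbitrary `π₁` may have fewer than `z` elements; the `take` forces
    -- the size bound for every `π₁` and discards nothing where `Z-size` holds.
    Q : List A → List A → List A
    Q π₁ π = take (M ∸ length π ∸ z) (fresh (Z π₁) π)
    inner : List A → List A → List (List A)
    inner π₁ π₂ = map (λ τ → π₁ ++ π₂ ++ τ) (gen (fresh []) x (π₁ ++ π₂))
    mid : List A → List (List A)
    mid π₁ = concatMap (inner π₁) (gen (Q π₁) ℓ π₁)
    B = concatMap mid (gen (fresh []) m [])
    c : ℕ → ℕ
    c i = M ∸ i ∸ z
    c-bound : ∀ i ℓ → M ^ ℓ * ∏ c i ℓ ≤ (M ∸ z) ^ ℓ * ∏ (M ∸_) i ℓ
    c-bound i zero = ≤-refl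
    c-bound i (suc ℓ) = begin
        M * M ^ ℓ * (c i * ∏ c (suc i) ℓ)             ≡⟨ l M (M ^ ℓ) (c i) _ ⟩
        M * c i * (M ^ ℓ * ∏ c (suc i) ℓ)             ≤⟨ *-mono-≤ step (c-bound (suc i) ℓ) ⟩
        (M ∸ z) * (M ∸ i) * ((M ∸ z) ^ ℓ * ∏ (M ∸_) (suc i) ℓ) ≡⟨ sym (l (M ∸ z) ((M ∸ z) ^ ℓ) (M ∸ i) _) ⟩
        (M ∸ z) ^ suc ℓ * ∏ (M ∸_) i (suc ℓ) ∎
      where
      open ≤-Reasoning
      l : ∀ a b c d → a * b * (c * d) ≡ a * c * (b * d)
      l = solve-∀
      step : M * c i ≤ (M ∸ z) * (M ∸ i)
      step = begin
        M * (M ∸ i ∸ z)              ≡⟨ *-distribˡ-∸ M (M ∸ i) z ⟩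
        M * (M ∸ i) ∸ M * z          ≤⟨ ∸-monoʳ-≤ (M * (M ∸ i)) (≤-trans (*-monoʳ-≤ z (m∸n≤m M i)) (≤-reflexive (*-comm z M))) ⟩
        M * (M ∸ i) ∸ z * (M ∸ i)    ≡⟨ sym (*-distribʳ-∸ (M ∸ i) M z) ⟩
        (M ∸ z) * (M ∸ i) ∎
    len-inner : ∀ π₁ π₂ → length π₁ ≡ m → length π₂ ≡ ℓ → length (inner π₁ π₂) ≤ x !
    len-inner π₁ π₂ a b = begin
      length (inner π₁ π₂)                      ≡⟨ length-map _ (gen (fresh []) x (π₁ ++ π₂)) ⟩
      length (gen (fresh []) x (π₁ ++ π₂))      ≤⟨ length-gen length-fresh-[] x (π₁ ++ π₂) ⟩
      ∏ (M ∸_) (length (π₁ ++ π₂)) x            ≡⟨ cong (λ t → ∏ (M ∸_) t x) (trans (length-++ π₁) (cong₂ _+_ a b)) ⟩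
      ∏ (M ∸_) (m + ℓ) x                        ≡⟨ falling-all M (m + ℓ) m+ℓ≤M ⟩
      x ! ∎
      where open ≤-Reasoning
    len-mid : ∀ π₁ → length π₁ ≡ m → length (mid π₁) ≤ ∏ c m ℓ * x !
    len-mid π₁ a = ≤-trans (length-concatMap-≤ (inner π₁) (gen (Q π₁) ℓ π₁) (λ {φ} φ∈ → len-inner π₁ φ a (gen-length ℓ π₁ φ∈)))
      (*-monoˡ-≤ (x !) (≤-trans (length-gen {c = c} (λ π → length-take-≤ _ (fresh (Z π₁) π)) ℓ π₁) (≤-reflexive (cong (λ t → ∏ c t ℓ) a))))
    bound : M ^ ℓ * length B ≤ (M ∸ z) ^ ℓ * M !
    bound = begin
        M ^ ℓ * length B                                  ≤⟨ *-monoʳ-≤ (M ^ ℓ) (length-concatMap-≤ mid (gen (fresh []) m []) (λ {ρ} ρ∈ → len-mid ρ (gen-length m [] ρ∈))) ⟩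
        M ^ ℓ * (length (gen (fresh []) m []) * (∏ c m ℓ * x !)) ≤⟨ *-monoʳ-≤ (M ^ ℓ) (*-monoˡ-≤ _ (length-gen length-fresh-[] m [])) ⟩
        M ^ ℓ * (∏ (M ∸_) 0 m * (∏ c m ℓ * x !))          ≡⟨ l (M ^ ℓ) (∏ (M ∸_) 0 m) (∏ c m ℓ) (x !) ⟩
        M ^ ℓ * ∏ c m ℓ * (∏ (M ∸_) 0 m * x !)            ≤⟨ *-monoˡ-≤ _ (c-bound m ℓ) ⟩
        (M ∸ z) ^ ℓ * ∏ (M ∸_) m ℓ * (∏ (M ∸_) 0 m * x !) ≡⟨ l′ ((M ∸ z) ^ ℓ) (∏ (M ∸_) 0 m) (∏ (M ∸_) m ℓ) (x !) ⟩
        (M ∸ z) ^ ℓ * (∏ (M ∸_) 0 m * (∏ (M ∸_) m ℓ * x !)) ≡⟨ cong (λ t → (M ∸ z) ^ ℓ * (∏ (M ∸_) 0 m * t)) (falling-! M m ℓ m+ℓ≤M) ⟩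
        (M ∸ z) ^ ℓ * (∏ (M ∸_) 0 m * (M ∸ m) !)          ≡⟨ cong ((M ∸ z) ^ ℓ *_) (falling-! M 0 m (≤-trans (m≤m+n m ℓ) m+ℓ≤M)) ⟩
        (M ∸ z) ^ ℓ * M ! ∎
      where
      open ≤-Reasoning
      l : ∀ a b c d → a * (b * (c * d)) ≡ a * c * (b * d)
      l = solve-∀
      l′ : ∀ a b c d → a * c * (b * d) ≡ a * (b * (c * d))
      l′ = solve-∀
    member : ∀ {σ} → σ ↭ pool → Avoids Z z m ℓ σ → σ ∈ B
    member {σ} σ↭ h = ∈-concatMap-intro mid
          (subst (λ t → σ₁ ∈ gen (fresh []) t []) len₁ (tail-∈-gen [] σ₁ (proj₁ u₁₂) (⊆σ ∘ take-⊆ m σ)))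
        (∈-concatMap-intro (inner σ₁)
          (subst (λ t → σ₂ ∈ gen (Q σ₁) t σ₁) len₂ (∈-gen σ₂ σ₁ next))
          (subst (_∈ inner σ₁ σ₂) eq₃ (∈-map⁺ (λ τ → σ₁ ++ σ₂ ++ τ)
            (subst (λ t → σ₃ ∈ gen (fresh []) t (σ₁ ++ σ₂)) len₃
              (tail-∈-gen (σ₁ ++ σ₂) σ₃ (subst Unique (sym eq₃′) uσ) λ p → ⊆σ (subst (_ ∈_) eq₃′ p))))))
      where
      open Avoids h
      ⊆σ : ∀ {e} → e ∈ σ → e ∈ pool
      ⊆σ = ordering-⊆ σ↭
      uσ = ordering-Unique σ↭
      σ₁ = take m σ
      σ₂ = take ℓ (drop m σ)
      σ₃ = drop ℓ (drop m σ)
      u₁₂ = Unique-++⁻ σ₁ (subst Unique (sym (take++drop≡id m σ)) uσ)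
      eq₃ : σ₁ ++ σ₂ ++ σ₃ ≡ σ
      eq₃ = trans (cong (σ₁ ++_) (take++drop≡id ℓ (drop m σ))) (take++drop≡id m σ)
      eq₃′ : (σ₁ ++ σ₂) ++ σ₃ ≡ σ
      eq₃′ = trans (++-assoc σ₁ σ₂ σ₃) eq₃
      lσ = ↭-length σ↭
      len₁ : length σ₁ ≡ m
      len₁ = length-take-exact σ (≤-trans (m≤m+n m ℓ) (≤-trans m+ℓ≤M (≤-reflexive (sym lσ))))
      ld : length (drop m σ) ≡ M ∸ m
      ld = trans (length-drop m σ) (cong (_∸ m) lσ)
      len₂ : length σ₂ ≡ ℓ
      len₂ = length-take-exact (drop m σ) (≤-trans (m+n≤o⇒m≤o∸n ℓ (≤-trans (≤-reflexive (+-comm ℓ m)) m+ℓ≤M)) (≤-reflexive (sym ld)))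
      len₃ : length σ₃ ≡ x
      len₃ = trans (length-drop ℓ (drop m σ)) (trans (cong (_∸ ℓ) ld) (∸-+-assoc M m ℓ))
      take-12 : ∀ {e} → e ∈ σ₁ ++ σ₂ → e ∈ take (m + ℓ) σ
      take-12 = subst (_ ∈_) (sym (take-+ m σ))
        where
        take-+ : ∀ m xs → take (m + ℓ) xs ≡ take m xs ++ take ℓ (drop m xs)
        take-+ zero xs = refl
        take-+ (suc m) [] = sym (take-all {m = ℓ} z≤n)
        take-+ (suc m) (x ∷ xs) = cong (x ∷_) (take-+ m xs)
      next : ∀ α e β → σ₂ ≡ α ++ e ∷ β → e ∈ Q σ₁ (σ₁ ++ α)
      next α e β eq = subst (e ∈_) (sym (take-all (≤-trans (length-fresh (Z σ₁) (σ₁ ++ α)) (∸-monoʳ-≤ (M ∸ length (σ₁ ++ α)) Z-size))))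
          (∈-fresh-next (σ₁ ++ α) (β ++ σ₃) (subst Unique (sym whole) uσ) Z! (λ p → ⊆σ (subst (_ ∈_) whole p)) Z⊆pool
            λ p → avoid (take-12 (subst (_ ∈_) (cong (σ₁ ++_) (sym eq)) (prefix p))))
        where
        whole : (σ₁ ++ α) ++ e ∷ (β ++ σ₃) ≡ σ
        whole = trans (++-assoc σ₁ α _) (trans (cong (σ₁ ++_) (trans (sym (++-assoc α (e ∷ β) σ₃)) (cong (_++ σ₃) (sym eq)))) eq₃)
        prefix : ∀ {y} → y ∈ (σ₁ ++ α) ++ [ e ] → y ∈ σ₁ ++ (α ++ e ∷ β)
        prefix {y} p with ∈-++⁻ (σ₁ ++ α) p
        ... | inj₂ (here refl) = ∈-++⁺ʳ σ₁ (∈-insert α)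
        ... | inj₁ q with ∈-++⁻ σ₁ q
        ...   | inj₁ r = ∈-++⁺ˡ r
        ...   | inj₂ r = ∈-++⁺ʳ σ₁ (∈-++⁺ˡ r)

-- Union bounds over early positions

^-self-positive : ∀ f → 0 < f ^ f
^-self-positive zero = s≤s z≤n
^-self-positive (suc f) = m^n>0 (suc f) (suc f)

∏-const : ∀ q i f → ∏ (λ _ → q) i f ≡ q ^ f
∏-const q i zero = refl
∏-const q i (suc f) = cong (q *_) (∏-const q (suc i) f)

binomial-lower : ∀ y z c → y ^ suc c + suc c * z * y ^ c ≤ (y + z) ^ suc c
binomial-lower y z zero = ≤-reflexive (l y z)
  where
  l : ∀ y z → y * 1 + (z + 0) * 1 ≡ (y + z) * 1
  l = solve-∀
binomial-lower y z (suc c) = begin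
    y * (y * p) + suc (suc c) * z * (y * p)               ≤⟨ m≤m+n _ (suc c * z * p * z) ⟩
    y * (y * p) + suc (suc c) * z * (y * p) + suc c * z * p * z ≡⟨ l y z c p ⟩
    (y + z) * (y * p + suc c * z * p)                     ≤⟨ *-monoʳ-≤ (y + z) (binomial-lower y z c) ⟩
    (y + z) * (y + z) ^ suc c ∎
  where
  open ≤-Reasoning
  p = y ^ c
  l : ∀ y z c p → y * (y * p) + suc (suc c) * z * (y * p) + suc c * z * p * z ≡ (y + z) * (y * p + suc c * z * p)
  l = solve-∀

-- With y = M - z, the binomial expansion of (y + z)^c starts with y^c and c z y^(c-1), and the
-- second term is at least the first when M ≤ c z. So each block of c draws avoiding z elements
-- costs a factor 2.
halving : ∀ M z c → 0 < M → M ≤ c * z → 2 * (M ∸ z) ^ c ≤ M ^ c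
halving M z zero M>0 h = contradiction (≤-trans M>0 h) λ ()
halving M z (suc c) M>0 h with ≤-total z M
... | inj₂ M≤z rewrite m≤n⇒m∸n≡0 M≤z = z≤n
... | inj₁ z≤M = begin
    2 * y ^ suc c                       ≡⟨ l (y ^ suc c) ⟩
    y ^ suc c + y * y ^ c               ≤⟨ +-monoʳ-≤ (y ^ suc c) (*-monoˡ-≤ (y ^ c) (≤-trans (m∸n≤m M z) h)) ⟩
    y ^ suc c + suc c * z * y ^ c       ≤⟨ binomial-lower y z c ⟩
    (y + z) ^ suc c                     ≡⟨ cong (_^ suc c) (m∸n+n≡m z≤M) ⟩
    M ^ suc c ∎
  where
  open ≤-Reasoning
  y = M ∸ z
  l : ∀ a → 2 * a ≡ a + a
  l = solve-∀

labelAt : List Bool → ℕ → Bool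
labelAt [] _ = false
labelAt (b ∷ l) zero = b
labelAt (b ∷ l) (suc j) = labelAt l j

∏-labels : ∀ q₀ q₁ l → ∏ (λ j → if labelAt l j then q₁ else q₀) 0 (length l) ≡ q₁ ^ trues l * q₀ ^ falses l
∏-labels q₀ q₁ [] = refl
∏-labels q₀ q₁ (b ∷ l) = trans (cong ((if b then q₁ else q₀) *_) (trans (shift 0 (length l)) (∏-labels q₀ q₁ l))) (split b)
  where
  shift : ∀ i m → ∏ (λ j → if labelAt (b ∷ l) j then q₁ else q₀) (suc i) m ≡ ∏ (λ j → if labelAt l j then q₁ else q₀) i m
  shift i zero = refl
  shift i (suc m) = cong ((if labelAt l i then q₁ else q₀) *_) (shift (suc i) m)
  l₁ : ∀ a b c → a * (b * c) ≡ a * b * c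
  l₁ = solve-∀
  l₂ : ∀ a b c → a * (b * c) ≡ b * (a * c)
  l₂ = solve-∀
  split : ∀ b → (if b then q₁ else q₀) * (q₁ ^ trues l * q₀ ^ falses l) ≡ q₁ ^ trues (b ∷ l) * q₀ ^ falses (b ∷ l)
  split true  = l₁ q₁ (q₁ ^ trues l) (q₀ ^ falses l)
  split false = l₂ q₀ (q₁ ^ trues l) (q₀ ^ falses l)

module RareEvents {A : Set} (_≟ᴬ_ : DecidableEquality A) (pool : List A) (pool! : Unique pool) where

  open Orderings _≟ᴬ_ pool pool! public
  open import Data.List.Membership.DecPropositional _≟ᴬ_ using (_∈?_)

  ManyEarly : ℕ → List A → ℕ → List A → Set
  ManyEarly m Q f σ = ∃[ F ] (Unique F × f ≤ length F × (∀ {e} → e ∈ F → e ∈ Q × e ∈ take m σ))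

  -- Union bound over the C(m,f) sets of positions: f given positions all hit `Q` with probability
  -- at most (q/(M - m))^f, and `masks-bound` makes the total at most (4mq/(f(M - m)))^f.
  Rare-ManyEarly : ∀ m Q f {q} z → length Q ≤ q → m < M → 4 * m * q * z ≤ f * (M ∸ m) → Rare (z ^ f) 1 (ManyEarly m Q f)
  Rare-ManyEarly m Q f {q} z Q≤ m<M h = Rare-map hit (Rare-weaken (m^n>0 x {{>-nonZero x>0}} f) final (Rare-∃ (masks m f) each))
    where
    x = M ∸ m
    x>0 : 0 < x
    x>0 = m<n⇒0<n∸m m<M
    All-in : List Bool → List A → Set
    All-in w σ = ∀ {e} → e ∈ pick₁ w (take (length w) σ) → e ∈ Q
    each : ∀ {w} → w ∈ masks m f → Rare (x ^ f) (q ^ f) (All-in w)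
    each {w} w∈ with masks-sound m f w∈
    ... | refl , refl = subst (λ t → Rare (x ^ f) t (All-in w)) (∏-const q 0 f)
          (Rare-map (λ _ a α e β eq → a (subst (e ∈_) (sym eq) (∈-insert α)))
            (Rare-hit w (<⇒≤ m<M) (λ _ _ → Q) (λ _ → q) (λ _ _ → Q≤)))
    final : length (masks m f) * q ^ f * z ^ f ≤ 1 * x ^ f
    final = ≤-trans (*-cancelʳ-≤ _ _ (f ^ f) {{>-nonZero (^-self-positive f)}} (begin
        L * q ^ f * z ^ f * f ^ f          ≡⟨ l L (q ^ f) (z ^ f) (f ^ f) ⟩
        L * f ^ f * (q ^ f * z ^ f)        ≤⟨ *-monoˡ-≤ (q ^ f * z ^ f) (masks-bound m f) ⟩
        (4 * m) ^ f * (q ^ f * z ^ f)      ≡⟨ cong ((4 * m) ^ f *_) (sym (^-distribʳ-* q z f)) ⟩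
        (4 * m) ^ f * (q * z) ^ f          ≡⟨ sym (^-distribʳ-* (4 * m) (q * z) f) ⟩
        (4 * m * (q * z)) ^ f              ≤⟨ ^-monoˡ-≤ f (≤-trans (≤-reflexive (sym (*-assoc (4 * m) q z))) h) ⟩
        (f * x) ^ f                        ≡⟨ trans (^-distribʳ-* f x f) (*-comm (f ^ f) (x ^ f)) ⟩
        x ^ f * f ^ f ∎)) (≤-reflexive (sym (*-identityˡ _)))
      where
      open ≤-Reasoning
      L = length (masks m f)
      l : ∀ a b c d → a * b * c * d ≡ a * d * (b * c)
      l = solve-∀
    hit : ∀ {σ} → σ ↭ pool → ManyEarly m Q f σ → ∃[ w ] (w ∈ masks m f × All-in w σ)
    hit {σ} σ↭ (F , F! , f≤ , F⊆) = w , w∈ , λ {e} p → proj₁ (F⊆ (take-⊆ f F (inF′ p)))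
      where
      -- Keeping exactly `f` elements gives the mask exactly `f` marks.
      F′ = take f F
      σ₁ = take m σ
      w = mask (_∈? F′) σ₁
      len-σ₁ : length σ₁ ≡ m
      len-σ₁ = length-take-exact σ (≤-trans (<⇒≤ m<M) (≤-reflexive (sym (↭-length σ↭))))
      len-w : length w ≡ m
      len-w = trans (length-map _ σ₁) len-σ₁
      picked = filter (_∈? F′) σ₁
      picked-eq : pick₁ w (take (length w) σ) ≡ picked
      picked-eq = trans (cong (λ t → pick₁ w (take t σ)) len-w) (pick₁-mask (_∈? F′) σ₁)
      inF′ : ∀ {e} → e ∈ pick₁ w (take (length w) σ) → e ∈ F′
      inF′ p = proj₂ (∈-filter⁻ (_∈? F′) {xs = σ₁} (subst (_ ∈_) picked-eq p))
      len-picked : length picked ≡ f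
      len-picked = trans (≤-antisym
          (Unique-⊆-length (Unique.filter⁺ (_∈? F′) (Unique.take⁺ m (ordering-Unique σ↭))) (λ p → proj₂ (∈-filter⁻ (_∈? F′) {xs = σ₁} p)))
          (Unique-⊆-length (Unique.take⁺ f F!) (λ p → ∈-filter⁺ (_∈? F′) (proj₂ (F⊆ (take-⊆ f F p))) p)))
        (length-take-exact F f≤)
      trues-w : trues w ≡ f
      trues-w = trans (sym (length-pick₁ w σ₁ (sym (length-map _ σ₁)))) (trans (cong length (pick₁-mask (_∈? F′) σ₁)) len-picked)
      w∈ : w ∈ masks m f
      w∈ = subst₂ (λ a b → w ∈ masks a b) len-w trues-w (∈-masks w)

  Rare-Avoids : ∀ Z z m c j → 0 < M → m + c * j ≤ M → M ≤ c * z → Rare (2 ^ j) 1 (Avoids Z z m (c * j))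
  Rare-Avoids Z z m c j M>0 m≤ h = Rare-weaken (m^n>0 M {{>-nonZero M>0}} (c * j)) (begin
      (M ∸ z) ^ (c * j) * 2 ^ j        ≡⟨ cong (_* 2 ^ j) (sym (^-*-assoc (M ∸ z) c j)) ⟩
      ((M ∸ z) ^ c) ^ j * 2 ^ j        ≡⟨ trans (*-comm _ (2 ^ j)) (sym (^-distribʳ-* 2 ((M ∸ z) ^ c) j)) ⟩
      (2 * (M ∸ z) ^ c) ^ j            ≤⟨ ^-monoˡ-≤ j (halving M z c M>0 h) ⟩
      (M ^ c) ^ j                      ≡⟨ ^-*-assoc M c j ⟩
      M ^ (c * j)                      ≡⟨ sym (*-identityˡ _) ⟩
      1 * M ^ (c * j) ∎) (Rare-avoid Z z m (c * j) m≤)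
    where open ≤-Reasoning

  module _ (m f s q₀ q₁ : ℕ) (C₀ : List A → List A) (C₁ : List A → List A → List A) where

    -- The label at position |α| says whether the next pick comes from C₁ or from C₀; the takes only enforce the sizes.
    choices : List Bool → List A → List A → List A
    choices l ρ α = if labelAt l (length α) then take q₁ (C₁ ρ α) else take q₀ (C₀ ρ)

    labels : List (List Bool)
    labels = filter (λ l → (length l ≟ f) ×-dec (f ≤? s * trues l)) (lists (true ∷ false ∷ []) f)

    LabelledHit : List A → Set
    LabelledHit σ = ∃[ w ] (w ∈ masks m f × ∃[ l ] (l ∈ labels ×
      (∀ α e β → pick₁ w (take (length w) σ) ≡ α ++ e ∷ β → e ∈ choices l (pick₀ w (take (length w) σ)) α)))

    -- Positions cost (4m/f)^f and labels 2^f. With u = c f B, a pick has at most u candidates, and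
    -- at most u/z^s if its label is true; as at least f/s labels are true, a label word admits at
    -- most (u/z)^f sequences of picks. The factor f of u cancels against f^f, and the last
    -- hypothesis leaves x^(-f).
    Rare-LabelledHit : ∀ c B z x → m < M → 0 < z → q₀ ≤ c * f * B → q₁ * z ^ s ≤ c * f * B →
                       8 * m * (c * B) * x ≤ (M ∸ m) * z → Rare (x ^ f) 1 LabelledHit
    Rare-LabelledHit c B z x m<M z>0 h₀ h₁ h = Rare-weaken XZ>0 final
        (Rare-∃ (masks m f) λ w∈ → Rare-weaken XZ>0 labels-count (Rare-∃ labels λ l∈ → each w∈ l∈))
      where
      open ≤-Reasoning
      X = M ∸ m
      X^ = X ^ f
      u = c * f * B
      XZ>0 : 0 < X^ * z ^ f
      XZ>0 = *-mono-≤ (m^n>0 X {{>-nonZero (m<n⇒0<n∸m m<M)}} f) (m^n>0 z {{>-nonZero z>0}} f)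
      weights : ∀ l → f ≤ s * trues l → q₁ ^ trues l * q₀ ^ falses l * z ^ f ≤ u ^ length l
      weights l f≤ = begin
          q₁ ^ t * q₀ ^ g * z ^ f               ≤⟨ *-monoʳ-≤ (q₁ ^ t * q₀ ^ g) (^-monoʳ-≤ z {{>-nonZero z>0}} f≤) ⟩
          q₁ ^ t * q₀ ^ g * z ^ (s * t)         ≡⟨ cong (q₁ ^ t * q₀ ^ g *_) (sym (^-*-assoc z s t)) ⟩
          q₁ ^ t * q₀ ^ g * (z ^ s) ^ t         ≡⟨ l₁ (q₁ ^ t) (q₀ ^ g) _ ⟩
          q₁ ^ t * (z ^ s) ^ t * q₀ ^ g         ≡⟨ cong (_* q₀ ^ g) (sym (^-distribʳ-* q₁ (z ^ s) t)) ⟩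
          (q₁ * z ^ s) ^ t * q₀ ^ g             ≤⟨ *-mono-≤ (^-monoˡ-≤ t h₁) (^-monoˡ-≤ g h₀) ⟩
          u ^ t * u ^ g                         ≡⟨ trans (*-comm (u ^ t) (u ^ g)) (sym (^-distribˡ-+-* u g t)) ⟩
          u ^ (g + t)                           ≡⟨ cong (u ^_) (falses+trues l) ⟩
          u ^ length l ∎
        where
        t = trues l
        g = falses l
        l₁ : ∀ a b c → a * b * c ≡ a * c * b
        l₁ = solve-∀
      Hit : List Bool → List Bool → List A → Set
      Hit w l σ = ∀ α e β → pick₁ w (take (length w) σ) ≡ α ++ e ∷ β → e ∈ choices l (pick₀ w (take (length w) σ)) α
      choices-bound : ∀ l ρ α → length (choices l ρ α) ≤ (if labelAt l (length α) then q₁ else q₀)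
      choices-bound l ρ α with labelAt l (length α)
      ... | true  = length-take-≤ q₁ (C₁ ρ α)
      ... | false = length-take-≤ q₀ (C₀ ρ)
      each : ∀ {w l} → w ∈ masks m f → l ∈ labels → Rare (X^ * z ^ f) (u ^ f) (Hit w l)
      each {w} {l} w∈ l∈ with masks-sound m f w∈ | ∈-filter⁻ (λ l → (length l ≟ f) ×-dec (f ≤? s * trues l)) {xs = lists (true ∷ false ∷ []) f} l∈
      ... | refl , eq-f | _ , len-l , f≤ = Rare-weaken (m^n>0 X {{>-nonZero (m<n⇒0<n∸m m<M)}} (trues w)) bound
            (Rare-hit w (<⇒≤ m<M) (choices l) (λ j → if labelAt l j then q₁ else q₀) (choices-bound l))
        where
        bound : ∏ (λ j → if labelAt l j then q₁ else q₀) 0 (trues w) * (X^ * z ^ f) ≤ u ^ f * X ^ trues w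
        bound = begin
          ∏ (λ j → if labelAt l j then q₁ else q₀) 0 (trues w) * (X^ * z ^ f) ≡⟨ cong (λ t → ∏ (λ j → if labelAt l j then q₁ else q₀) 0 t * (X^ * z ^ f)) (trans eq-f (sym len-l)) ⟩
          ∏ (λ j → if labelAt l j then q₁ else q₀) 0 (length l) * (X^ * z ^ f) ≡⟨ cong (_* (X^ * z ^ f)) (∏-labels q₀ q₁ l) ⟩
          q₁ ^ trues l * q₀ ^ falses l * (X^ * z ^ f)  ≡⟨ l₂ (q₁ ^ trues l * q₀ ^ falses l) X^ (z ^ f) ⟩
          q₁ ^ trues l * q₀ ^ falses l * z ^ f * X^    ≤⟨ *-monoˡ-≤ X^ (weights l f≤) ⟩
          u ^ length l * X^                            ≡⟨ cong₂ (λ a b → u ^ a * X ^ b) len-l (sym eq-f) ⟩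
          u ^ f * X ^ trues w ∎
          where
          l₂ : ∀ a b c → a * (b * c) ≡ a * c * b
          l₂ = solve-∀
      labels-count : length labels * u ^ f * (X^ * z ^ f) ≤ 2 ^ f * u ^ f * (X^ * z ^ f)
      labels-count = *-monoˡ-≤ (X^ * z ^ f) (*-monoˡ-≤ (u ^ f)
        (≤-trans (length-filter _ (lists (true ∷ false ∷ []) f)) (length-lists (true ∷ false ∷ []) f)))
      final : length (masks m f) * (2 ^ f * u ^ f) * x ^ f ≤ 1 * (X^ * z ^ f)
      final = begin
        L * (2 ^ f * u ^ f) * x ^ f                    ≡⟨ cong (λ t → L * (2 ^ f * t) * x ^ f) (trans (cong (_^ f) (l₃ c f B)) (^-distribʳ-* f (c * B) f)) ⟩
        L * (2 ^ f * (f ^ f * (c * B) ^ f)) * x ^ f    ≡⟨ l₄ L (2 ^ f) (f ^ f) ((c * B) ^ f) (x ^ f) ⟩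
        L * f ^ f * (2 ^ f * (c * B) ^ f * x ^ f)      ≤⟨ *-monoˡ-≤ _ (masks-bound m f) ⟩
        (4 * m) ^ f * (2 ^ f * (c * B) ^ f * x ^ f)    ≡⟨ cong ((4 * m) ^ f *_) (trans (cong (_* x ^ f) (sym (^-distribʳ-* 2 (c * B) f))) (sym (^-distribʳ-* (2 * (c * B)) x f))) ⟩
        (4 * m) ^ f * (2 * (c * B) * x) ^ f            ≡⟨ sym (^-distribʳ-* (4 * m) (2 * (c * B) * x) f) ⟩
        (4 * m * (2 * (c * B) * x)) ^ f                ≤⟨ ^-monoˡ-≤ f (≤-trans (≤-reflexive (l₅ m (c * B) x)) h) ⟩
        (X * z) ^ f                                    ≡⟨ ^-distribʳ-* X z f ⟩
        X^ * z ^ f                                     ≡⟨ sym (*-identityˡ _) ⟩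
        1 * (X^ * z ^ f) ∎
        where
        L = length (masks m f)
        l₃ : ∀ c f B → c * f * B ≡ f * (c * B)
        l₃ = solve-∀
        l₄ : ∀ a b c d e → a * (b * (c * d)) * e ≡ a * c * (b * d * e)
        l₄ = solve-∀
        l₅ : ∀ m b x → 4 * m * (2 * b * x) ≡ 8 * m * b * x
        l₅ = solve-∀

-- Edges and triangles

_≟ᴱ_ : ∀ {n} → DecidableEquality (Edge n)
_≟ᴱ_ = ×-≡-dec Fin._≟_ Fin._≟_

module _ {n : ℕ} where
  open import Data.List.Membership.DecPropositional (_≟ᴱ_ {n}) public using () renaming (_∈?_ to _∈ᴱ?_)

infix 4 _⊆ᴱ_
_⊆ᴱ_ : ∀ {n} → Graph n → Graph n → Set
G ⊆ᴱ H = ∀ {e} → e ∈ G → e ∈ H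

-- Graphs store each edge with the smaller end first, so `norm` turns adjacency into a single
-- decidable membership that ignores the order of the ends.
norm : ∀ {n} → Fin n → Fin n → Edge n
norm x y = if toℕ x <ᵇ toℕ y then (x , y) else (y , x)

<ᵇ-true : ∀ {m n} → m < n → (m <ᵇ n) ≡ true
<ᵇ-true {m} {n} p with m <ᵇ n | <⇒<ᵇ p
... | true | _ = refl

<ᵇ-false : ∀ {m n} → n ≤ m → (m <ᵇ n) ≡ false
<ᵇ-false {m} {n} p with m <ᵇ n in eq
... | false = refl
... | true  = contradiction (<ᵇ⇒< m n (subst T (sym eq) tt)) (≤⇒≯ p)

norm-cases : ∀ {n} (x y : Fin n) → norm x y ≡ (x , y) ⊎ norm x y ≡ (y , x)
norm-cases x y with toℕ x <ᵇ toℕ y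
... | true  = inj₁ refl
... | false = inj₂ refl

norm-< : ∀ {n} {x y : Fin n} → toℕ x < toℕ y → norm x y ≡ (x , y)
norm-< p rewrite <ᵇ-true p = refl

norm-≥ : ∀ {n} {x y : Fin n} → toℕ y ≤ toℕ x → norm x y ≡ (y , x)
norm-≥ p rewrite <ᵇ-false p = refl

norm-sym : ∀ {n} (x y : Fin n) → norm x y ≡ norm y x
norm-sym x y with <-cmp (toℕ x) (toℕ y)
... | tri< p _ _ = trans (norm-< p) (sym (norm-≥ (<⇒≤ p)))
... | tri> _ _ p = trans (norm-≥ (<⇒≤ p)) (sym (norm-< p))
... | tri≈ _ p _ with Fin.toℕ-injective p
...   | refl = refl

norm-injective : ∀ {n} {a b c d : Fin n} → norm a b ≡ norm c d → (a ≡ c × b ≡ d) ⊎ (a ≡ d × b ≡ c)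
norm-injective {a = a} {b} {c} {d} eq with norm-cases a b | norm-cases c d
... | inj₁ p | inj₁ q with trans (sym p) (trans eq q)
...   | refl = inj₁ (refl , refl)
norm-injective eq | inj₁ p | inj₂ q with trans (sym p) (trans eq q)
...   | refl = inj₂ (refl , refl)
norm-injective eq | inj₂ p | inj₁ q with trans (sym p) (trans eq q)
...   | refl = inj₂ (refl , refl)
norm-injective eq | inj₂ p | inj₂ q with trans (sym p) (trans eq q)
...   | refl = inj₁ (refl , refl)

norm-injectiveʳ : ∀ {n} {v a b : Fin n} → norm v a ≡ norm v b → a ≡ b
norm-injectiveʳ eq with norm-injective eq
... | inj₁ (_ , p) = p
... | inj₂ (refl , refl) = refl

colourOf-norm : ∀ {n} (c : Colouring n) x y → colourOf c x y ≡ c (norm x y)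
colourOf-norm c x y with toℕ x <ᵇ toℕ y
... | true  = refl
... | false = refl

allEdges-row : ∀ n → Fin n → List (Edge n)
allEdges-row n i = concatMap (λ j → if toℕ i <ᵇ toℕ j then [ (i , j) ] else []) (allFin n)

∈-allEdges : ∀ {n} {i j : Fin n} → toℕ i < toℕ j → (i , j) ∈ allEdges n
∈-allEdges {n} {i} {j} p = ∈-concatMap-intro (allEdges-row n) (∈-allFin i)
  (∈-concatMap-intro (λ j → if toℕ i <ᵇ toℕ j then [ (i , j) ] else []) (∈-allFin j)
    (subst (λ b → (i , j) ∈ (if b then [ (i , j) ] else [])) (sym (<ᵇ-true p)) (here refl)))

singleton-cell : ∀ {n} {i j : Fin n} {e : Edge n} → e ∈ (if toℕ i <ᵇ toℕ j then [ (i , j) ] else []) → e ≡ (i , j) × toℕ i < toℕ j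
singleton-cell {i = i} {j} p with toℕ i <ᵇ toℕ j in eq
singleton-cell {i = i} {j} (here refl) | true = refl , <ᵇ⇒< (toℕ i) (toℕ j) (subst T (sym eq) tt)

∈-allEdges⁻ : ∀ {n} {i j : Fin n} → (i , j) ∈ allEdges n → toℕ i < toℕ j
∈-allEdges⁻ {n} p with ∈-concatMap-elim (allEdges-row n) (allFin n) p
... | i , _ , q with ∈-concatMap-elim (λ j → if toℕ i <ᵇ toℕ j then [ (i , j) ] else []) (allFin n) q
...   | j , _ , r with singleton-cell {i = i} {j} r
...     | refl , lt = lt

Unique-concatMap : ∀ {A B : Set} (f : A → List B) {xs} → Unique xs → (∀ x → Unique (f x)) →
                   (∀ {x y z} → z ∈ f x → z ∈ f y → x ≡ y) → Unique (concatMap f xs)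
Unique-concatMap f [] _ _ = []
Unique-concatMap f {x ∷ xs} (x∉ ∷ u) uf d = Unique-++⁺ (uf x) (Unique-concatMap f u uf d) λ p q →
  let (y , y∈ , z∈) = ∈-concatMap-elim f xs q in All.lookup x∉ y∈ (d p z∈)

allEdges-Unique : ∀ n → Unique (allEdges n)
allEdges-Unique n = Unique-concatMap (allEdges-row n) (Unique.allFin⁺ n)
    (λ i → Unique-concatMap (λ j → if toℕ i <ᵇ toℕ j then [ (i , j) ] else []) (Unique.allFin⁺ n) (cell! i)
      λ {j} {j′} p q → cong proj₂ (trans (sym (proj₁ (singleton-cell {i = i} {j} p))) (proj₁ (singleton-cell {i = i} {j′} q))))
    λ {i} {i′} p q → trans (sym (row-fst i p)) (row-fst i′ q)
  where
  cell! : ∀ i j → Unique (if toℕ i <ᵇ toℕ j then [ (i , j) ] else [])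
  cell! i j with toℕ i <ᵇ toℕ j
  ... | true  = [] ∷ []
  ... | false = []
  row-fst : ∀ i {e} → e ∈ allEdges-row n i → proj₁ e ≡ i
  row-fst i p with ∈-concatMap-elim (λ j → if toℕ i <ᵇ toℕ j then [ (i , j) ] else []) (allFin n) p
  ... | j , _ , r with singleton-cell {i = i} {j} r
  ...   | refl , _ = refl

ΣFin : ∀ n → (Fin n → ℕ) → ℕ
ΣFin zero h = 0
ΣFin (suc n) h = h fzero + ΣFin n (h ∘ fsuc)

ΣFin-cong : ∀ n {h h′ : Fin n → ℕ} → (∀ i → h i ≡ h′ i) → ΣFin n h ≡ ΣFin n h′
ΣFin-cong zero e = refl
ΣFin-cong (suc n) e = cong₂ _+_ (e fzero) (ΣFin-cong n (e ∘ fsuc))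

length-concatMap-tabulate : ∀ {A B : Set} (g : A → List B) n (f : Fin n → A) →
  length (concatMap g (Data.List.tabulate f)) ≡ ΣFin n (λ i → length (g (f i)))
length-concatMap-tabulate g zero f = refl
length-concatMap-tabulate g (suc n) f = trans (length-++ (g (f fzero))) (cong (length (g (f fzero)) +_) (length-concatMap-tabulate g n (f ∘ fsuc)))

numPairs : ℕ → ℕ
numPairs n = ΣFin n (λ i → ΣFin n (λ j → if toℕ i <ᵇ toℕ j then 1 else 0))

numPairs-suc : ∀ n → numPairs (suc n) ≡ n + numPairs n
numPairs-suc n = cong (_+ numPairs n) (ones n)
  where
  ones : ∀ n → ΣFin n (λ _ → 1) ≡ n
  ones zero = refl
  ones (suc n) = cong suc (ones n)

length-allEdges : ∀ n → length (allEdges n) ≡ numPairs n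
length-allEdges n = trans (length-concatMap-tabulate (allEdges-row n) n id)
  (ΣFin-cong n λ i → trans (length-concatMap-tabulate (λ j → if toℕ i <ᵇ toℕ j then [ (i , j) ] else []) n id)
    (ΣFin-cong n λ j → cell i j))
  where
  cell : ∀ (i j : Fin n) → length (if toℕ i <ᵇ toℕ j then [ (i , j) ] else []) ≡ (if toℕ i <ᵇ toℕ j then 1 else 0)
  cell i j with toℕ i <ᵇ toℕ j
  ... | true  = refl
  ... | false = refl

length-allEdges-C : ∀ n → length (allEdges n) ≡ n C 2
length-allEdges-C n = trans (length-allEdges n) (go n)
  where
  go : ∀ n → numPairs n ≡ n C 2
  go zero = refl
  go (suc n) = trans (numPairs-suc n) (trans (cong₂ _+_ (sym (nC1≡n n)) (go n)) (nCk+nC[k+1]≡[n+1]C[k+1] n 1))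

2*length-allEdges : ∀ n → 2 * length (allEdges (suc n)) ≡ suc n * n
2*length-allEdges n = trans (cong (2 *_) (length-allEdges (suc n))) (go n)
  where
  l : ∀ n → 2 * suc n + suc n * n ≡ suc (suc n) * suc n
  l = solve-∀
  go : ∀ n → 2 * numPairs (suc n) ≡ suc n * n
  go zero = refl
  go (suc n) = trans (cong (2 *_) (numPairs-suc (suc n))) (trans (*-distribˡ-+ 2 (suc n) _) (trans (cong (2 * suc n +_) (go n)) (l n)))

norm∈allEdges : ∀ {n} {x y : Fin n} → x ≢ y → norm x y ∈ allEdges n
norm∈allEdges {x = x} {y} x≢y with <-cmp (toℕ x) (toℕ y)
... | tri< p _ _ = subst (_∈ allEdges _) (sym (norm-< p)) (∈-allEdges p)
... | tri> _ _ p = subst (_∈ allEdges _) (sym (norm-≥ (<⇒≤ p))) (∈-allEdges p)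
... | tri≈ _ p _ = contradiction (Fin.toℕ-injective p) x≢y

edge-norm : ∀ {n} {x y : Fin n} → (x , y) ∈ allEdges n → norm x y ≡ (x , y)
edge-norm p = norm-< (∈-allEdges⁻ p)

norm∈⇒≢ : ∀ {n} {G : Graph n} {x y} → G ⊆ᴱ allEdges n → norm x y ∈ G → x ≢ y
norm∈⇒≢ {x = x} G⊆ p refl with norm-cases x x
... | inj₁ q = <-irrefl refl (∈-allEdges⁻ (G⊆ (subst (_∈ _) q p)))
... | inj₂ q = <-irrefl refl (∈-allEdges⁻ (G⊆ (subst (_∈ _) q p)))

norm∈-sym : ∀ {n} {G : Graph n} {x y} → norm x y ∈ G → norm y x ∈ G
norm∈-sym {x = x} {y} = subst (_∈ _) (norm-sym x y)

Adj⇒norm∈ : ∀ {n} {G : Graph n} {x y} → G ⊆ᴱ allEdges n → Adj G x y → norm x y ∈ G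
Adj⇒norm∈ {G = G} G⊆ (inj₁ p) = subst (_∈ G) (sym (edge-norm (G⊆ p))) p
Adj⇒norm∈ {G = G} {x} {y} G⊆ (inj₂ p) = subst (_∈ G) (trans (sym (edge-norm (G⊆ p))) (norm-sym y x)) p

norm∈⇒Adj : ∀ {n} {G : Graph n} {x y} → norm x y ∈ G → Adj G x y
norm∈⇒Adj {G = G} {x} {y} p with norm-cases x y
... | inj₁ q = inj₁ (subst (_∈ G) q p)
... | inj₂ q = inj₂ (subst (_∈ G) q p)

-- For subgraphs of `allEdges n` the three vertices are automatically distinct, because `norm x x`
-- is not an edge of K_n.
Covered : ∀ {n} → Graph n → Fin n → Set
Covered G v = ∃[ a ] ∃[ b ] (norm v a ∈ G × norm v b ∈ G × norm a b ∈ G)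

covered? : ∀ {n} (G : Graph n) → Decidable (Covered G)
covered? G v = Fin.any? λ a → Fin.any? λ b → (norm v a ∈ᴱ? G) ×-dec ((norm v b ∈ᴱ? G) ×-dec (norm a b ∈ᴱ? G))

Covered-mono : ∀ {n} {G H : Graph n} {v} → G ⊆ᴱ H → Covered G v → Covered H v
Covered-mono s (a , b , p , q , r) = a , b , s p , s q , s r

everyVertexInTriangle⁺ : ∀ {n} {G : Graph n} → (∀ v → Covered G v) → EveryVertexInTriangle G
everyVertexInTriangle⁺ h v with h v
... | a , b , p , q , r = a , b , norm∈⇒Adj p , norm∈⇒Adj q , norm∈⇒Adj r

everyVertexInTriangle⁻ : ∀ {n} {G : Graph n} → G ⊆ᴱ allEdges n → EveryVertexInTriangle G → ∀ v → Covered G v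
everyVertexInTriangle⁻ s h v with h v
... | a , b , p , q , r = a , b , Adj⇒norm∈ s p , Adj⇒norm∈ s q , Adj⇒norm∈ s r

neighbours : ∀ {n} → Graph n → Fin n → List (Fin n)
neighbours {n} G v = filter (λ x → norm v x ∈ᴱ? G) (allFin n)

common : ∀ {n} → Graph n → Fin n → Fin n → List (Fin n)
common {n} G a b = filter (λ x → (norm a x ∈ᴱ? G) ×-dec (norm b x ∈ᴱ? G)) (allFin n)

uncovered : ∀ {n} → Graph n → List (Fin n)
uncovered {n} G = filter (λ v → ¬? (covered? G v)) (allFin n)

∈-uncovered : ∀ {n} {G : Graph n} {v} → ¬ Covered G v → v ∈ uncovered G
∈-uncovered {G = G} ¬c = ∈-filter⁺ (λ v → ¬? (covered? G v)) (∈-allFin _) ¬c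

uncovered-sound : ∀ {n} {G : Graph n} {v} → v ∈ uncovered G → ¬ Covered G v
uncovered-sound {n} {G} p = proj₂ (∈-filter⁻ (λ v → ¬? (covered? G v)) {xs = allFin n} p)

cross : ∀ {n} → List (Fin n) → List (Fin n) → List (Edge n)
cross A B = concatMap (λ x → map (norm x) B) A

length-cross : ∀ {n} (A B : List (Fin n)) → length (cross A B) ≡ length A * length B
length-cross [] B = refl
length-cross (x ∷ A) B = trans (length-++ (map (norm x) B)) (cong₂ _+_ (length-map (norm x) B) (length-cross A B))

∈-cross : ∀ {n} {A B : List (Fin n)} {x y} → x ∈ A → y ∈ B → norm x y ∈ cross A B
∈-cross {B = B} {x} {y} p q = ∈-concatMap-intro (λ x → map (norm x) B) p (∈-map⁺ (norm x) q)

∈-cross⁻ : ∀ {n} (A B : List (Fin n)) {e} → e ∈ cross A B → ∃[ x ] ∃[ y ] (x ∈ A × y ∈ B × e ≡ norm x y)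
∈-cross⁻ A B p with ∈-concatMap-elim (λ x → map (norm x) B) A p
... | x , x∈ , q with ∈-map⁻ (norm x) q
...   | y , y∈ , eq = x , y , x∈ , y∈ , eq

-- `norm` forgets the order of the ends, so two vertices lying in both lists would produce their
-- edge twice; disjointness excludes this.
Unique-cross : ∀ {n} {A B : List (Fin n)} → Unique A → Unique B → (∀ {x} → x ∈ A → x ∉ B) → Unique (cross A B)
Unique-cross {A = []} _ _ _ = []
Unique-cross {A = x ∷ A} {B} (x∉ ∷ uA) uB d = Unique-++⁺ (Unique.map⁺ norm-injectiveʳ uB) (Unique-cross uA uB (d ∘ there)) disjoint
  where
  disjoint : ∀ {e} → e ∈ map (norm x) B → e ∉ cross A B
  disjoint p q with ∈-map⁻ (norm x) p | ∈-cross⁻ A B q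
  ... | y , y∈ , refl | x′ , y′ , x′∈ , y′∈ , eq with norm-injective eq
  ...   | inj₁ (refl , _) = All.lookup x∉ x′∈ refl
  ...   | inj₂ (refl , refl) = d (here refl) y′∈

-- Large components and closed sets

Fin-¬¬-shift : ∀ {n} {P : Fin n → Set} → (∀ i → ¬ ¬ P i) → ¬ ¬ (∀ i → P i)
Fin-¬¬-shift {zero} h k = k λ ()
Fin-¬¬-shift {suc n} h k = h fzero λ p₀ → Fin-¬¬-shift (h ∘ fsuc) λ ps → k λ { fzero → p₀ ; (fsuc i) → ps i }

-- Reachability comes without a decision procedure. The goals that use it are absurdities, so its
-- decidability on a finite vertex set may be assumed.
¬¬-decidable₂ : ∀ {n} (R : Fin n → Fin n → Set) → ¬ ¬ (∀ x y → Dec (R x y))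
¬¬-decidable₂ R = Fin-¬¬-shift λ x → Fin-¬¬-shift λ y k → k (no λ r → k (yes r))

count : ∀ {n} {P : Fin n → Set} → Decidable P → ℕ
count {n} P? = length (filter P? (allFin n))

module _ {n : ℕ} where

  count-∪ : ∀ {P Q R : Fin n → Set} (P? : Decidable P) (Q? : Decidable Q) (R? : Decidable R) →
            (∀ {x} → P x → Q x ⊎ R x) → count P? ≤ count Q? + count R?
  count-∪ P? Q? R? h = ≤-trans
    (Unique-⊆-length (Unique.filter⁺ P? (Unique.allFin⁺ n)) λ p →
      [ (λ q → ∈-++⁺ˡ (∈-filter⁺ Q? (∈-allFin _) q)) , (λ r → ∈-++⁺ʳ (filter Q? (allFin n)) (∈-filter⁺ R? (∈-allFin _) r)) ]′
      (h (proj₂ (∈-filter⁻ P? {xs = allFin n} p))))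
    (≤-reflexive (length-++ (filter Q? (allFin n))))

  count-mono : ∀ {P Q : Fin n → Set} (P? : Decidable P) (Q? : Decidable Q) → (∀ {x} → P x → Q x) → count P? ≤ count Q?
  count-mono P? Q? h = Unique-⊆-length (Unique.filter⁺ P? (Unique.allFin⁺ n)) λ p →
    ∈-filter⁺ Q? (∈-allFin _) (h (proj₂ (∈-filter⁻ P? {xs = allFin n} p)))

  record IsDecEquiv (r : Fin n → Fin n → Set) : Set where
    field
      dec   : ∀ x y → Dec (r x y)
      rfl   : ∀ {x} → r x x
      symm  : ∀ {x y} → r x y → r y x
      trns  : ∀ {x y z} → r x y → r y z → r x z

  Saturated : (Fin n → Fin n → Set) → (Fin n → Set) → Set
  Saturated r X = ∀ {x y} → r x y → X x → X y

  record Balanced (r : Fin n → Fin n → Set) (a : ℕ) : Set₁ where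
    field
      X        : Fin n → Set
      X?       : Decidable X
      sat      : Saturated r X
      inside   : 2 * a ≤ count X?
      outside  : 2 * a ≤ count (λ x → ¬? (X? x))

  module _ {r : Fin n → Fin n → Set} (E : IsDecEquiv r) (a : ℕ) (v₀ : Fin n) where
    open IsDecEquiv E

    Hull : List (Fin n) → Fin n → Set
    Hull L x = Any (λ j → r j x) L

    hull? : ∀ L → Decidable (Hull L)
    hull? L x = Any.any? (λ j → dec j x) L

    BigClass : Set
    BigClass = ∃[ x₀ ] (count (λ y → ¬? (dec x₀ y)) < 4 * a)

    2+2≡4 : 2 * a + 2 * a ≡ 4 * a
    2+2≡4 = l a
      where
      l : ∀ a → 2 * a + 2 * a ≡ 4 * a
      l = solve-∀

    -- Classes are added one at a time until at least 2a vertices are collected.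
    collect : ∀ done todo → count (hull? done) < 2 * a → (∀ x → x ∈ done ⊎ x ∈ todo) → Balanced r a ⊎ BigClass
    -- Here `done` exhausts the vertices, so there are fewer than 2a of them and the class of any
    -- vertex will do.
    collect done [] small all = inj₂ (v₀ , ≤-trans
      (s≤s (count-mono (λ y → ¬? (dec v₀ y)) (hull? done) λ {x} _ → Any.map (λ { refl → rfl }) ([ id , (λ ()) ]′ (all x))))
      (≤-trans small (≤-trans (m≤m+n (2 * a) (2 * a)) (≤-reflexive 2+2≡4))))
    collect done (j ∷ todo) small all with count (hull? (j ∷ done)) <? 2 * a
    ... | yes lt = collect (j ∷ done) todo lt λ x → [ inj₁ ∘ there , (λ { (here refl) → inj₁ (here refl) ; (there p) → inj₂ p }) ]′ (all x)
    ... | no ≮ with 2 * a ≤? count (λ x → ¬? (hull? (j ∷ done) x))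
    ...   | yes out = inj₁ record { X = Hull (j ∷ done) ; X? = hull? (j ∷ done) ; sat = λ r′ → Any.map (λ q → trns q r′) ; inside = ≮⇒≥ ≮ ; outside = out }
    -- A vertex outside the class of `j` lies in the old hull or outside the new one; both sets have
    -- fewer than 2a vertices.
    ...   | no ≰ = inj₂ (j , ≤-trans (s≤s (count-∪ (λ y → ¬? (dec j y)) (hull? done) (λ x → ¬? (hull? (j ∷ done) x)) split))
            (≤-trans (+-mono-≤ small (<⇒≤ (≰⇒> ≰))) (≤-reflexive 2+2≡4)))
      where
      split : ∀ {x} → ¬ r j x → Hull done x ⊎ ¬ Hull (j ∷ done) x
      split {x} ¬r with hull? done x
      ... | yes h = inj₁ h
      ... | no ¬h = inj₂ λ { (here q) → ¬r q ; (there q) → ¬h q }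

    balanced-or-big : 0 < a → Balanced r a ⊎ BigClass
    balanced-or-big a>0 = collect [] (allFin n) none λ x → inj₂ (∈-allFin x)
      where
      none : count (hull? []) < 2 * a
      none = subst (_< 2 * a) (sym (cong length (filter-none (hull? []) {xs = allFin n} (All.tabulate λ _ ())))) (*-mono-≤ (s≤s (z≤n {1})) a>0)

  Joined : Graph n → ℕ → Set
  Joined G a = ∀ (A B : List (Fin n)) → Unique A → Unique B → (∀ {x} → x ∈ A → x ∉ B) → a ≤ length A → a ≤ length B →
               ∃[ x ] ∃[ y ] (x ∈ A × y ∈ B × norm x y ∈ G)

  module _ {G : Graph n} {a : ℕ} (joined : Joined G a) {r₁ r₂ : Fin n → Fin n → Set}
           (edge : ∀ {x y} → norm x y ∈ G → r₁ x y ⊎ r₂ x y) where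

    no-opposite : ∀ {X Z : Fin n → Set} (X? : Decidable X) (Z? : Decidable Z) →
                  (∀ {x y} → norm x y ∈ G → X x → Z x → ¬ X y → ¬ Z y → ⊥) →
                  count (λ x → X? x ×-dec Z? x) < a ⊎ count (λ x → ¬? (X? x) ×-dec ¬? (Z? x)) < a
    no-opposite X? Z? h with count (λ x → X? x ×-dec Z? x) <? a | count (λ x → ¬? (X? x) ×-dec ¬? (Z? x)) <? a
    ... | yes p | _ = inj₁ p
    ... | no _ | yes q = inj₂ q
    ... | no p | no q with joined _ _ (Unique.filter⁺ (λ x → X? x ×-dec Z? x) (Unique.allFin⁺ n)) (Unique.filter⁺ (λ x → ¬? (X? x) ×-dec ¬? (Z? x)) (Unique.allFin⁺ n))
              (λ u v → proj₁ (proj₂ (∈-filter⁻ (λ x → ¬? (X? x) ×-dec ¬? (Z? x)) {xs = allFin n} v)) (proj₁ (proj₂ (∈-filter⁻ (λ x → X? x ×-dec Z? x) {xs = allFin n} u))))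
              (≮⇒≥ p) (≮⇒≥ q)
    ...   | x , y , x∈ , y∈ , e with ∈-filter⁻ (λ x → X? x ×-dec Z? x) {xs = allFin n} x∈ | ∈-filter⁻ (λ x → ¬? (X? x) ×-dec ¬? (Z? x)) {xs = allFin n} y∈
    ...     | _ , Xx , Zx | _ , ¬Xy , ¬Zy = ⊥-elim (h e Xx Zx ¬Xy ¬Zy)

    -- No edge leaves both X and Z, so X and Z cut the vertices into four quadrants, and of two
    -- opposite quadrants one has fewer than a vertices. Two small quadrants from different opposite
    -- pairs make up a whole side of X or of Z, which has at least 2a vertices.
    not-both-balanced : IsDecEquiv r₁ → IsDecEquiv r₂ → Balanced r₁ a → Balanced r₂ a → ⊥
    not-both-balanced E₁ E₂ b₁ b₂ = conclude (no-opposite X? Z? sep) (no-opposite X? ¬Z? sep′)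
      where
      open Balanced b₁
      open Balanced b₂ renaming (X to Z; X? to Z?; sat to satZ; inside to insideZ; outside to outsideZ)
      open IsDecEquiv
      ¬Z? : Decidable (λ x → ¬ Z x)
      ¬Z? x = ¬? (Z? x)
      sep : ∀ {x y} → norm x y ∈ G → X x → Z x → ¬ X y → ¬ Z y → ⊥
      sep e Xx Zx ¬Xy ¬Zy = [ (λ r → ¬Xy (sat r Xx)) , (λ r → ¬Zy (satZ r Zx)) ]′ (edge e)
      sep′ : ∀ {x y} → norm x y ∈ G → X x → ¬ Z x → ¬ X y → ¬ ¬ Z y → ⊥
      sep′ e Xx ¬Zx ¬Xy ¬¬Zy = [ (λ r → ¬Xy (sat r Xx)) , (λ r → ¬¬Zy λ Zy → ¬Zx (satZ (symm E₂ r) Zy)) ]′ (edge e)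
      small : ∀ {P Q R : Fin n → Set} (P? : Decidable P) (Q? : Decidable Q) (R? : Decidable R) →
              (∀ {x} → P x → Q x ⊎ R x) → 2 * a ≤ count P? → count Q? < a → count R? < a → ⊥
      small P? Q? R? h big q r = <-irrefl refl (≤-trans (s≤s (≤-trans big (count-∪ P? Q? R? h)))
        (≤-trans (≤-trans (s≤s (+-monoʳ-≤ (count Q?) (<⇒≤ r))) (+-monoˡ-≤ a q)) (≤-reflexive (cong (a +_) (sym (+-identityʳ a))))))
      byZ : ∀ x → Z x ⊎ ¬ Z x
      byZ x with Z? x
      ... | yes z = inj₁ z
      ... | no z = inj₂ z
      byX : ∀ x → X x ⊎ ¬ X x
      byX x with X? x
      ... | yes z = inj₁ z
      ... | no z = inj₂ z
      conclude : count (λ x → X? x ×-dec Z? x) < a ⊎ count (λ x → ¬? (X? x) ×-dec ¬? (Z? x)) < a →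
                 count (λ x → X? x ×-dec ¬Z? x) < a ⊎ count (λ x → ¬? (X? x) ×-dec ¬? (¬Z? x)) < a → ⊥
      conclude (inj₁ p) (inj₁ q) = small X? (λ x → X? x ×-dec Z? x) (λ x → X? x ×-dec ¬Z? x)
        (λ {x} Xx → [ inj₁ ∘ (Xx ,_) , inj₂ ∘ (Xx ,_) ]′ (byZ x)) inside p q
      conclude (inj₁ p) (inj₂ q) = small Z? (λ x → X? x ×-dec Z? x) (λ x → ¬? (X? x) ×-dec ¬? (¬Z? x))
        (λ {x} Zx → [ (λ Xx → inj₁ (Xx , Zx)) , (λ ¬Xx → inj₂ (¬Xx , λ ¬Zx → ¬Zx Zx)) ]′ (byX x)) insideZ p q
      conclude (inj₂ p) (inj₁ q) = small ¬Z? (λ x → ¬? (X? x) ×-dec ¬? (Z? x)) (λ x → X? x ×-dec ¬Z? x)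
        (λ {x} ¬Zx → [ (λ Xx → inj₂ (Xx , ¬Zx)) , (λ ¬Xx → inj₁ (¬Xx , ¬Zx)) ]′ (byX x)) outsideZ p q
      conclude (inj₂ p) (inj₂ q) = small (λ x → ¬? (X? x)) (λ x → ¬? (X? x) ×-dec ¬? (Z? x)) (λ x → ¬? (X? x) ×-dec ¬? (¬Z? x))
        (λ {x} ¬Xx → [ (λ Zx → inj₂ (¬Xx , λ ¬Zx → ¬Zx Zx)) , (λ ¬Zx → inj₁ (¬Xx , ¬Zx)) ]′ (byZ x)) outside p q

    big-class : 0 < a → Fin n → (E₁ : IsDecEquiv r₁) (E₂ : IsDecEquiv r₂) →
                (∃[ x₀ ] (count (λ y → ¬? (IsDecEquiv.dec E₁ x₀ y)) < 4 * a)) ⊎ (∃[ x₀ ] (count (λ y → ¬? (IsDecEquiv.dec E₂ x₀ y)) < 4 * a))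
    big-class a>0 v₀ E₁ E₂ with balanced-or-big E₁ a v₀ a>0 | balanced-or-big E₂ a v₀ a>0
    ... | inj₂ big | _ = inj₁ big
    ... | inj₁ _ | inj₂ big = inj₂ big
    ... | inj₁ b₁ | inj₁ b₂ = ⊥-elim (not-both-balanced E₁ E₂ b₁ b₂)

  Closed : Graph n → (Fin n → Set) → Set
  Closed G S = ∀ {v a b} → S v → norm v a ∈ G → norm v b ∈ G → norm a b ∈ G → S a ⊎ S b

  NoSmallClosed : Graph n → ℕ → Set₁
  NoSmallClosed G s = ∀ (S : Fin n → Set) (S? : Decidable S) → ∃[ v ] S v → count S? < s → Closed G S → ⊥

-- Connectedness and absence of NAC-colourings

Star-sym : ∀ {A : Set} {R : A → A → Set} → (∀ {x y} → R x y → R y x) → ∀ {x y} → Star R x y → Star R y x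
Star-sym s ε = ε
Star-sym s (r ◅ p) = Star-sym s p ◅◅ (s r ◅ ε)

Star-decEquiv : ∀ {n} {R : Fin n → Fin n → Set} → (∀ {x y} → R x y → R y x) → (∀ x y → Dec (Star R x y)) → IsDecEquiv (Star R)
Star-decEquiv s d = record { dec = d ; rfl = ε ; symm = Star-sym s ; trns = _◅◅_ }

module _ {n : ℕ} {G : Graph n} {a : ℕ} (a>0 : 0 < a) (v₀ : Fin n) (G⊆ : G ⊆ᴱ allEdges n)
         (joined : Joined G a) (none : NoSmallClosed G (4 * a)) where

  -- Both relations of `big-class` are taken to be reachability. All neighbours of a vertex outside
  -- the large component are outside too, so the outside is closed.
  connected : ¬ ¬ Connected G
  connected ¬conn = ¬¬-decidable₂ (Star (Adj G)) λ d → go d (big-class joined (λ e → inj₁ (norm∈⇒Adj e ◅ ε)) a>0 v₀ (eqv d) (eqv d))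
    where
    Adj-sym : ∀ {x y} → Adj G x y → Adj G y x
    Adj-sym = [ inj₂ , inj₁ ]′
    eqv : (∀ x y → Dec (Star (Adj G) x y)) → IsDecEquiv (Star (Adj G))
    eqv = Star-decEquiv Adj-sym
    go : (d : ∀ x y → Dec (Star (Adj G) x y)) → (∃[ x₀ ] (count (λ y → ¬? (d x₀ y)) < 4 * a)) ⊎ (∃[ x₀ ] (count (λ y → ¬? (d x₀ y)) < 4 * a)) → ⊥
    go d (inj₂ p) = go d (inj₁ p)
    go d (inj₁ (x₀ , small)) = ¬conn λ u v → Star-sym Adj-sym (reach u) ◅◅ reach v
      where
      reach : ∀ v → Star (Adj G) x₀ v
      reach v with d x₀ v
      ... | yes p = p
      ... | no ¬p = ⊥-elim (none (λ y → ¬ Star (Adj G) x₀ y) (λ y → ¬? (d x₀ y)) (v , ¬p) small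
                      λ ¬r e _ _ → inj₁ λ r → ¬r (r ◅◅ (Adj-sym (norm∈⇒Adj e) ◅ ε)))

  module _ (c : Colouring n) (nac : IsNAC G c) where

    ColAdj : Bool → Fin n → Fin n → Set
    ColAdj b x y = norm x y ∈ G × c (norm x y) ≡ b

    ColAdj-sym : ∀ {b x y} → ColAdj b x y → ColAdj b y x
    ColAdj-sym {b} {x} {y} = subst (λ e → e ∈ G × c e ≡ b) (norm-sym x y)

    ind : Bool → Bool → ℕ
    ind true d = if d then 1 else 0
    ind false d = if d then 0 else 1

    ind-same : ∀ b → ind b b ≡ 1
    ind-same true = refl
    ind-same false = refl

    ind-not : ∀ b → ind (not b) b ≡ 0
    ind-not true = refl
    ind-not false = refl

    ind-not′ : ∀ b → ind b (not b) ≡ 0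
    ind-not′ true = refl
    ind-not′ false = refl

    ≢⇒not : ∀ {b d : Bool} → d ≢ b → d ≡ not b
    ≢⇒not {true} {true} h = contradiction refl h
    ≢⇒not {true} {false} h = refl
    ≢⇒not {false} {true} h = refl
    ≢⇒not {false} {false} h = contradiction refl h

    countColour-∷ : ∀ b x y es → countColour c b ((x , y) ∷ es) ≡ ind b (c (norm x y)) + countColour c b es
    countColour-∷ true x y es = cong (λ d → (if d then 1 else 0) + countColour c true es) (colourOf-norm c x y)
    countColour-∷ false x y es = cong (λ d → (if d then 0 else 1) + countColour c false es) (colourOf-norm c x y)

    countColour-[] : ∀ b → countColour c b [] ≡ 0
    countColour-[] true = refl
    countColour-[] false = refl

    cycle-not-one : ∀ b vs → IsCycle G vs → countColour c b (cycleEdges vs) ≢ 1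
    cycle-not-one true vs cyc = proj₁ (proj₂ (proj₂ nac) vs cyc)
    cycle-not-one false vs cyc = proj₂ (proj₂ (proj₂ nac) vs cyc)

    -- The list omits the first vertex, so that `x ∷ vs` is the vertex list of the cycle obtained by
    -- joining the two ends.
    data SimplePath (b : Bool) : Fin n → Fin n → List (Fin n) → Set where
      done : ∀ {x} → SimplePath b x x []
      step : ∀ {x y z vs} → ColAdj b x z → SimplePath b z y vs → x ∉ z ∷ vs → SimplePath b x y (z ∷ vs)

    from-vertex : ∀ {b x z y vs} → SimplePath b z y vs → x ∈ z ∷ vs → ∃[ ws ] SimplePath b x y ws
    from-vertex p (here refl) = _ , p
    from-vertex (step _ p _) (there x∈) = from-vertex p x∈

    loop-erase : ∀ {b x y} → Star (ColAdj b) x y → ∃[ vs ] SimplePath b x y vs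
    loop-erase ε = [] , done
    loop-erase {x = x} (_◅_ {j = z} e s) with loop-erase s
    ... | vs , p with Any.any? (x Fin.≟_) (z ∷ vs)
    ...   | yes x∈ = from-vertex p x∈
    ...   | no x∉ = z ∷ vs , step e p x∉

    SimplePath-Unique : ∀ {b x y vs} → SimplePath b x y vs → Unique (x ∷ vs)
    SimplePath-Unique done = [] ∷ []
    SimplePath-Unique (step _ p x∉) = ¬Any⇒All¬ _ x∉ ∷ SimplePath-Unique p

    -- The path edges all have colour `b`; only the edge from `y` to `w`, which closes the cycle
    -- when `w` is the start, can count towards colour `not b`.
    path-edges : ∀ {b x y vs} w → SimplePath b x y vs → norm y w ∈ G →
                 All (λ e → Adj G (proj₁ e) (proj₂ e)) (zip (x ∷ vs) (vs ++ [ w ])) ×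
                 countColour c (not b) (zip (x ∷ vs) (vs ++ [ w ])) ≡ ind (not b) (c (norm y w))
    path-edges {b} {x} w done e = (norm∈⇒Adj e ∷ []) ,
      trans (countColour-∷ (not b) x w []) (trans (cong (ind (not b) (c (norm x w)) +_) (countColour-[] (not b))) (+-identityʳ _))
    path-edges {b} {x} w (step {z = z} {vs = vs} (xz∈ , col) p _) e with path-edges w p e
    ... | adj , cnt = norm∈⇒Adj xz∈ ∷ adj ,
      trans (countColour-∷ (not b) x z _) (trans (cong (_+ countColour c (not b) (zip (z ∷ vs) (vs ++ [ w ]))) (trans (cong (ind (not b)) col) (ind-not b))) cnt)

    -- An edge of the other colour inside a `b`-component would close a simple `b`-path to a cycle
    -- containing that colour exactly once. A path with a single edge is the edge itself and so
    -- already has colour `b`.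
    class-edge : ∀ {b x y} → Star (ColAdj b) x y → norm x y ∈ G → c (norm x y) ≡ b
    class-edge {b} {x} {y} s e with c (norm x y) Data.Bool.≟ b
    ... | yes p = p
    ... | no ≢b with loop-erase s
    ...   | [] , done = contradiction refl (norm∈⇒≢ G⊆ e)
    ...   | z ∷ [] , step (_ , col) done _ = col
    ...   | z ∷ z′ ∷ vs , p with path-edges x p (norm∈-sym e)
    ...     | adj , cnt = contradiction (trans cnt one) (cycle-not-one (not b) (x ∷ z ∷ z′ ∷ vs) (s≤s (s≤s (s≤s z≤n)) , SimplePath-Unique p , adj))
      where
      one : ind (not b) (c (norm y x)) ≡ 1
      one = trans (cong (ind (not b)) (trans (cong c (norm-sym y x)) (≢⇒not ≢b))) (ind-same (not b))

    -- If v is outside the component and p, q are inside, then vp and vq have the other colour,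
    -- while pq has colour `b` by `class-edge`; the triangle would contain colour `b` exactly once.
    class-closed : ∀ b (d : ∀ x y → Dec (Star (ColAdj b) x y)) x₀ → Closed G (λ y → ¬ Star (ColAdj b) x₀ y)
    class-closed b d x₀ {v} {p} {q} v∉ vp vq pq with d x₀ p | d x₀ q
    ... | no ¬p | _ = inj₁ ¬p
    ... | yes _ | no ¬q = inj₂ ¬q
    ... | yes rp | yes rq = contradiction one (cycle-not-one b (v ∷ p ∷ q ∷ []) cyc)
      where
      red : c (norm p q) ≡ b
      red = class-edge (Star-sym ColAdj-sym rp ◅◅ rq) pq
      vp-col : c (norm v p) ≡ not b
      vp-col = ≢⇒not λ eq → v∉ (rp ◅◅ (ColAdj-sym (vp , eq) ◅ ε))
      qv-col : c (norm q v) ≡ not b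
      qv-col = ≢⇒not λ eq → v∉ (rq ◅◅ ((norm∈-sym vq , eq) ◅ ε))
      cyc : IsCycle G (v ∷ p ∷ q ∷ [])
      cyc = s≤s (s≤s (s≤s z≤n)) ,
            ((norm∈⇒≢ G⊆ vp ∷ norm∈⇒≢ G⊆ vq ∷ []) ∷ (norm∈⇒≢ G⊆ pq ∷ []) ∷ [] ∷ []) ,
            (norm∈⇒Adj vp ∷ norm∈⇒Adj pq ∷ norm∈⇒Adj (norm∈-sym vq) ∷ [])
      one : countColour c b (cycleEdges (v ∷ p ∷ q ∷ [])) ≡ 1
      one = trans (countColour-∷ b v p _) (cong₂ _+_ (trans (cong (ind b) vp-col) (ind-not′ b))
            (trans (countColour-∷ b p q _) (cong₂ _+_ (trans (cong (ind b) red) (ind-same b))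
              (trans (countColour-∷ b q v []) (cong₂ _+_ (trans (cong (ind b) qv-col) (ind-not′ b)) (countColour-[] b))))))

    -- By `class-edge` an edge of the other colour cannot have both ends in the component.
    class-proper : ∀ b (d : ∀ x y → Dec (Star (ColAdj b) x y)) x₀ → (∃[ e ] (e ∈ G × c e ≢ b)) → ∃[ y ] ¬ Star (ColAdj b) x₀ y
    class-proper b d x₀ ((i , j) , e∈ , ≢b) with d x₀ i | d x₀ j
    ... | no ¬i | _ = i , ¬i
    ... | yes _ | no ¬j = j , ¬j
    ... | yes ri | yes rj = contradiction (subst (λ e → c e ≡ b) eq (class-edge (Star-sym ColAdj-sym ri ◅◅ rj) (subst (_∈ G) (sym eq) e∈))) ≢b
      where
      eq : norm i j ≡ (i , j)
      eq = edge-norm (G⊆ e∈)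

    nac-impossible : ⊥
    nac-impossible = ¬¬-decidable₂ (Star (ColAdj true)) λ d₁ → ¬¬-decidable₂ (Star (ColAdj false)) λ d₂ →
        [ (λ { (x₀ , small) → none _ (λ y → ¬? (d₁ x₀ y)) (class-proper true d₁ x₀ blue) small (class-closed true d₁ x₀) }) ,
          (λ { (x₀ , small) → none _ (λ y → ¬? (d₂ x₀ y)) (class-proper false d₂ x₀ red) small (class-closed false d₂ x₀) }) ]′
        (big-class joined coloured a>0 v₀ (Star-decEquiv ColAdj-sym d₁) (Star-decEquiv ColAdj-sym d₂))
      where
      blue : ∃[ e ] (e ∈ G × c e ≢ true)
      blue = let (e , e∈ , p) = proj₁ (proj₂ nac) in e , e∈ , λ q → contradiction (trans (sym p) q) λ ()
      red : ∃[ e ] (e ∈ G × c e ≢ false)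
      red = let (e , e∈ , p) = proj₁ nac in e , e∈ , λ q → contradiction (trans (sym p) q) λ ()
      coloured : ∀ {x y} → norm x y ∈ G → Star (ColAdj true) x y ⊎ Star (ColAdj false) x y
      coloured {x} {y} e with c (norm x y) in eq
      ... | true  = inj₁ ((e , eq) ◅ ε)
      ... | false = inj₂ ((e , eq) ◅ ε)

  noNAC : ¬ HasNAC G
  noNAC (c , nac) = nac-impossible c nac

-- The NAC-colouring around an uncovered vertex

module _ {n : ℕ} where

  Incident : Fin n → Edge n → Set
  Incident w e = proj₁ e ≡ w ⊎ proj₂ e ≡ w

  incident? : ∀ w → Decidable (Incident w)
  incident? w e = (proj₁ e Fin.≟ w) ⊎-dec (proj₂ e Fin.≟ w)

  starColouring : Fin n → Colouring n
  starColouring w e = does (incident? w e)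

  isCentre : Fin n → Fin n → ℕ
  isCentre w x = if does (x Fin.≟ w) then 1 else 0

  occurrences : Fin n → List (Fin n) → ℕ
  occurrences w [] = 0
  occurrences w (x ∷ xs) = isCentre w x + occurrences w xs

  starColouring-edge : ∀ w {x y} → x ≢ y → (if colourOf (starColouring w) x y then 1 else 0) ≡ isCentre w x + isCentre w y
  starColouring-edge w {x} {y} x≢y with toℕ x <ᵇ toℕ y
  ... | true with x Fin.≟ w | y Fin.≟ w
  ...   | yes refl | yes refl = contradiction refl x≢y
  ...   | yes _ | no _ = refl
  ...   | no _ | yes _ = refl
  ...   | no _ | no _ = refl
  starColouring-edge w {x} {y} x≢y | false with x Fin.≟ w | y Fin.≟ w
  ...   | yes refl | yes refl = contradiction refl x≢y
  ...   | yes _ | no _ = refl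
  ...   | no _ | yes _ = refl
  ...   | no _ | no _ = refl

  occurrences-∷ʳ : ∀ w xs x → occurrences w (xs ++ [ x ]) ≡ isCentre w x + occurrences w xs
  occurrences-∷ʳ w [] x = refl
  occurrences-∷ʳ w (y ∷ xs) x = trans (cong (isCentre w y +_) (occurrences-∷ʳ w xs x)) (l (isCentre w y) (isCentre w x) (occurrences w xs))
    where
    l : ∀ a b c → a + (b + c) ≡ b + (a + c)
    l = solve-∀

  occurrences-∉ : ∀ w xs → w ∉ xs → occurrences w xs ≡ 0
  occurrences-∉ w [] _ = refl
  occurrences-∉ w (x ∷ xs) w∉ with x Fin.≟ w
  ... | yes refl = contradiction (here refl) w∉
  ... | no _ = occurrences-∉ w xs (w∉ ∘ there)

  occurrences-Unique : ∀ w {xs} → Unique xs → occurrences w xs ≤ 1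
  occurrences-Unique w [] = z≤n
  occurrences-Unique w {x ∷ xs} (x∉ ∷ u) with x Fin.≟ w
  ... | yes refl = ≤-reflexive (cong suc (occurrences-∉ w xs λ p → All.lookup x∉ p refl))
  ... | no _ = occurrences-Unique w u

  module _ {G : Graph n} (G⊆ : G ⊆ᴱ allEdges n) where

    AdjPair : Edge n → Set
    AdjPair e = Adj G (proj₁ e) (proj₂ e)

    count-red : ∀ w xs ys → length xs ≡ length ys → All AdjPair (zip xs ys) →
                countColour (starColouring w) true (zip xs ys) ≡ occurrences w xs + occurrences w ys
    count-red w [] [] _ _ = refl
    count-red w (x ∷ xs) (y ∷ ys) eq (p ∷ ps) = trans
        (cong₂ _+_ (starColouring-edge w (norm∈⇒≢ G⊆ (Adj⇒norm∈ G⊆ p))) (count-red w xs ys (suc-injective eq) ps))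
        (l (isCentre w x) (isCentre w y) (occurrences w xs) (occurrences w ys))
      where
      l : ∀ a b c d → a + b + (c + d) ≡ a + c + (b + d)
      l = solve-∀

    count-both : ∀ (c : Colouring n) xs ys → length xs ≡ length ys →
                 countColour c true (zip xs ys) + countColour c false (zip xs ys) ≡ length xs
    count-both c [] [] _ = refl
    count-both c (x ∷ xs) (y ∷ ys) eq with colourOf c x y
    ... | true  = cong suc (count-both c xs ys (suc-injective eq))
    ... | false = trans (+-suc _ _) (cong suc (count-both c xs ys (suc-injective eq)))

    -- An edge is red when w is one of its ends. The second ends along the cycle are a rotation of
    -- the first ends, so each visit to w is counted twice; in particular the number of red edges is
    -- never 1.
    red-cycle : ∀ w vs → IsCycle G vs → countColour (starColouring w) true (cycleEdges vs) ≡ 2 * occurrences w vs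
    red-cycle w (v ∷ vs) (_ , _ , adj) = begin
        countColour (starColouring w) true (zip (v ∷ vs) (vs ++ [ v ])) ≡⟨ count-red w (v ∷ vs) (vs ++ [ v ]) (rot-length v vs) adj ⟩
        occurrences w (v ∷ vs) + occurrences w (vs ++ [ v ]) ≡⟨ cong (occurrences w (v ∷ vs) +_) (occurrences-∷ʳ w vs v) ⟩
        occurrences w (v ∷ vs) + occurrences w (v ∷ vs)      ≡⟨ cong (occurrences w (v ∷ vs) +_) (sym (+-identityʳ _)) ⟩
        2 * occurrences w (v ∷ vs) ∎
      where
      open ≡-Reasoning
      rot-length : ∀ (v : Fin n) vs → suc (length vs) ≡ length (vs ++ [ v ])
      rot-length v vs = sym (trans (length-++ vs) (+-comm (length vs) 1))

    2*≢1 : ∀ m → 2 * m ≢ 1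
    2*≢1 (suc m) eq = contradiction (suc-injective (trans (sym (+-suc (suc m) (m + 0))) eq)) λ ()

    triangle-through : ∀ w vs → IsCycle G vs → length vs ≡ 3 → occurrences w vs ≡ 1 → Covered G w
    triangle-through w (x ∷ y ∷ z ∷ []) (_ , _ , (xy ∷ yz ∷ zx ∷ [])) refl occ with x Fin.≟ w
    ... | yes refl = y , z , N xy , norm∈-sym (N zx) , N yz
      where
      N : ∀ {x y} → Adj G x y → norm x y ∈ G
      N = Adj⇒norm∈ G⊆
    ... | no _ with y Fin.≟ w
    ...   | yes refl = z , x , Adj⇒norm∈ G⊆ yz , norm∈-sym (Adj⇒norm∈ G⊆ xy) , Adj⇒norm∈ G⊆ zx
    ...   | no _ with z Fin.≟ w
    ...     | yes refl = x , y , Adj⇒norm∈ G⊆ zx , norm∈-sym (Adj⇒norm∈ G⊆ yz) , Adj⇒norm∈ G⊆ xy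
    ...     | no _ = contradiction occ λ ()

    -- The cycle visits w at most once, so it has 0 or 2 red edges. With exactly one blue edge its
    -- length would be 1, which is too short, or 3, which gives a triangle through w.
    blue-cycle : ∀ w → ¬ Covered G w → ∀ vs → IsCycle G vs → countColour (starColouring w) false (cycleEdges vs) ≢ 1
    blue-cycle w ¬cov (v ∷ vs) cyc@(3≤ , u , _) eq with occurrences w (v ∷ vs) in occ | occurrences-Unique w u
      | trans (sym (cong₂ _+_ (red-cycle w (v ∷ vs) cyc) eq)) (count-both (starColouring w) (v ∷ vs) (vs ++ [ v ]) (sym (trans (length-++ vs) (+-comm (length vs) 1))))
    ... | 0 | _ | total = contradiction (subst (3 ≤_) (sym total) 3≤) λ { (s≤s ()) }
    ... | 1 | _ | total = ¬cov (triangle-through w (v ∷ vs) cyc (sym total) occ)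
    ... | suc (suc _) | s≤s () | _

    other-vertex-edge : Connected G → ∀ {w u} → u ≢ w → ∃[ z ] norm w z ∈ G
    other-vertex-edge conn {w} {u} u≢w with conn w u
    ... | ε = contradiction refl u≢w
    ... | _◅_ {j = z} p _ = z , Adj⇒norm∈ G⊆ p

    incident-norm : ∀ {w x y} → Incident w (norm x y) → x ≡ w ⊎ y ≡ w
    incident-norm {w} {x} {y} p with norm-cases x y
    ... | inj₁ eq = subst (Incident w) eq p
    ... | inj₂ eq = [ inj₂ , inj₁ ]′ (subst (Incident w) eq p)

    norm-incident : ∀ w y → Incident w (norm w y)
    norm-incident w y with norm-cases w y
    ... | inj₁ eq = subst (Incident w) (sym eq) (inj₁ refl)
    ... | inj₂ eq = subst (Incident w) (sym eq) (inj₂ refl)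

    star-NAC : Connected G → ∀ {w u} → u ≢ w → ¬ Covered G w → (∃[ e ] (e ∈ G × ¬ Incident w e)) → HasNAC G
    star-NAC conn {w} {u} u≢w ¬cov (e , e∈ , ¬inc) with other-vertex-edge conn u≢w
    ... | z , wz = starColouring w , (norm w z , wz , red) , (e , e∈ , blue) ,
          λ vs cyc → (λ eq → 2*≢1 (occurrences w vs) (trans (sym (red-cycle w vs cyc)) eq)) , blue-cycle w ¬cov vs cyc
      where
      red : starColouring w (norm w z) ≡ true
      red = dec-true (incident? w (norm w z)) (norm-incident w z)
      blue : starColouring w e ≡ false
      blue = dec-false (incident? w e) ¬inc

    -- If every edge meets w then G is a star, and any other vertex serves as centre instead.
    uncovered⇒NAC : Connected G → ∀ {w w₂ w₃} → w₂ ≢ w → w₃ ≢ w → w₃ ≢ w₂ → ¬ Covered G w → HasNAC G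
    uncovered⇒NAC conn {w} {w₂} {w₃} w₂≢w w₃≢w w₃≢w₂ ¬cov with Any.any? (λ e → ¬? (incident? w e)) G
    ... | yes p = star-NAC conn w₂≢w ¬cov (find p)
    ... | no none = star-NAC conn w₃≢w₂ ¬cov₂ edge₃
      where
      all-incident : ∀ {x y} → norm x y ∈ G → x ≡ w ⊎ y ≡ w
      all-incident {x} {y} p with incident? w (norm x y)
      ... | yes i = incident-norm i
      ... | no ¬i = contradiction (lose p ¬i) none
      ¬cov₂ : ¬ Covered G w₂
      ¬cov₂ (a , b , p , q , r) with all-incident p | all-incident q
      ... | inj₁ eq | _ = w₂≢w eq
      ... | inj₂ _ | inj₁ eq = w₂≢w eq
      ... | inj₂ refl | inj₂ refl = norm∈⇒≢ G⊆ r refl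
      edge₃ : ∃[ e ] (e ∈ G × ¬ Incident w₂ e)
      edge₃ with other-vertex-edge conn {w₃} {w} (w₃≢w ∘ sym)
      ... | z , p with all-incident p
      ...   | inj₁ eq = contradiction eq w₃≢w
      ...   | inj₂ refl = norm w₃ w , p , λ i → [ w₃≢w₂ , w₂≢w ∘ sym ]′ (incident-norm i)

two-others : ∀ {n} (w : Fin (3 + n)) → ∃[ w₂ ] ∃[ w₃ ] (w₂ ≢ w × w₃ ≢ w × w₃ ≢ w₂)
two-others fzero = fsuc fzero , fsuc (fsuc fzero) , (λ ()) , (λ ()) , λ ()
two-others (fsuc fzero) = fzero , fsuc (fsuc fzero) , (λ ()) , (λ ()) , λ ()
two-others (fsuc (fsuc w)) = fzero , fsuc fzero , (λ ()) , (λ ()) , λ ()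

ConnectedNoNAC⇒triangles : ∀ {n} {G : Graph n} → 3 ≤ n → G ⊆ᴱ allEdges n → ConnectedNoNAC G → ∀ v → Covered G v
ConnectedNoNAC⇒triangles {G = G} (s≤s (s≤s (s≤s z≤n))) G⊆ (conn , ¬nac) v with covered? G v
... | yes c = c
... | no ¬c with two-others v
...   | w₂ , w₃ , p , q , r = contradiction (uncovered⇒NAC G⊆ conn p q r ¬c) ¬nac

-- Edges covering a closed set

Σᴸ : ∀ {A : Set} → (A → ℕ) → List A → ℕ
Σᴸ g [] = 0
Σᴸ g (x ∷ xs) = g x + Σᴸ g xs

module _ {A : Set} where

  Σᴸ-mono : ∀ {g g′ : A → ℕ} xs → (∀ {x} → x ∈ xs → g x ≤ g′ x) → Σᴸ g xs ≤ Σᴸ g′ xs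
  Σᴸ-mono [] h = z≤n
  Σᴸ-mono (x ∷ xs) h = +-mono-≤ (h (here refl)) (Σᴸ-mono xs (h ∘ there))

  Σᴸ-*ˡ : ∀ (k : ℕ) (g : A → ℕ) xs → Σᴸ (λ x → k * g x) xs ≡ k * Σᴸ g xs
  Σᴸ-*ˡ k g [] = sym (*-zeroʳ k)
  Σᴸ-*ˡ k g (x ∷ xs) = trans (cong (k * g x +_) (Σᴸ-*ˡ k g xs)) (sym (*-distribˡ-+ k (g x) _))

  Σᴸ-lower : ∀ {k} {g : A → ℕ} xs → (∀ {x} → x ∈ xs → k ≤ g x) → k * length xs ≤ Σᴸ g xs
  Σᴸ-lower {k} [] h = ≤-reflexive (*-zeroʳ k)
  Σᴸ-lower {k} (x ∷ xs) h = ≤-trans (≤-reflexive (*-suc k (length xs))) (+-mono-≤ (h (here refl)) (Σᴸ-lower xs (h ∘ there)))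

  Σᴸ-filter : ∀ {P : A → Set} (P? : Decidable P) (g : A → ℕ) xs → Σᴸ g xs ≡ Σᴸ g (filter P? xs) + Σᴸ g (filter (λ x → ¬? (P? x)) xs)
  Σᴸ-filter P? g [] = refl
  Σᴸ-filter P? g (x ∷ xs) with does (P? x)
  ... | true  = trans (cong (g x +_) (Σᴸ-filter P? g xs)) (sym (+-assoc (g x) _ _))
  ... | false = trans (cong (g x +_) (Σᴸ-filter P? g xs)) (l (g x) (Σᴸ g (filter P? xs)) _)
    where
    l : ∀ a b c → a + (b + c) ≡ b + (a + c)
    l = solve-∀

  length-concatMap : ∀ {B : Set} (f : A → List B) xs → length (concatMap f xs) ≡ Σᴸ (length ∘ f) xs
  length-concatMap f [] = refl
  length-concatMap f (x ∷ xs) = trans (length-++ (f x)) (cong (length (f x) +_) (length-concatMap f xs))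

-- The lists have exact length `w` but may contain repetitions, so a shorter list can be padded.
Sparse : ∀ {n} → Graph n → ℕ → ℕ → Set
Sparse G K w = ∀ A B → length A ≡ w → length B ≡ w → ∀ F → Unique F → (∀ {e} → e ∈ F → e ∈ cross A B × e ∈ G) → length F < K * w

Closing : ∀ {n} → List (Fin n) → Graph n → Edge n → Set
Closing U π e = proj₁ e ∈ U × proj₂ e ∈ U × ∃[ z ] (norm (proj₁ e) z ∈ π × norm (proj₂ e) z ∈ π)

module _ {n : ℕ} where
  open import Data.List.Membership.DecPropositional (Fin._≟_ {n}) using () renaming (_∈?_ to _∈ⱽ?_)

  closing? : ∀ (U : List (Fin n)) π → Decidable (Closing U π)
  closing? U π e = (proj₁ e ∈ⱽ? U) ×-dec ((proj₂ e ∈ⱽ? U) ×-dec Fin.any? λ z → (norm (proj₁ e) z ∈ᴱ? π) ×-dec (norm (proj₂ e) z ∈ᴱ? π))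

  module _ (G : Graph n) (U : List (Fin n)) (U! : Unique U) where

    into : Fin n → List (Fin n)
    into z = filter (λ x → norm x z ∈ᴱ? G) U

    ∈-into⁻ : ∀ {z x} → x ∈ into z → x ∈ U × norm x z ∈ G
    ∈-into⁻ {z} = ∈-filter⁻ (λ x → norm x z ∈ᴱ? G)

    into! : ∀ z → Unique (into z)
    into! z = Unique.filter⁺ (λ x → norm x z ∈ᴱ? G) U!

    d : Fin n → ℕ
    d z = length (into z)

    arcs : List (Fin n) → List (Fin n × Fin n)
    arcs L = concatMap (λ z → map (z ,_) (into z)) L

    length-arcs : ∀ L → length (arcs L) ≡ Σᴸ d L
    length-arcs L = trans (length-concatMap (λ z → map (z ,_) (into z)) L) (cong-Σ L)
      where
      cong-Σ : ∀ L → Σᴸ (λ z → length (map (z ,_) (into z))) L ≡ Σᴸ d L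
      cong-Σ [] = refl
      cong-Σ (z ∷ L) = cong₂ _+_ (length-map (z ,_) (into z)) (cong-Σ L)

    ∈-arcs⁻ : ∀ L {z x} → (z , x) ∈ arcs L → z ∈ L × x ∈ into z
    ∈-arcs⁻ L p with ∈-concatMap-elim (λ z → map (z ,_) (into z)) L p
    ... | z , z∈ , q with ∈-map⁻ (z ,_) q
    ...   | x , x∈ , refl = z∈ , x∈

    arcs! : ∀ {L} → Unique L → Unique (arcs L)
    arcs! L! = Unique-concatMap (λ z → map (z ,_) (into z)) L! (λ z → Unique.map⁺ (cong proj₂) (into! z)) λ p q → same p q
      where
      same : ∀ {z z′ a} → a ∈ map (z ,_) (into z) → a ∈ map (z′ ,_) (into z′) → z ≡ z′
      same {z} {z′} p q with ∈-map⁻ (z ,_) p | ∈-map⁻ (z′ ,_) q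
      ... | _ , _ , refl | _ , _ , eq = cong proj₁ eq

    edgesOf : List (Fin n) → List (Edge n)
    edgesOf L = deduplicate _≟ᴱ_ (map (λ a → norm (proj₁ a) (proj₂ a)) (arcs L))

    edgesOf-sound : ∀ L {e} → e ∈ edgesOf L → e ∈ cross L U × e ∈ G
    edgesOf-sound L p with ∈-map⁻ (λ a → norm (proj₁ a) (proj₂ a)) (∈-deduplicate⁻ _≟ᴱ_ _ p)
    ... | (z , x) , a∈ , refl with ∈-arcs⁻ L a∈
    ...   | z∈ , x∈ with ∈-into⁻ x∈
    ...     | x∈U , e = ∈-cross z∈ x∈U , norm∈-sym e

    -- An edge can arise as an arc in both directions when its ends lie in `L` as well as in `U`;
    -- hence the factor 2.
    arcs≤2*edges : ∀ {L} → Unique L → Σᴸ d L ≤ length (edgesOf L) * 2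
    arcs≤2*edges {L} L! = begin
        Σᴸ d L                 ≡⟨ sym (length-arcs L) ⟩
        length (arcs L)        ≤⟨ Unique-⊆-length (arcs! L!) cover ⟩
        length (concatMap both (edgesOf L)) ≤⟨ length-concatMap-≤ both (edgesOf L) (λ _ → ≤-refl) ⟩
        length (edgesOf L) * 2 ∎
      where
      open ≤-Reasoning
      both : Edge n → List (Fin n × Fin n)
      both e = e ∷ (proj₂ e , proj₁ e) ∷ []
      cover : ∀ {a} → a ∈ arcs L → a ∈ concatMap both (edgesOf L)
      cover {z , x} a∈ = ∈-concatMap-intro both (∈-deduplicate⁺ _≟ᴱ_ (∈-map⁺ (λ a → norm (proj₁ a) (proj₂ a)) a∈)) orient
        where
        orient : (z , x) ∈ both (norm z x)
        orient with norm-cases z x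
        ... | inj₁ eq = subst (λ e → (z , x) ∈ both e) (sym eq) (here refl)
        ... | inj₂ eq = subst (λ e → (z , x) ∈ both e) (sym eq) (there (here refl))

    module _ {D K : ℕ} (deg : ∀ v → length (neighbours G v) ≤ D) (sparse : Sparse G K (length U)) where

      d≤D : ∀ z → d z ≤ D
      d≤D z = ≤-trans (Unique-⊆-length (into! z) λ p → ∈-filter⁺ (λ x → norm z x ∈ᴱ? G) (∈-allFin _) (norm∈-sym (proj₂ (∈-into⁻ p)))) (deg z)

      Σd≤ : ∀ {L} → Unique L → Σᴸ d L ≤ length U * D
      Σd≤ {L} L! = ≤-trans (≤-reflexive (sym (length-arcs L))) (≤-trans (Unique-⊆-length (arcs! L!) cover)
          (length-concatMap-≤ rev U λ {x} _ → ≤-trans (≤-reflexive (length-map (_, x) (neighbours G x))) (deg x)))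
        where
        rev : Fin n → List (Fin n × Fin n)
        rev x = map (_, x) (neighbours G x)
        cover : ∀ {a} → a ∈ arcs L → a ∈ concatMap rev U
        cover {z , x} a∈ with ∈-into⁻ (proj₂ (∈-arcs⁻ L a∈))
        ... | x∈ , e = ∈-concatMap-intro rev x∈ (∈-map⁺ (_, x) (∈-filter⁺ (λ z → norm x z ∈ᴱ? G) (∈-allFin z) e))

      heavy? : Decidable (λ z → 2 * K ≤ d z)
      heavy? z = 2 * K ≤? d z

      heavy : List (Fin n)
      heavy = filter heavy? (allFin n)

      Σd-sparse : ∀ {L} → Unique L → length L ≤ length U → 0 < length U → Σᴸ d L < 2 * K * length U
      Σd-sparse {L} L! L≤ U>0 = ≤-<-trans (arcs≤2*edges L!) (≤-trans
          (*-monoˡ-< 2 (sparse padded U len refl (edgesOf L) (deduplicate-! _≟ᴱ_ _) λ p →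
            let (e∈ , e∈G) = edgesOf-sound L p in subset e∈ , e∈G))
          (≤-reflexive (l K (length U))))
        where
        l : ∀ k u → k * u * 2 ≡ 2 * k * u
        l = solve-∀
        x₀ : Fin n
        x₀ = Data.List.lookup U (fromℕ< U>0)
        -- Copies of one vertex bring `L` to the exact length that `Sparse` demands.
        padded : List (Fin n)
        padded = L ++ replicate (length U ∸ length L) x₀
        len : length padded ≡ length U
        len = trans (length-++ L) (trans (cong (length L +_) (length-replicate (length U ∸ length L))) (m+[n∸m]≡n L≤))
        subset : ∀ {e} → e ∈ cross L U → e ∈ cross padded U
        subset p with ∈-cross⁻ L U p
        ... | x , y , x∈ , y∈ , refl = ∈-cross (∈-++⁺ˡ x∈) y∈

      -- Otherwise `length U` heavy vertices would send at least 2K|U| arcs into U, which is more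
      -- than sparsity allows.
      heavy-few : 0 < length U → length heavy ≤ length U
      heavy-few U>0 with length heavy ≤? length U
      ... | yes p = p
      ... | no ≰ = contradiction (≤-<-trans lower (Σd-sparse (Unique.take⁺ (length U) heavy!) (length-take-≤ (length U) heavy) U>0)) (<-irrefl refl)
        where
        heavy! : Unique heavy
        heavy! = Unique.filter⁺ heavy? (Unique.allFin⁺ n)
        lower : 2 * K * length U ≤ Σᴸ d (take (length U) heavy)
        lower = ≤-trans (≤-reflexive (cong (2 * K *_) (sym (length-take-exact heavy (<⇒≤ (≰⇒> ≰))))))
          (Σᴸ-lower (take (length U) heavy) λ p → proj₂ (∈-filter⁻ heavy? {xs = allFin n} (take-⊆ (length U) heavy p)))

      -- Heavy vertices have d ≤ D, and their degrees into U sum to less than 2K|U| because there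
      -- are at most |U| of them. Light vertices have d < 2K, and their degrees sum to at most |U|D.
      -- Each part contributes at most 2KD|U|.
      Σd² : 0 < length U → Σᴸ (λ z → d z * d z) (allFin n) ≤ length U * (4 * K * D)
      Σd² U>0 = begin
          Σᴸ (λ z → d z * d z) (allFin n)                            ≡⟨ Σᴸ-filter heavy? _ (allFin n) ⟩
          Σᴸ (λ z → d z * d z) heavy + Σᴸ (λ z → d z * d z) light    ≤⟨ +-mono-≤ (Σᴸ-mono heavy λ {z} _ → *-monoˡ-≤ (d z) (d≤D z))
                                                                          (Σᴸ-mono light λ {z} p → *-monoˡ-≤ (d z) (<⇒≤ (≰⇒> (proj₂ (∈-filter⁻ (λ x → ¬? (heavy? x)) {xs = allFin n} p))))) ⟩
          Σᴸ (λ z → D * d z) heavy + Σᴸ (λ z → 2 * K * d z) light    ≡⟨ cong₂ _+_ (Σᴸ-*ˡ D d heavy) (Σᴸ-*ˡ (2 * K) d light) ⟩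
          D * Σᴸ d heavy + 2 * K * Σᴸ d light                        ≤⟨ +-mono-≤ (*-monoʳ-≤ D (<⇒≤ (Σd-sparse (Unique.filter⁺ heavy? (Unique.allFin⁺ n)) (heavy-few U>0) U>0)))
                                                                          (*-monoʳ-≤ (2 * K) (Σd≤ (Unique.filter⁺ (λ x → ¬? (heavy? x)) (Unique.allFin⁺ n)))) ⟩
          D * (2 * K * length U) + 2 * K * (length U * D)            ≡⟨ l D K (length U) ⟩
          length U * (4 * K * D) ∎
        where
        open ≤-Reasoning
        light : List (Fin n)
        light = filter (λ x → ¬? (heavy? x)) (allFin n)
        l : ∀ D K u → D * (2 * K * u) + 2 * K * (u * D) ≡ u * (4 * K * D)
        l = solve-∀

      -- A closing edge joins two neighbours, both in U, of some vertex z, and z offers at most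
      -- d(z)^2 such pairs. The result is linear in |U|, against the |U|^2 pairs available without
      -- the triangle.
      closing-count : 0 < length U → ∀ π → π ⊆ᴱ G → length (filter (closing? U π) (allEdges n)) ≤ length U * (4 * K * D)
      closing-count U>0 π π⊆ = begin
          length (filter (closing? U π) (allEdges n))   ≤⟨ Unique-⊆-length (Unique.filter⁺ (closing? U π) (allEdges-Unique n)) cover ⟩
          length (concatMap walks (allFin n))           ≡⟨ length-concatMap walks (allFin n) ⟩
          Σᴸ (length ∘ walks) (allFin n)                ≤⟨ Σᴸ-mono (allFin n) (λ {z} _ → ≤-reflexive (length-cross (into z) (into z))) ⟩
          Σᴸ (λ z → d z * d z) (allFin n)               ≤⟨ Σd² U>0 ⟩
          length U * (4 * K * D) ∎
        where
        open ≤-Reasoning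
        walks : Fin n → List (Edge n)
        walks z = cross (into z) (into z)
        cover : ∀ {e} → e ∈ filter (closing? U π) (allEdges n) → e ∈ concatMap walks (allFin n)
        cover {x , y} p with ∈-filter⁻ (closing? U π) {xs = allEdges n} p
        ... | e∈ , x∈ , y∈ , z , xz , yz = ∈-concatMap-intro walks (∈-allFin z)
              (subst (_∈ walks z) (edge-norm e∈) (∈-cross (∈-filter⁺ (λ x → norm x z ∈ᴱ? G) x∈ (π⊆ xz)) (∈-filter⁺ (λ x → norm x z ∈ᴱ? G) y∈ (π⊆ yz))))

  -- A stopping rule that consults only the edge list and `u`. The default `[]` keeps the size at
  -- most `u` for every input.
  scanUncovered : ℕ → Graph n → Graph n → List (Fin n)
  scanUncovered u π τ with length (uncovered π) ≤? u
  ... | yes _ = uncovered π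
  scanUncovered u π [] | no _ = []
  scanUncovered u π (e ∷ τ) | no _ = scanUncovered u (π ++ [ e ]) τ

  firstSmall : ℕ → Graph n → List (Fin n)
  firstSmall u ρ = scanUncovered u [] ρ

  scan-length : ∀ u π τ → length (scanUncovered u π τ) ≤ u
  scan-length u π τ with length (uncovered π) ≤? u
  ... | yes p = p
  scan-length u π [] | no _ = z≤n
  scan-length u π (e ∷ τ) | no _ = scan-length u (π ++ [ e ]) τ

  scan-Unique : ∀ u π τ → Unique (scanUncovered u π τ)
  scan-Unique u π τ with length (uncovered π) ≤? u
  ... | yes p = Unique.filter⁺ (λ v → ¬? (covered? π v)) (Unique.allFin⁺ n)
  scan-Unique u π [] | no _ = []
  scan-Unique u π (e ∷ τ) | no _ = scan-Unique u (π ++ [ e ]) τ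

  -- Coverage is monotone: a prefix with at most `u` uncovered vertices is no earlier than the
  -- stopping point, so whatever it leaves uncovered was uncovered there too.
  scan-⊇ : ∀ u π τ k {v} → length (uncovered (π ++ take k τ)) ≤ u → v ∈ uncovered (π ++ take k τ) → v ∈ scanUncovered u π τ
  scan-⊇ u π τ k {v} small v∈ with length (uncovered π) ≤? u
  ... | yes _ = ∈-uncovered λ c → uncovered-sound v∈ (Covered-mono ∈-++⁺ˡ c)
  scan-⊇ u π τ zero small v∈ | no ≰ = contradiction (subst (λ G → length (uncovered G) ≤ u) (++-identityʳ π) small) ≰
  scan-⊇ u π [] (suc k) small v∈ | no ≰ = contradiction (subst (λ G → length (uncovered G) ≤ u) (++-identityʳ π) small) ≰
  scan-⊇ u π (e ∷ τ) (suc k) {v} small v∈ | no _ = scan-⊇ u (π ++ [ e ]) τ k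
    (subst (λ G → length (uncovered G) ≤ u) (sym (++-assoc π [ e ] (take k τ))) small)
    (subst (λ G → v ∈ uncovered G) (sym (++-assoc π [ e ] (take k τ))) v∈)

take-length-++ : ∀ {A : Set} (xs ys : List A) → take (length xs) (xs ++ ys) ≡ xs
take-length-++ [] ys = refl
take-length-++ (x ∷ xs) ys = cong (x ∷_) (take-length-++ xs ys)

take-take-≤ : ∀ {A : Set} {s t} (xs : List A) → s ≤ t → take s (take t xs) ≡ take s xs
take-take-≤ {s = zero} xs _ = refl
take-take-≤ {s = suc s} {suc t} [] _ = refl
take-take-≤ {s = suc s} {suc t} (x ∷ xs) (s≤s p) = cong (x ∷_) (take-take-≤ xs p)

-- Recovering the triangle edges of a closed set from the remaining edges

module _ {n : ℕ} where

  open RareEvents (_≟ᴱ_ {n}) (allEdges n) (allEdges-Unique n)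

  insideC₀ : ℕ → Graph n → List (Edge n)
  insideC₀ u ρ = cross (firstSmall u ρ) (firstSmall u ρ)

  closingC₁ : ℕ → Graph n → Graph n → List (Edge n)
  closingC₁ u ρ α = filter (closing? (firstSmall u ρ) (ρ ++ α)) (allEdges n)

  -- An edge of F and its common neighbours are at most 2 + h vertices, hence `u`. A closing edge
  -- accounts for itself and at most 2h edges of triangles on it, hence `1 + h * 2`.
  CoverHit : (m h K D f : ℕ) → Graph n → Set
  CoverHit m h K D f = LabelledHit m f (1 + h * 2) (u * u) (u * (4 * K * D)) (insideC₀ u) (closingC₁ u)
    where u = (2 + h) * f

  module _ (closing : Graph n → Edge n → Bool) where

    -- Each entry is judged knowing only the earlier ones, which is the information that `choices`
    -- has when the entry is picked.
    labelling : Graph n → Graph n → List Bool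
    labelling α [] = []
    labelling α (e ∷ φ) = closing α e ∷ labelling (α ++ [ e ]) φ

    length-labelling : ∀ α φ → length (labelling α φ) ≡ length φ
    length-labelling α [] = refl
    length-labelling α (e ∷ φ) = cong suc (length-labelling (α ++ [ e ]) φ)

    labelAt-labelling : ∀ α₀ α e β → labelAt (labelling α₀ (α ++ e ∷ β)) (length α) ≡ closing (α₀ ++ α) e
    labelAt-labelling α₀ [] e β = cong (λ t → closing t e) (sym (++-identityʳ α₀))
    labelAt-labelling α₀ (a ∷ α) e β = trans (labelAt-labelling (α₀ ++ [ a ]) α e β) (cong (λ t → closing t e) (++-assoc α₀ [ a ] α))

    ∈-pick-labelling : ∀ α₀ α e β → closing (α₀ ++ α) e ≡ true → e ∈ pick₁ (labelling α₀ (α ++ e ∷ β)) (α ++ e ∷ β)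
    ∈-pick-labelling α₀ [] e β eq rewrite trans (cong (λ t → closing t e) (sym (++-identityʳ α₀))) eq = here refl
    ∈-pick-labelling α₀ (a ∷ α) e β eq with closing α₀ a
    ... | true  = there (∈-pick-labelling (α₀ ++ [ a ]) α e β (trans (cong (λ t → closing t e) (++-assoc α₀ [ a ] α)) eq))
    ... | false = ∈-pick-labelling (α₀ ++ [ a ]) α e β (trans (cong (λ t → closing t e) (++-assoc α₀ [ a ] α)) eq)

  ends-norm : ∀ (P : Fin n → Fin n → Set) → (∀ {x y} → P x y → P y x) → ∀ {x y} → P x y → P (proj₁ (norm x y)) (proj₂ (norm x y))
  ends-norm P s {x} {y} p with norm-cases x y
  ... | inj₁ eq = subst (λ e → P (proj₁ e) (proj₂ e)) (sym eq) p
  ... | inj₂ eq = subst (λ e → P (proj₁ e) (proj₂ e)) (sym eq) (s p)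

  module _ {σ : List (Edge n)} (σ↭ : σ ↭ allEdges n) {m h K D : ℕ} (m≤M : m ≤ M)
           (deg : ∀ v → length (neighbours (take m σ) v) ≤ D)
           (codeg : ∀ {a b} → a ≢ b → length (common (take m σ) a b) ≤ h)
           {Kₛ s₀ w₀ : ℕ} (sparseₛ : ∀ {w} → 1 ≤ w → w ≤ s₀ → Sparse (take m σ) Kₛ w)
           (sparse : ∀ {w} → 1 ≤ w → w ≤ w₀ → Sparse (take m σ) K w) (w₀-big : (2 + h) * (Kₛ * s₀) ≤ w₀)
           {t : ℕ} (t≤m : t ≤ m) (cov : ∀ v → Covered (take t σ) v)
           {S : Fin n → Set} (S? : Decidable S) (v₀ : Fin n) (v₀∈S : S v₀) (S-small : count S? ≤ s₀) (closed : Closed (take t σ) S) where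

    private
      Gm G : Graph n
      Gm = take m σ
      G = take t σ

      G⊆Gm : G ⊆ᴱ Gm
      G⊆Gm = take-mono-⊆ σ t≤m

      Gm⊆ : Gm ⊆ᴱ allEdges n
      Gm⊆ p = ordering-⊆ σ↭ (take-⊆ m σ p)

      Gm! : Unique Gm
      Gm! = Unique.take⁺ m (ordering-Unique σ↭)

      IsT : Fin n → Fin n → Set
      IsT x y = S x × S y × ∃[ z ] (norm x z ∈ G × norm y z ∈ G)

      IsT-sym : ∀ {x y} → IsT x y → IsT y x
      IsT-sym (p , q , z , a , b) = q , p , z , b , a

      isT? : Decidable (λ e → IsT (proj₁ e) (proj₂ e))
      isT? e = S? (proj₁ e) ×-dec (S? (proj₂ e) ×-dec Fin.any? λ z → (norm (proj₁ e) z ∈ᴱ? G) ×-dec (norm (proj₂ e) z ∈ᴱ? G))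

      F : Graph n
      F = filter isT? G

      F⁻ : ∀ {e} → e ∈ F → e ∈ G × IsT (proj₁ e) (proj₂ e)
      F⁻ = ∈-filter⁻ isT?

      F⁺ : ∀ {x y z} → S x → S y → norm x y ∈ G → norm x z ∈ G → norm y z ∈ G → norm x y ∈ F
      F⁺ Sx Sy xy xz yz = ∈-filter⁺ isT? xy (ends-norm IsT IsT-sym (Sx , Sy , _ , xz , yz))

      inF? : Decidable (_∈ F)
      inF? e = e ∈ᴱ? F

      notF? : Decidable (_∉ F)
      notF? e = ¬? (inF? e)

      -- `ρ` extends to time `m` and not just `t`, so the mask and the ordering determine it without
      -- knowledge of `t`; `H` is a prefix of it.
      φ ρ H : Graph n
      φ = filter inF? Gm
      ρ = filter notF? Gm
      H = filter notF? G

      φ⁻ : ∀ {e} → e ∈ φ → e ∈ F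
      φ⁻ p = proj₂ (∈-filter⁻ inF? {xs = Gm} p)

      φ⁺ : ∀ {e} → e ∈ F → e ∈ φ
      φ⁺ p = ∈-filter⁺ inF? (G⊆Gm (proj₁ (F⁻ p))) p

      f u : ℕ
      f = length φ
      u = (2 + h) * f

      U : List (Fin n)
      U = firstSmall u ρ

      prefix-H : take (length H) ρ ≡ H
      prefix-H = trans (cong (take (length H)) split) (take-length-++ H _)
        where
        split : ρ ≡ H ++ filter notF? (drop t Gm)
        split = trans (cong (filter notF?) (trans (sym (take++drop≡id t Gm)) (cong (_++ drop t Gm) (take-take-≤ σ t≤m))))
                      (filter-++ notF? G (drop t Gm))

      touched : Edge n → List (Fin n)
      touched e = proj₁ e ∷ proj₂ e ∷ common Gm (proj₁ e) (proj₂ e)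

      ends≢ : ∀ {e} → e ∈ Gm → proj₁ e ≢ proj₂ e
      ends≢ {x , y} p eq = <-irrefl (cong toℕ eq) (∈-allEdges⁻ (Gm⊆ p))

      end-touched : ∀ v a → v ∈ touched (norm v a)
      end-touched v a with norm-cases v a
      ... | inj₁ eq = subst (λ e → v ∈ touched e) (sym eq) (here refl)
      ... | inj₂ eq = subst (λ e → v ∈ touched e) (sym eq) (there (here refl))

      apex-touched : ∀ {v a b} → norm v a ∈ Gm → norm v b ∈ Gm → v ∈ touched (norm a b)
      apex-touched {v} {a} {b} va vb = there (there
        (∈-filter⁺ (λ x → (norm (proj₁ (norm a b)) x ∈ᴱ? Gm) ×-dec (norm (proj₂ (norm a b)) x ∈ᴱ? Gm)) (∈-allFin v)
          (ends-norm (λ x y → norm x v ∈ Gm × norm y v ∈ Gm) (λ (p , q) → q , p) (norm∈-sym va , norm∈-sym vb))))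

      -- Every triangle of G at v has lost a side to F: either a side at v, so v is an end of it, or
      -- the opposite side, so v is a common neighbour of its ends.
      uncovered-touched : ∀ {v} → v ∈ uncovered H → v ∈ concatMap touched φ
      uncovered-touched {v} p = triangle (cov v)
        where
        triangle : Covered G v → v ∈ concatMap touched φ
        triangle (a , b , va , vb , ab) = by-case (inF? (norm v a)) (inF? (norm v b)) (inF? (norm a b))
          where
          by-case : Dec (norm v a ∈ F) → Dec (norm v b ∈ F) → Dec (norm a b ∈ F) → v ∈ concatMap touched φ
          by-case (yes q) _ _ = ∈-concatMap-intro touched (φ⁺ q) (end-touched v a)
          by-case (no _) (yes q) _ = ∈-concatMap-intro touched (φ⁺ q) (end-touched v b)
          by-case (no _) (no _) (yes q) = ∈-concatMap-intro touched (φ⁺ q) (apex-touched (G⊆Gm va) (G⊆Gm vb))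
          by-case (no ¬p) (no ¬q) (no ¬r) = contradiction
            (a , b , ∈-filter⁺ notF? va ¬p , ∈-filter⁺ notF? vb ¬q , ∈-filter⁺ notF? ab ¬r) (uncovered-sound p)

      few-uncovered : length (uncovered H) ≤ u
      few-uncovered = ≤-trans (Unique-⊆-length (Unique.filter⁺ (λ v → ¬? (covered? H v)) (Unique.allFin⁺ n)) uncovered-touched)
        (≤-trans (length-concatMap-≤ touched φ (λ p → s≤s (s≤s (codeg (ends≢ (proj₁ (∈-filter⁻ inF? {xs = Gm} p)))))))
          (≤-reflexive (*-comm f (2 + h))))

      uncovered-U : ∀ {v} → v ∈ uncovered H → v ∈ U
      uncovered-U p = scan-⊇ u [] ρ (length H)
        (subst (λ G → length (uncovered G) ≤ u) (sym prefix-H) few-uncovered) (subst (λ G → _ ∈ uncovered G) (sym prefix-H) p)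

      -- A triangle at x has a second vertex in S, and the side joining x to it lies in F.
      S-uncovered : ∀ {x} → S x → x ∈ uncovered H
      S-uncovered {x} Sx = ∈-uncovered λ { (a , b , xa , xb , ab) →
        let (xa∈ , xa∉) = ∈-filter⁻ notF? {xs = G} xa
            (xb∈ , xb∉) = ∈-filter⁻ notF? {xs = G} xb
            (ab∈ , _) = ∈-filter⁻ notF? {xs = G} ab in
        [ (λ Sa → xa∉ (F⁺ Sx Sa xa∈ xb∈ ab∈)) , (λ Sb → xb∉ (F⁺ Sx Sb xb∈ xa∈ (norm∈-sym ab∈))) ]′ (closed Sx xa∈ xb∈ ab∈) }

      φ-ends : ∀ {e} → e ∈ φ → proj₁ e ∈ U × proj₂ e ∈ U
      φ-ends p = let (_ , Sx , Sy , _) = F⁻ (φ⁻ p) in uncovered-U (S-uncovered Sx) , uncovered-U (S-uncovered Sy)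

      f≥1 : 1 ≤ f
      f≥1 with cov v₀
      ... | a , b , va , vb , ab = [ (λ Sa → ∈-length (φ⁺ (F⁺ v₀∈S Sa va vb ab))) , (λ Sb → ∈-length (φ⁺ (F⁺ v₀∈S Sb vb va (norm∈-sym ab)))) ]′
            (closed v₀∈S va vb ab)

      -- Sparsity is used at two scales: here for S itself, which bounds F and therefore U; then
      -- `sparse` applies to U.
      f≤ : f ≤ Kₛ * s₀
      f≤ = ≤-trans (<⇒≤ (sparseₛ (∈-length (∈-filter⁺ S? (∈-allFin v₀) v₀∈S)) S-small Sₗ Sₗ refl refl φ (Unique.filter⁺ inF? Gm!) inside))
        (*-monoʳ-≤ Kₛ S-small)
        where
        Sₗ : List (Fin n)
        Sₗ = filter S? (allFin n)
        inside : ∀ {e} → e ∈ φ → e ∈ cross Sₗ Sₗ × e ∈ Gm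
        inside {x , y} p with F⁻ (φ⁻ p)
        ... | e∈ , Sx , Sy , _ = subst (_∈ cross Sₗ Sₗ) (edge-norm (Gm⊆ (G⊆Gm e∈))) (∈-cross (∈-filter⁺ S? (∈-allFin x) Sx) (∈-filter⁺ S? (∈-allFin y) Sy)) , G⊆Gm e∈

      U! : Unique U
      U! = scan-Unique u [] ρ

      U≤ : length U ≤ u
      U≤ = scan-length u [] ρ

      closingᵇ : Graph n → Edge n → Bool
      closingᵇ α e = does (closing? U (ρ ++ α) e)

      l : List Bool
      l = labelling closingᵇ [] φ

      spokes : Edge n → List (Edge n)
      spokes e = concatMap (λ z → norm (proj₁ e) z ∷ norm (proj₂ e) z ∷ []) (common Gm (proj₁ e) (proj₂ e))

      star : Edge n → List (Edge n)
      star e = e ∷ spokes e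

      spoke : ∀ {p q y} → norm p y ∈ Gm → norm q y ∈ Gm → norm p y ∈ star (norm p q) × norm q y ∈ star (norm p q)
      spoke {p} {q} {y} py qy = ends-norm (λ a b → norm p y ∈ norm p q ∷ spokes′ a b × norm q y ∈ norm p q ∷ spokes′ a b)
          (λ {a} {b} (r , s) → flip a b r , flip a b s)
          (there (∈-concatMap-intro _ y∈ (here refl)) , there (∈-concatMap-intro _ y∈ (there (here refl))))
        where
        spokes′ : Fin n → Fin n → List (Edge n)
        spokes′ a b = concatMap (λ z → norm a z ∷ norm b z ∷ []) (common Gm a b)
        y∈ : y ∈ common Gm p q
        y∈ = ∈-filter⁺ (λ x → (norm p x ∈ᴱ? Gm) ×-dec (norm q x ∈ᴱ? Gm)) (∈-allFin y) (py , qy)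
        flip : ∀ a b {e} → e ∈ norm p q ∷ spokes′ a b → e ∈ norm p q ∷ spokes′ b a
        flip a b (here r) = here r
        flip a b (there r) with ∈-concatMap-elim _ (common Gm a b) r
        ... | z , z∈ , r′ with ∈-filter⁻ (λ x → (norm a x ∈ᴱ? Gm) ×-dec (norm b x ∈ᴱ? Gm)) {xs = allFin n} z∈
        ...   | _ , az , bz = there (∈-concatMap-intro _ (∈-filter⁺ (λ x → (norm b x ∈ᴱ? Gm) ×-dec (norm a x ∈ᴱ? Gm)) (∈-allFin z) (bz , az)) (swap r′))
          where
          swap : ∀ {a b : Edge n} {e} → e ∈ a ∷ b ∷ [] → e ∈ b ∷ a ∷ []
          swap (here r) = there (here r)
          swap (there (here r)) = here r

      -- The edge of a triangle that is revealed last closes the triangle.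
      closed-by-last : ∀ {x y z} → (x , y) ∈ φ → (x , y) ∈ G → norm x z ∈ G → norm y z ∈ G → ∃[ e′ ] (e′ ∈ pick₁ l φ × (x , y) ∈ star e′)
      closed-by-last {x} {y} {z} e∈ xy∈ xz yz = go (last-satisfying P? (lose e∈ (inj₁ (sym xy-eq))))
        where
        xy-eq : norm x y ≡ (x , y)
        xy-eq = edge-norm (Gm⊆ (G⊆Gm xy∈))
        xy : norm x y ∈ G
        xy = subst (_∈ G) (sym xy-eq) xy∈
        P : Edge n → Set
        P e = e ≡ norm x y ⊎ e ≡ norm x z ⊎ e ≡ norm y z
        P? : Decidable P
        P? e = (e ≟ᴱ norm x y) ⊎-dec ((e ≟ᴱ norm x z) ⊎-dec (e ≟ᴱ norm y z))
        x≢y : x ≢ y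
        x≢y = norm∈⇒≢ Gm⊆ (G⊆Gm xy)
        x≢z : x ≢ z
        x≢z = norm∈⇒≢ Gm⊆ (G⊆Gm xz)
        y≢z : y ≢ z
        y≢z = norm∈⇒≢ Gm⊆ (G⊆Gm yz)
        go : (∃[ α ] ∃[ e′ ] ∃[ β ] (φ ≡ α ++ e′ ∷ β × P e′ × (∀ {o} → o ∈ β → ¬ P o))) → ∃[ e′ ] (e′ ∈ pick₁ l φ × (x , y) ∈ star e′)
        go (α , e′ , β , φ-eq , Pe′ , none) = e′ , picked , covers Pe′
          where
          -- Another side of the triangle is either outside F, hence in `ρ`, or in `φ` before `e′`,
          -- since `e′` is the last side occurring there.
          earlier : ∀ {o} → P o → o ≢ e′ → o ∈ G → o ∈ ρ ++ α
          earlier {o} Po o≢ o∈ = by-case (inF? o)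
            where
            in-φ : o ∈ α ⊎ o ∈ e′ ∷ β → o ∈ ρ ++ α
            in-φ (inj₁ o∈α) = ∈-++⁺ʳ ρ o∈α
            in-φ (inj₂ (here eq)) = contradiction eq o≢
            in-φ (inj₂ (there o∈β)) = contradiction Po (none o∈β)
            by-case : Dec (o ∈ F) → o ∈ ρ ++ α
            by-case (no o∉) = ∈-++⁺ˡ (∈-filter⁺ notF? (G⊆Gm o∈) o∉)
            by-case (yes o∈F) = in-φ (∈-++⁻ α (subst (o ∈_) φ-eq (φ⁺ o∈F)))
          e′-ends : proj₁ e′ ∈ U × proj₂ e′ ∈ U
          e′-ends = φ-ends (subst (e′ ∈_) (sym φ-eq) (∈-insert α))
          closes : ∀ {p q r} → e′ ≡ norm p q → norm p r ∈ ρ ++ α → norm q r ∈ ρ ++ α → Closing U (ρ ++ α) e′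
          closes {p} {q} {r} eq pr qr = proj₁ e′-ends , proj₂ e′-ends ,
            r , subst (λ e → norm (proj₁ e) r ∈ ρ ++ α × norm (proj₂ e) r ∈ ρ ++ α) (sym eq)
                  (ends-norm (λ a b → norm a r ∈ ρ ++ α × norm b r ∈ ρ ++ α) (λ (c , d) → d , c) (pr , qr))
          closing-e′ : P e′ → Closing U (ρ ++ α) e′
          closing-e′ (inj₁ eq) = closes eq
            (earlier (inj₂ (inj₁ refl)) (λ q → y≢z (sym (norm-injectiveʳ (trans q eq)))) xz)
            (earlier (inj₂ (inj₂ refl)) (λ q → x≢z (sym (norm-injectiveʳ (trans q (trans eq (norm-sym x y)))))) yz)
          closing-e′ (inj₂ (inj₁ eq)) = closes eq
            (earlier (inj₁ refl) (λ q → y≢z (norm-injectiveʳ (trans q eq))) xy)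
            (subst (_∈ ρ ++ α) (norm-sym y z) (earlier (inj₂ (inj₂ refl)) (λ q → x≢y (sym (norm-injectiveʳ (trans (norm-sym z y) (trans q (trans eq (norm-sym x z))))))) yz))
          closing-e′ (inj₂ (inj₂ eq)) = closes eq
            (subst (_∈ ρ ++ α) (norm-sym x y) (earlier (inj₁ refl) (λ q → x≢z (norm-injectiveʳ (trans (norm-sym y x) (trans q eq)))) xy))
            (subst (_∈ ρ ++ α) (norm-sym x z) (earlier (inj₂ (inj₁ refl)) (λ q → x≢y (norm-injectiveʳ (trans (norm-sym z x) (trans q (trans eq (norm-sym y z)))))) xz))
          picked : e′ ∈ pick₁ l φ
          picked = subst (λ φ′ → e′ ∈ pick₁ (labelling closingᵇ [] φ′) φ′) (sym φ-eq)
            (∈-pick-labelling closingᵇ [] α e′ β (dec-true (closing? U (ρ ++ α) e′) (closing-e′ Pe′)))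
          covers : P e′ → (x , y) ∈ star e′
          covers (inj₁ eq) = here (trans (sym xy-eq) (sym eq))
          covers (inj₂ (inj₁ eq)) = subst₂ (λ e e″ → e ∈ star e″) xy-eq (sym eq) (proj₁ (spoke (G⊆Gm xy) (norm∈-sym (G⊆Gm yz))))
          covers (inj₂ (inj₂ eq)) = subst₂ (λ e e″ → e ∈ star e″) (trans (norm-sym y x) xy-eq) (sym eq) (proj₁ (spoke (norm∈-sym (G⊆Gm xy)) (norm∈-sym (G⊆Gm xz))))

      last-closes : ∀ {e} → e ∈ φ → ∃[ e′ ] (e′ ∈ pick₁ l φ × e ∈ star e′)
      last-closes e∈ = let (e∈G , _ , _ , _ , xz , yz) = F⁻ (φ⁻ e∈) in closed-by-last e∈ e∈G xz yz

      w : List Bool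
      w = mask inF? Gm

      len-Gm : length Gm ≡ m
      len-Gm = length-take-exact σ (≤-trans m≤M (≤-reflexive (sym (↭-length σ↭))))

      len-w : length w ≡ m
      len-w = trans (length-map _ Gm) len-Gm

      picked-φ : pick₁ w (take (length w) σ) ≡ φ
      picked-φ = trans (cong (λ t → pick₁ w (take t σ)) len-w) (pick₁-mask inF? Gm)

      picked-ρ : pick₀ w (take (length w) σ) ≡ ρ
      picked-ρ = trans (cong (λ t → pick₀ w (take t σ)) len-w) (pick₀-mask inF? Gm)

      trues-w : trues w ≡ f
      trues-w = trans (sym (length-pick₁ w Gm (sym (length-map _ Gm)))) (cong length (pick₁-mask inF? Gm))

      len-l : length l ≡ f
      len-l = length-labelling closingᵇ [] φ

      spokes-length : ∀ {e} → e ∈ pick₁ l φ → length (star e) ≤ 1 + h * 2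
      spokes-length {e} p = s≤s (≤-trans (length-concatMap-≤ _ (common Gm (proj₁ e) (proj₂ e)) (λ _ → ≤-refl))
        (*-monoˡ-≤ 2 (codeg (ends≢ (proj₁ (∈-filter⁻ inF? {xs = Gm} (∈-pick₁ l p)))))))

      -- Each edge of `φ` lies in the `star` of a closing edge, and a star has at most 1 + 2h edges.
      many-closing : f ≤ (1 + h * 2) * trues l
      many-closing = begin
        f                                      ≤⟨ Unique-⊆-length (Unique.filter⁺ inF? Gm!) (λ p → let (e′ , e′∈ , q) = last-closes p in ∈-concatMap-intro star e′∈ q) ⟩
        length (concatMap star (pick₁ l φ))    ≤⟨ length-concatMap-≤ star (pick₁ l φ) spokes-length ⟩
        length (pick₁ l φ) * (1 + h * 2)       ≡⟨ cong (_* (1 + h * 2)) (length-pick₁ l φ (sym len-l)) ⟩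
        trues l * (1 + h * 2)                  ≡⟨ *-comm (trues l) _ ⟩
        (1 + h * 2) * trues l ∎
        where open ≤-Reasoning

      q₀ q₁ : ℕ
      q₀ = u * u
      q₁ = u * (4 * K * D)

      ρ⊆Gm : ∀ {e} → e ∈ ρ → e ∈ Gm
      ρ⊆Gm p = proj₁ (∈-filter⁻ notF? {xs = Gm} p)

      chosen : ∀ α e β → φ ≡ α ++ e ∷ β →
               e ∈ choices m f (1 + h * 2) q₀ q₁ (insideC₀ u) (closingC₁ u) l ρ α
      chosen α e β φ-eq = subst (λ b → e ∈ (if b then take q₁ (closingC₁ u ρ α) else take q₀ (insideC₀ u ρ))) (sym label) (by-case (closing? U (ρ ++ α) e))
        where
        e∈φ : e ∈ φ
        e∈φ = subst (e ∈_) (sym φ-eq) (∈-insert α)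
        e∈Gm : e ∈ Gm
        e∈Gm = proj₁ (∈-filter⁻ inF? {xs = Gm} e∈φ)
        U>0 : 0 < length U
        U>0 = ∈-length (proj₁ (φ-ends e∈φ))
        label : labelAt l (length α) ≡ does (closing? U (ρ ++ α) e)
        label = trans (cong (λ φ′ → labelAt (labelling closingᵇ [] φ′) (length α)) φ-eq) (labelAt-labelling closingᵇ [] α e β)
        ⊆Gm : ρ ++ α ⊆ᴱ Gm
        ⊆Gm p = [ ρ⊆Gm , (λ q → proj₁ (∈-filter⁻ inF? {xs = Gm} (subst (_ ∈_) (sym φ-eq) (∈-++⁺ˡ q)))) ]′ (∈-++⁻ ρ p)
        -- The two size bounds show that the takes in `choices` discard nothing.
        bound₁ : length (closingC₁ u ρ α) ≤ q₁
        bound₁ = ≤-trans (closing-count Gm U U! {D} {K} deg (sparse U>0 (≤-trans U≤ (≤-trans (*-monoʳ-≤ (2 + h) f≤) w₀-big))) U>0 (ρ ++ α) ⊆Gm)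
                   (*-monoˡ-≤ (4 * K * D) U≤)
        bound₀ : length (insideC₀ u ρ) ≤ q₀
        bound₀ = ≤-trans (≤-reflexive (length-cross U U)) (*-mono-≤ U≤ U≤)
        by-case : (d : Dec (Closing U (ρ ++ α) e)) → e ∈ (if does d then take q₁ (closingC₁ u ρ α) else take q₀ (insideC₀ u ρ))
        by-case (yes c) = subst (e ∈_) (sym (take-all bound₁)) (∈-filter⁺ (closing? U (ρ ++ α)) (Gm⊆ e∈Gm) c)
        by-case (no _) = subst (e ∈_) (sym (take-all bound₀))
          (subst (_∈ cross U U) (edge-norm (Gm⊆ e∈Gm)) (∈-cross (proj₁ (φ-ends e∈φ)) (proj₂ (φ-ends e∈φ))))

    closed⇒CoverHit : ∃[ f ] (1 ≤ f × f ≤ Kₛ * s₀ × CoverHit m h K D f σ)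
    closed⇒CoverHit = f , f≥1 , f≤ , w , subst₂ (λ a b → w ∈ masks a b) len-w trues-w (∈-masks w) ,
      l , ∈-filter⁺ (λ l → (length l ≟ f) ×-dec (f ≤? (1 + h * 2) * trues l)) l∈ (len-l , many-closing) ,
      λ α e β eq → subst (λ t → e ∈ choices m f (1 + h * 2) q₀ q₁ (insideC₀ u) (closingC₁ u) l t α) (sym picked-ρ)
        (chosen α e β (trans (sym picked-φ) eq))
      where
      bool∈ : ∀ b → b ∈ true ∷ false ∷ []
      bool∈ true = here refl
      bool∈ false = there (here refl)
      l∈ : l ∈ lists (true ∷ false ∷ []) f
      l∈ = subst (λ t → l ∈ lists (true ∷ false ∷ []) t) len-l (∈-lists l λ {b} _ → bool∈ b)

-- Unlikely properties of a random ordering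

length-allFin : ∀ n → length (allFin n) ≡ n
length-allFin n = length-tabulate (id {A = Fin n})

module _ {n : ℕ} where

  open RareEvents (_≟ᴱ_ {n}) (allEdges n) (allEdges-Unique n)

  Rare-mono : ∀ {X Y Y′ P} → Y ≤ Y′ → Rare X Y P → Rare X Y′ P
  Rare-mono h (rare B b m) = rare B (≤-trans b (*-monoˡ-≤ (M !) h)) m

  Rare-∃-vertex : ∀ {X Y} {P : Fin n → Graph n → Set} → (∀ v → Rare X Y (P v)) → Rare X (n * Y) (λ σ → ∃[ v ] P v σ)
  Rare-∃-vertex {Y = Y} h = Rare-mono (≤-reflexive (cong (_* Y) (length-allFin n)))
    (Rare-map (λ { _ (v , q) → v , ∈-allFin v , q }) (Rare-∃ (allFin n) λ {v} _ → h v))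

  Rare-∃-list : ∀ {X Y} w {P : List (Fin n) → Graph n → Set} → (∀ A → length A ≡ w → Rare X Y (P A)) →
                Rare X (n ^ w * Y) (λ σ → ∃[ A ] (length A ≡ w × P A σ))
  Rare-∃-list {X} {Y} w {P} h = Rare-mono (*-monoˡ-≤ Y (≤-trans (≤-trans (length-filter (λ A → length A ≟ w) (lists (allFin n) w)) (length-lists (allFin n) w)) (≤-reflexive (cong (_^ w) (length-allFin n)))))
    (Rare-map (λ { _ (A , refl , q) → A , ∈-filter⁺ (λ A → length A ≟ w) (∈-lists A λ {x} _ → ∈-allFin x) refl , q })
      (Rare-∃ (filter (λ A → length A ≟ w) (lists (allFin n) w)) λ {A} A∈ → h A (proj₂ (∈-filter⁻ (λ A → length A ≟ w) {xs = lists (allFin n) w} A∈))))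

  take-⊆-all : ∀ {σ} m → σ ↭ allEdges n → take m σ ⊆ᴱ allEdges n
  take-⊆-all {σ} m σ↭ p = ordering-⊆ σ↭ (take-⊆ m σ p)

  Rare-covered : ∀ m z v → m < M → 4 * m * 3 * z ≤ 3 * (M ∸ m) → Rare (z ^ 3) (n * (n * 1)) (λ σ → Covered (take m σ) v)
  Rare-covered m z v m<M h = Rare-map hit (Rare-∃-vertex λ a → Rare-∃-vertex λ b → Rare-ManyEarly m (Q a b) 3 z ≤-refl m<M h)
    where
    Q : Fin n → Fin n → List (Edge n)
    Q a b = norm v a ∷ norm v b ∷ norm a b ∷ []
    hit : ∀ {σ} → σ ↭ allEdges n → Covered (take m σ) v → ∃[ a ] ∃[ b ] ManyEarly m (Q a b) 3 σ
    hit {σ} σ↭ (a , b , va , vb , ab) = a , b , Q a b , unique , ≤-refl , λ e∈ → e∈ , early e∈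
      where
      v≢a : v ≢ a
      v≢a = norm∈⇒≢ (take-⊆-all m σ↭) va
      v≢b : v ≢ b
      v≢b = norm∈⇒≢ (take-⊆-all m σ↭) vb
      a≢b : a ≢ b
      a≢b = norm∈⇒≢ (take-⊆-all m σ↭) ab
      unique : Unique (Q a b)
      unique = ((λ eq → a≢b (norm-injectiveʳ eq)) ∷ (λ eq → v≢b (norm-injectiveʳ (trans (norm-sym a v) (trans eq refl)))) ∷ []) ∷
               ((λ eq → v≢a (norm-injectiveʳ (trans (norm-sym b v) (trans eq (norm-sym a b))))) ∷ []) ∷ [] ∷ []
      early : ∀ {e} → e ∈ Q a b → e ∈ take m σ
      early (here refl) = va
      early (there (here refl)) = vb
      early (there (there (here refl))) = ab

  HighDegree : ℕ → ℕ → Graph n → Set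
  HighDegree m D σ = ∃[ v ] D ≤ length (neighbours (take m σ) v)

  Rare-HighDegree : ∀ m D z → m < M → 4 * m * n * z ≤ D * (M ∸ m) → Rare (z ^ D) (n * 1) (HighDegree m D)
  Rare-HighDegree m D z m<M h = Rare-map hit (Rare-∃-vertex λ v → Rare-ManyEarly m (Q v) D z (≤-reflexive (trans (length-map (norm v) (allFin n)) (length-allFin n))) m<M h)
    where
    Q : Fin n → List (Edge n)
    Q v = map (norm v) (allFin n)
    hit : ∀ {σ} → σ ↭ allEdges n → HighDegree m D σ → ∃[ v ] ManyEarly m (Q v) D σ
    hit {σ} _ (v , D≤) = v , map (norm v) N , Unique.map⁺ norm-injectiveʳ (Unique.filter⁺ (λ x → norm v x ∈ᴱ? take m σ) (Unique.allFin⁺ n)) ,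
        ≤-trans D≤ (≤-reflexive (sym (length-map (norm v) N))) , inside
      where
      N : List (Fin n)
      N = neighbours (take m σ) v
      inside : ∀ {e} → e ∈ map (norm v) N → e ∈ Q v × e ∈ take m σ
      inside p with ∈-map⁻ (norm v) p
      ... | x , x∈ , refl = ∈-map⁺ (norm v) (∈-allFin x) , proj₂ (∈-filter⁻ (λ x → norm v x ∈ᴱ? take m σ) {xs = allFin n} x∈)

  HighCodegree : ℕ → ℕ → Graph n → Set
  HighCodegree m h σ = ∃[ a ] ∃[ b ] (a ≢ b × h ≤ length (common (take m σ) a b))

  Rare-HighCodegree : ∀ m h z → m < M → 4 * m * (h + h) * z ≤ (h + h) * (M ∸ m) →
                      Rare (z ^ (h + h)) (n * (n * (n ^ h * 1))) (HighCodegree m h)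
  Rare-HighCodegree m h z m<M cond = Rare-map hit (Rare-∃-vertex λ a → Rare-∃-vertex λ b → Rare-∃-list h λ A A-len →
      Rare-ManyEarly m (Q a b A) (h + h) z (≤-reflexive (length-Q a b A A-len)) m<M cond)
    where
    Q : Fin n → Fin n → List (Fin n) → List (Edge n)
    Q a b A = map (norm a) A ++ map (norm b) A
    length-Q : ∀ a b A → length A ≡ h → length (Q a b A) ≡ h + h
    length-Q a b A eq = trans (length-++ (map (norm a) A)) (cong₂ _+_ (trans (length-map _ A) eq) (trans (length-map _ A) eq))
    hit : ∀ {σ} → σ ↭ allEdges n → HighCodegree m h σ → ∃[ a ] ∃[ b ] ∃[ A ] (length A ≡ h × ManyEarly m (Q a b A) (h + h) σ)
    hit {σ} σ↭ (a , b , a≢b , h≤) = a , b , A , A-len , Q a b A ,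
        Unique-++⁺ (Unique.map⁺ norm-injectiveʳ A!) (Unique.map⁺ norm-injectiveʳ A!) disjoint ,
        ≤-reflexive (sym (length-Q a b A A-len)) , λ e∈ → e∈ , [ early a proj₁ , early b proj₂ ]′ (∈-++⁻ (map (norm a) A) e∈)
      where
      A : List (Fin n)
      A = take h (common (take m σ) a b)
      A-len : length A ≡ h
      A-len = length-take-exact (common (take m σ) a b) h≤
      A! : Unique A
      A! = Unique.take⁺ h (Unique.filter⁺ (λ x → (norm a x ∈ᴱ? take m σ) ×-dec (norm b x ∈ᴱ? take m σ)) (Unique.allFin⁺ n))
      A⁻ : ∀ {x} → x ∈ A → norm a x ∈ take m σ × norm b x ∈ take m σ
      A⁻ x∈ = proj₂ (∈-filter⁻ (λ x → (norm a x ∈ᴱ? take m σ) ×-dec (norm b x ∈ᴱ? take m σ)) {xs = allFin n} (take-⊆ h _ x∈))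
      early : ∀ c → (∀ {x} → norm a x ∈ take m σ × norm b x ∈ take m σ → norm c x ∈ take m σ) → ∀ {e} → e ∈ map (norm c) A → e ∈ take m σ
      early c π p with ∈-map⁻ (norm c) p
      ... | x , x∈ , refl = π (A⁻ x∈)
      disjoint : ∀ {e} → e ∈ map (norm a) A → e ∉ map (norm b) A
      disjoint p q with ∈-map⁻ (norm a) p | ∈-map⁻ (norm b) q
      ... | x , x∈ , refl | y , y∈ , eq with norm-injective eq
      ...   | inj₁ (a≡b , _) = a≢b a≡b
      ...   | inj₂ (refl , _) = norm∈⇒≢ (take-⊆-all m σ↭) (proj₁ (A⁻ y∈)) refl

  DensePair : ℕ → ℕ → ℕ → Graph n → Set
  DensePair m K w σ = ∃[ A ] (length A ≡ w × ∃[ B ] (length B ≡ w × ManyEarly m (cross A B) (K * w) σ))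

  Rare-DensePair : ∀ m K w z → m < M → 4 * m * (w * w) * z ≤ K * w * (M ∸ m) → Rare (z ^ (K * w)) (n ^ w * (n ^ w * 1)) (DensePair m K w)
  Rare-DensePair m K w z m<M h = Rare-∃-list w λ A A-len → Rare-∃-list w λ B B-len →
    Rare-ManyEarly m (cross A B) (K * w) z (≤-reflexive (trans (length-cross A B) (cong₂ _*_ A-len B-len))) m<M h

  ¬DensePair⇒Sparse : ∀ {m K w σ} → ¬ DensePair m K w σ → Sparse (take m σ) K w
  ¬DensePair⇒Sparse {K = K} {w} ¬d A B A-len B-len F F! F⊆ with K * w ≤? length F
  ... | yes p = contradiction (A , A-len , B , B-len , F , F! , p , λ {e} → F⊆ {e}) ¬d
  ... | no ≰ = ≰⇒> ≰

  Separated : ℕ → ℕ → Graph n → Set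
  Separated a m σ = ∃[ A ] (length A ≡ a × ∃[ B ] (length B ≡ a × Avoids (λ _ → cross A B) (a * a) 0 m σ))

  Rare-Separated : ∀ a c j → 0 < M → c * j ≤ M → M ≤ c * (a * a) → Rare (2 ^ j) (n ^ a * (n ^ a * 1)) (Separated a (c * j))
  Rare-Separated a c j M>0 m≤ h = Rare-∃-list a λ A _ → Rare-∃-list a λ B _ → Rare-Avoids (λ _ → cross A B) (a * a) 0 c j M>0 m≤ h

  ¬Separated⇒Joined : ∀ {a m σ} {G : Graph n} → ¬ Separated a m σ → take m σ ⊆ᴱ G → Joined G a
  ¬Separated⇒Joined {a} {m} {σ} ¬s ⊆G A B A! B! disj a≤A a≤B with Any.any? (λ e → e ∈ᴱ? take m σ) (cross (take a A) (take a B))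
  ... | yes p with find p
  ...   | e , e∈ , early with ∈-cross⁻ (take a A) (take a B) e∈
  ...     | x , y , x∈ , y∈ , refl = x , y , take-⊆ a A x∈ , take-⊆ a B y∈ , ⊆G early
  ¬Separated⇒Joined {a} {m} {σ} ¬s ⊆G A B A! B! disj a≤A a≤B | no none = contradiction
      (take a A , length-take-exact A a≤A , take a B , length-take-exact B a≤B , avoids
        (Unique-cross (Unique.take⁺ a A!) (Unique.take⁺ a B!) disj′)
        inAll
        (≤-reflexive (sym (trans (length-cross (take a A) (take a B)) (cong₂ _*_ (length-take-exact A a≤A) (length-take-exact B a≤B)))))
        λ early e∈ → none (lose e∈ early)) ¬s
    where
    disj′ : ∀ {x} → x ∈ take a A → x ∉ take a B
    disj′ p q = disj (take-⊆ a A p) (take-⊆ a B q)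
    inAll : cross (take a A) (take a B) ⊆ᴱ allEdges n
    inAll p with ∈-cross⁻ (take a A) (take a B) p
    ... | x , y , x∈ , y∈ , refl = norm∈allEdges λ { refl → disj′ x∈ y∈ }

  InRange : ℕ → ℕ → Fin n → Set
  InRange lo len x = lo ≤ toℕ x × toℕ x < lo + len

  inRange? : ∀ lo len → Decidable (InRange lo len)
  inRange? lo len x = (lo ≤? toℕ x) ×-dec (toℕ x <? lo + len)

  range : ℕ → ℕ → List (Fin n)
  range lo len = filter (inRange? lo len) (allFin n)

  length-range : ∀ lo len → lo + len ≤ n → len ≤ length (range lo len)
  length-range lo len h = begin
      len                                       ≡⟨ sym (length-applyUpTo (lo +_) len) ⟩
      length (applyUpTo (lo +_) len)            ≤⟨ Unique-⊆-length (Unique.applyUpTo⁺₁ (lo +_) len λ i<j _ eq → <⇒≢ i<j (+-cancelˡ-≡ lo _ _ eq)) cover ⟩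
      length (map toℕ (range lo len))           ≡⟨ length-map toℕ (range lo len) ⟩
      length (range lo len) ∎
    where
    open ≤-Reasoning
    cover : ∀ {i} → i ∈ applyUpTo (lo +_) len → i ∈ map toℕ (range lo len)
    cover p with ∈-applyUpTo⁻ (lo +_) p
    ... | k , k< , refl = subst (_∈ map toℕ (range lo len)) (Fin.toℕ-fromℕ< lo+k<n)
        (∈-map⁺ toℕ (∈-filter⁺ (inRange? lo len) (∈-allFin (fromℕ< lo+k<n))
          (≤-trans (m≤m+n lo k) (≤-reflexive (sym (Fin.toℕ-fromℕ< lo+k<n))) ,
           ≤-trans (s≤s (≤-reflexive (Fin.toℕ-fromℕ< lo+k<n))) (+-monoʳ-< lo k<))))
      where
      lo+k<n : lo + k < n
      lo+k<n = ≤-trans (+-monoʳ-< lo k<) h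

  -- Blocks have g + 1 vertices so that at least g remain after v is removed.
  group : ℕ → Fin n → ℕ → List (Fin n)
  group g v j = filter (λ x → ¬? (x Fin.≟ v)) (range (j * suc g) (suc g))

  length-group : ∀ g v j → suc j * suc g ≤ n → g ≤ length (group g v j)
  length-group g v j h = ≤-pred (≤-trans (length-range (j * suc g) (suc g) (≤-trans (≤-reflexive (+-comm (j * suc g) (suc g))) h))
      (Unique-⊆-length {ys = v ∷ group g v j} (Unique.filter⁺ (inRange? (j * suc g) (suc g)) (Unique.allFin⁺ n)) λ {x} p → cover x p))
    where
    cover : ∀ x → x ∈ range (j * suc g) (suc g) → x ∈ v ∷ group g v j
    cover x p with x Fin.≟ v
    ... | yes eq = here eq
    ... | no ≢ = there (∈-filter⁺ (λ x → ¬? (x Fin.≟ v)) p ≢)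

  MissesGroup : (g H m : ℕ) → Graph n → Set
  MissesGroup g H m σ = ∃[ v ] ∃[ j ] (j ∈ upTo H × Avoids (λ _ → map (norm v) (group g v j)) g 0 m σ)

  Rare-MissesGroup : ∀ g H c J → 0 < M → c * J ≤ M → M ≤ c * g → Rare (2 ^ J) (n * (H * 1)) (MissesGroup g H (c * J))
  Rare-MissesGroup g H c J M>0 m≤ h = Rare-∃-vertex λ v → Rare-mono (≤-reflexive (cong (_* 1) (length-upTo H)))
    (Rare-∃ (upTo H) λ {j} _ → Rare-Avoids (λ _ → map (norm v) (group g v j)) g 0 c J M>0 m≤ h)

  module _ {g H m : ℕ} {σ : Graph n} (σ↭ : σ ↭ allEdges n) (¬miss : ¬ MissesGroup g H m σ) (H≤n : H * suc g ≤ n) where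

    group-hit : ∀ v {j} → j < H → ∃[ x ] (InRange (j * suc g) (suc g) x × norm v x ∈ take m σ)
    group-hit v {j} j<H with Any.any? (λ x → norm v x ∈ᴱ? take m σ) (group g v j)
    ... | yes p with find p
    ...   | x , x∈ , e = x , proj₂ (∈-filter⁻ (inRange? (j * suc g) (suc g)) {xs = allFin n} (proj₁ (∈-filter⁻ (λ x → ¬? (x Fin.≟ v)) {xs = range (j * suc g) (suc g)} x∈))) , e
    group-hit v {j} j<H | no none = contradiction
        (v , j , ∈-upTo⁺ j<H , avoids
          (Unique.map⁺ norm-injectiveʳ (Unique.filter⁺ (λ x → ¬? (x Fin.≟ v)) (Unique.filter⁺ (inRange? (j * suc g) (suc g)) (Unique.allFin⁺ n))))
          inAll (≤-trans (length-group g v j (≤-trans (*-monoˡ-≤ (suc g) j<H) H≤n)) (≤-reflexive (sym (length-map (norm v) (group g v j)))))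
          missed) ¬miss
      where
      inAll : map (norm v) (group g v j) ⊆ᴱ allEdges n
      inAll p with ∈-map⁻ (norm v) p
      ... | x , x∈ , refl = norm∈allEdges λ v≡x → proj₂ (∈-filter⁻ (λ x → ¬? (x Fin.≟ v)) {xs = range (j * suc g) (suc g)} x∈) (sym v≡x)
      missed : ∀ {e} → e ∈ take m σ → e ∉ map (norm v) (group g v j)
      missed e∈ p with ∈-map⁻ (norm v) p
      ... | x , x∈ , refl = none (lose x∈ e∈)

    -- One neighbour is taken from each of `J` consecutive blocks; the blocks are disjoint, so the
    -- neighbours are distinct.
    many-neighbours : ∀ v o J → o + J ≤ H → ∃[ A ] (length A ≡ J × Unique A × (∀ {x} → x ∈ A → InRange (o * suc g) (J * suc g) x × norm v x ∈ take m σ))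
    many-neighbours v o zero _ = [] , refl , [] , λ ()
    many-neighbours v o (suc J) h with many-neighbours v o J (≤-trans (+-monoʳ-≤ o (n≤1+n J)) h) | group-hit v {o + J} (≤-trans (≤-reflexive (sym (+-suc o J))) h)
    ... | A , A-len , A! , A∈ | x , (lo≤ , <hi) , e = x ∷ A , cong suc A-len , (All.tabulate (λ { y∈ refl → x∉ y∈ }) ∷ A!) ,
        λ { (here refl) → (≤-trans (*-monoˡ-≤ (suc g) (m≤m+n o J)) lo≤ , ≤-trans <hi (≤-reflexive (l o J (suc g)))) , e
          ; (there y∈) → (proj₁ (proj₁ (A∈ y∈)) , ≤-trans (proj₂ (proj₁ (A∈ y∈))) (+-monoʳ-≤ (o * suc g) (m≤n+m _ (suc g)))) , proj₂ (A∈ y∈) }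
      where
      l : ∀ o J s → (o + J) * s + s ≡ o * s + (s + J * s)
      l = solve-∀
      x∉ : x ∉ A
      x∉ x∈ = <-irrefl refl (≤-trans (proj₂ (proj₁ (A∈ x∈))) (≤-trans (≤-reflexive (sym (*-distribʳ-+ (suc g) o J))) lo≤))

  side : ℕ → ℕ → Graph n → Fin n → List (Fin n)
  side lo len π v = filter (λ x → inRange? lo len x ×-dec (norm v x ∈ᴱ? π)) (allFin n)

  crossNeighbours : ℕ → Fin n → Graph n → Graph n
  crossNeighbours b v π = cross (side 0 b π v) (side b b π v)

  NoCrossing : (b hh m ℓ : ℕ) → Graph n → Set
  NoCrossing b hh m ℓ σ = ∃[ v ] Avoids (crossNeighbours b v) (hh * hh) m ℓ σ

  Rare-NoCrossing : ∀ b hh m c J → 0 < M → m + c * J ≤ M → M ≤ c * (hh * hh) → Rare (2 ^ J) (n * 1) (NoCrossing b hh m (c * J))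
  Rare-NoCrossing b hh m c J M>0 m≤ h = Rare-∃-vertex λ v → Rare-Avoids (crossNeighbours b v) (hh * hh) m c J M>0 m≤ h

  -- Two rounds: after `m` edges each v has at least `hh` neighbours in each of two disjoint ranges
  -- of vertices. Each of the `hh * hh` pairs across would complete a triangle at v, and one of them
  -- is present once `ℓ` further edges are revealed.
  all-covered : ∀ {g hh m ℓ σ} → σ ↭ allEdges n → ¬ MissesGroup g (hh + hh) m σ → (hh + hh) * suc g ≤ n →
                ¬ NoCrossing (hh * suc g) hh m ℓ σ → ∀ v → Covered (take (m + ℓ) σ) v
  all-covered {g} {hh} {m} {ℓ} {σ} σ↭ ¬miss H≤n ¬nc v with covered? (take (m + ℓ) σ) v
  ... | yes c = c
  ... | no ¬c = contradiction (v , avoids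
          (Unique-cross (side! 0) (side! b) disjoint) inAll size missed) ¬nc
    where
    b : ℕ
    b = hh * suc g
    π : Graph n
    π = take m σ
    side! : ∀ lo → Unique (side lo b π v)
    side! lo = Unique.filter⁺ (λ x → inRange? lo b x ×-dec (norm v x ∈ᴱ? π)) (Unique.allFin⁺ n)
    side⁻ : ∀ {lo x} → x ∈ side lo b π v → InRange lo b x × norm v x ∈ π
    side⁻ {lo} p = proj₂ (∈-filter⁻ (λ x → inRange? lo b x ×-dec (norm v x ∈ᴱ? π)) {xs = allFin n} p)
    disjoint : ∀ {x} → x ∈ side 0 b π v → x ∉ side b b π v
    disjoint p q = <-irrefl refl (≤-trans (proj₂ (proj₁ (side⁻ p))) (proj₁ (proj₁ (side⁻ q))))
    inAll : crossNeighbours b v π ⊆ᴱ allEdges n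
    inAll p with ∈-cross⁻ (side 0 b π v) (side b b π v) p
    ... | x , y , x∈ , y∈ , refl = norm∈allEdges λ { refl → disjoint x∈ y∈ }
    side-size : ∀ o → o + hh ≤ hh + hh → hh ≤ length (side (o * suc g) b π v)
    side-size o h with many-neighbours {H = hh + hh} σ↭ ¬miss H≤n v o hh h
    ... | A , A-len , A! , A∈ = ≤-trans (≤-reflexive (sym A-len)) (Unique-⊆-length A! λ p → ∈-filter⁺ (λ x → inRange? (o * suc g) b x ×-dec (norm v x ∈ᴱ? π)) (∈-allFin _) (A∈ p))
    size : hh * hh ≤ length (crossNeighbours b v π)
    size = ≤-trans (*-mono-≤ (side-size 0 (m≤m+n hh hh)) (side-size hh ≤-refl)) (≤-reflexive (sym (length-cross (side 0 b π v) (side b b π v))))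
    missed : ∀ {e} → e ∈ take (m + ℓ) σ → e ∉ crossNeighbours b v π
    missed e∈ p with ∈-cross⁻ (side 0 b π v) (side b b π v) p
    ... | x , y , x∈ , y∈ , refl = ¬c (x , y , late (proj₂ (side⁻ x∈)) , late (proj₂ (side⁻ y∈)) , e∈)
      where
      late : ∀ {e} → e ∈ π → e ∈ take (m + ℓ) σ
      late = take-mono-⊆ σ (m≤m+n m ℓ)

-- Kept abstract so that powers with large literal exponents are never unfolded.
abstract
  pow : ℕ → ℕ → ℕ
  pow r i = r ^ i

  pow-+ : ∀ r i j → pow r i * pow r j ≡ pow r (i + j)
  pow-+ r i j = sym (^-distribˡ-+-* r i j)

  pow-^ : ∀ r i j → pow r i ^ j ≡ pow r (i * j)
  pow-^ r i j = ^-*-assoc r i j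

  pow-suc : ∀ r i → r * pow r i ≡ pow r (suc i)
  pow-suc r i = refl

  pow-1 : ∀ r → pow r 1 ≡ r
  pow-1 r = *-identityʳ r

  pow-mono : ∀ {r i j} → 0 < r → i ≤ j → pow r i ≤ pow r j
  pow-mono {r} r>0 = ^-monoʳ-≤ r {{>-nonZero r>0}}

  pow>0 : ∀ {r} i → 0 < r → 0 < pow r i
  pow>0 {r} i r>0 = m^n>0 r {{>-nonZero r>0}} i

  pow-≤-2^ : ∀ r i → pow r i ≤ 2 ^ (r * i)
  pow-≤-2^ r i = ≤-trans (^-monoˡ-≤ i (<⇒≤ (n<2^n r))) (≤-reflexive (^-*-assoc 2 r i))
    where
    n<2^n : ∀ m → m < 2 ^ m
    n<2^n zero = s≤s z≤n
    n<2^n (suc m) = ≤-trans (+-mono-≤ (m^n>0 2 m) (n<2^n m)) (≤-reflexive (cong (2 ^ m +_) (sym (+-identityʳ _))))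

  floor-root : ∀ q → 0 < q → ∀ n → ∃[ r ] (r ^ q ≤ n × n < suc r ^ q)
  floor-root (suc q) q>0 zero = 0 , z≤n , m^n>0 1 (suc q)
  floor-root q q>0 (suc n) with floor-root q q>0 n
  ... | r , r^q≤n , n< with suc r ^ q ≤? suc n
  ...   | yes p = suc r , p , ≤-trans (s≤s n<) (^-monoˡ-< q {{>-nonZero q>0}} ≤-refl)
  ...   | no ≰ = r , ≤-trans r^q≤n (n≤1+n n) , ≰⇒> ≰

  -- For r the integer q-th root, n < (r + 1)^q ≤ (2r)^q ≤ r * r^q as soon as r ≥ 2^q. So n is known
  -- up to a factor r, which the exponents below absorb.
  approximate-root : ∀ q → 0 < q → ∀ R → ∃[ N ] (∀ n → N ≤ n → ∃[ r ] (R ≤ r × pow r q ≤ n × n ≤ pow r (suc q)))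
  approximate-root q q>0 R = R′ ^ q , λ n N≤n →
    let (r , lower , upper) = floor-root q q>0 n
        R′≤r : R′ ≤ r
        R′≤r = ≮⇒≥ λ r<R′ → <-irrefl refl (≤-trans upper (≤-trans (^-monoˡ-≤ q r<R′) N≤n))
    in r , ≤-trans (m≤m+n R (2 ^ q)) R′≤r , lower , (begin
        n                ≤⟨ <⇒≤ upper ⟩
        suc r ^ q        ≤⟨ ^-monoˡ-≤ q (+-mono-≤ (≤-trans (m^n>0 2 q) (≤-trans (m≤n+m (2 ^ q) R) R′≤r)) (≤-reflexive (sym (+-identityʳ r)))) ⟩
        (2 * r) ^ q      ≡⟨ ^-distribʳ-* 2 r q ⟩
        2 ^ q * r ^ q    ≤⟨ *-monoˡ-≤ (r ^ q) (≤-trans (m≤n+m (2 ^ q) R) R′≤r) ⟩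
        r * r ^ q ∎)
    where
    open ≤-Reasoning
    R′ : ℕ
    R′ = R + 2 ^ q

-- With n ≈ r^2130 all sizes below are powers of r:
-- m₀ ≈ n^(4/3) / r⁴, m₁ ≈ n^(4/3) r⁵, a ≈ n^(2/3) r⁸.
module Sizes (k r n : ℕ) (k>0 : 0 < k) (r-big : 2 * k + 5000 ≤ r) (n-lower : pow r 2130 ≤ n) (n-upper : n ≤ pow r 2131) where

  open RareEvents (_≟ᴱ_ {n}) (allEdges n) (allEdges-Unique n)
  open ≤-Reasoning

  p : ℕ → ℕ
  p = pow r

  5000≤r : 5000 ≤ r
  5000≤r = ≤-trans (m≤n+m 5000 (2 * k)) r-big

  small≤r : ∀ c → c ≤ 5000 → c ≤ r
  small≤r c h = ≤-trans h 5000≤r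

  2k≤r : 2 * k ≤ r
  2k≤r = ≤-trans (m≤m+n (2 * k) 5000) r-big

  k≤r : k ≤ r
  k≤r = ≤-trans (m≤m+n k (k + 0)) 2k≤r

  r>0 : 0 < r
  r>0 = small≤r 1 (s≤s z≤n)

  r≤p : ∀ i → 1 ≤ i → r ≤ p i
  r≤p i h = ≤-trans (≤-reflexive (sym (pow-1 r))) (pow-mono r>0 h)

  absorb : ∀ {c} i → c ≤ r → c * p i ≤ p (suc i)
  absorb i h = ≤-trans (*-monoˡ-≤ (p i) h) (≤-reflexive (pow-suc r i))

  n>0 : 0 < n
  n>0 = ≤-trans (pow>0 2130 r>0) n-lower

  2*M≡ : 2 * M ≡ n * (n ∸ 1)
  2*M≡ = go n n>0
    where
    go : ∀ n → 0 < n → 2 * length (allEdges n) ≡ n * (n ∸ 1)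
    go (suc n) _ = 2*length-allEdges n

  M-upper : M ≤ p 4262
  M-upper = begin
    M             ≤⟨ m≤m+n M (M + 0) ⟩
    2 * M         ≡⟨ 2*M≡ ⟩
    n * (n ∸ 1)   ≤⟨ *-monoʳ-≤ n (m∸n≤m n 1) ⟩
    n * n         ≤⟨ *-mono-≤ n-upper n-upper ⟩
    p 2131 * p 2131 ≡⟨ pow-+ r 2131 2131 ⟩
    p 4262 ∎

  M-lower : p 4259 ≤ M
  M-lower = *-cancelˡ-≤ 4 (begin
      4 * p 4259            ≤⟨ absorb 4259 (small≤r 4 (m≤m+n 4 4996)) ⟩
      p 4260                ≡⟨ sym (pow-+ r 2130 2130) ⟩
      p 2130 * p 2130       ≤⟨ *-mono-≤ n-lower n-lower ⟩
      n * n                 ≤⟨ *-monoʳ-≤ n (half n n≥2) ⟩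
      n * (2 * (n ∸ 1))     ≡⟨ l n (n ∸ 1) ⟩
      2 * (n * (n ∸ 1))     ≡⟨ cong (2 *_) (sym 2*M≡) ⟩
      2 * (2 * M)           ≡⟨ sym (*-assoc 2 2 M) ⟩
      4 * M ∎)
    where
    l : ∀ a b → a * (2 * b) ≡ 2 * (a * b)
    l = solve-∀
    n≥2 : 2 ≤ n
    n≥2 = ≤-trans (≤-trans (small≤r 2 (m≤m+n 2 4998)) (r≤p 2130 (m≤m+n 1 2129))) n-lower
    half : ∀ n → 2 ≤ n → n ≤ 2 * (n ∸ 1)
    half (suc zero) (s≤s ())
    half (suc (suc n)) _ = ≤-trans (m≤m+n (suc (suc n)) n) (≤-reflexive (l₂ n))
      where
      l₂ : ∀ n → suc (suc n) + n ≡ 2 * suc n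
      l₂ = solve-∀

  M>0 : 0 < M
  M>0 = ≤-trans (pow>0 4259 r>0) M-lower

  module _ {m : ℕ} (m≤ : m ≤ p 4258) where

    2*4258≤M : p 4258 + p 4258 ≤ M
    2*4258≤M = begin
      p 4258 + p 4258 ≡⟨ cong (p 4258 +_) (sym (+-identityʳ _)) ⟩
      2 * p 4258      ≤⟨ absorb 4258 (small≤r 2 (m≤m+n 2 4998)) ⟩
      p 4259          ≤⟨ M-lower ⟩
      M ∎

    m<M : m < M
    m<M = ≤-trans (s≤s m≤) (≤-trans (+-monoˡ-≤ (p 4258) (pow>0 4258 r>0)) 2*4258≤M)

    gap : p 4258 ≤ M ∸ m
    gap = ≤-trans (≤-reflexive (sym (m+n∸n≡m (p 4258) (p 4258)))) (≤-trans (∸-monoˡ-≤ (p 4258) 2*4258≤M) (∸-monoʳ-≤ M m≤))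

  to-k : ∀ {X Y P} → 0 < X → Y * k ≤ X → Rare X Y P → Rare k 1 P
  to-k X>0 h = Rare-weaken X>0 (≤-trans h (≤-reflexive (sym (*-identityˡ _))))

  k≤2^ : k ≤ 2 ^ r
  k≤2^ = ≤-trans k≤r (≤-trans (≤-reflexive (sym (pow-1 r))) (≤-trans (pow-≤-2^ r 1) (≤-reflexive (cong (2 ^_) (*-identityʳ r)))))

  -- From n ≤ 2^(2131 r) and k ≤ 2^r it is enough that 2 * 2131 + 1 ≤ r, one reason for requiring r
  -- ≥ 5000.
  nnk≤2^rr : n * n * k ≤ 2 ^ p 2
  nnk≤2^rr = at 2131 n-upper (small≤r 4263 (m≤m+n 4263 737))
    where
    l : ∀ r t → r * t + r * t + r ≡ (t + t + 1) * r
    l = solve-∀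
    at : ∀ t → n ≤ pow r t → t + t + 1 ≤ r → n * n * k ≤ 2 ^ p 2
    at t n≤ t≤ = begin
        n * n * k                                    ≤⟨ *-mono-≤ (*-mono-≤ n≤2^ n≤2^) k≤2^ ⟩
        2 ^ (r * t) * 2 ^ (r * t) * 2 ^ r            ≡⟨ cong (_* 2 ^ r) (sym (^-distribˡ-+-* 2 (r * t) _)) ⟩
        2 ^ (r * t + r * t) * 2 ^ r                  ≡⟨ sym (^-distribˡ-+-* 2 (r * t + r * t) r) ⟩
        2 ^ (r * t + r * t + r)                      ≤⟨ ^-monoʳ-≤ 2 expo ⟩
        2 ^ p 2 ∎
      where
      n≤2^ : n ≤ 2 ^ (r * t)
      n≤2^ = ≤-trans n≤ (pow-≤-2^ r t)
      expo : r * t + r * t + r ≤ p 2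
      expo = begin
        r * t + r * t + r        ≡⟨ l r t ⟩
        (t + t + 1) * r          ≤⟨ *-monoˡ-≤ r t≤ ⟩
        r * r                    ≡⟨ cong (r *_) (sym (pow-1 r)) ⟩
        r * p 1                  ≡⟨ pow-suc r 1 ⟩
        p 2 ∎

  -- Here n^(1/3) is about r^710. By `halving`, `c` draws avoid `g` or `hh * hh` given edges with
  -- probability at most 1/2, and 2^(-J) beats n^2. Likewise `m₀` is r^1430 blocks of r^1406 draws,
  -- each block long enough for a set of a^2 edges. `D` is above m₁/n by a power of r. `rare-dense`
  -- ties r^19 to sets of r^1429 vertices and r^39 to r^1449; the former covers 4a, and the latter
  -- 10 `Kₛ` `s₀`.
  a m₀ c J half-m₁ m₁ g hh D Kₛ s₀ K w₀ : ℕ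
  a = p 1428
  m₀ = p 1406 * p 1430
  c = p 2843
  J = p 2
  half-m₁ = c * J
  m₁ = c * J + c * J
  g = p 1419
  hh = p 710
  D = p 721
  Kₛ = p 19
  s₀ = 4 * a
  K = p 39
  w₀ = p 1449

  m₀≡ : m₀ ≡ p 2836
  m₀≡ = pow-+ r 1406 1430

  m₀≤ : m₀ ≤ p 4258
  m₀≤ = ≤-trans (≤-reflexive m₀≡) (pow-mono r>0 (m≤m+n 2836 1422))

  m₁≤2846 : m₁ ≤ p 2846
  m₁≤2846 = begin
    c * J + c * J      ≡⟨ cong₂ _+_ (pow-+ r 2843 2) (trans (pow-+ r 2843 2) (sym (+-identityʳ _))) ⟩
    2 * p 2845         ≤⟨ absorb 2845 (small≤r 2 (m≤m+n 2 4998)) ⟩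
    p 2846 ∎

  m₁≤ : m₁ ≤ p 4258
  m₁≤ = ≤-trans m₁≤2846 (pow-mono r>0 (m≤m+n 2846 1412))

  m₁<M : m₁ < M
  m₁<M = m<M m₁≤

  -- At most r^4262 pairs a, b stand against r^(-3 * 1421), which leaves a factor r for k. One
  -- vertex is enough: while it is uncovered, τ has not been reached.
  rare-early-cover : ∀ v → Rare k 1 (λ σ → Covered (take m₀ σ) v)
  rare-early-cover v = to-k (m^n>0 (p 1421) {{>-nonZero (pow>0 1421 r>0)}} 3) size (Rare-covered m₀ (p 1421) v (m<M m₀≤) cond)
    where
    cond : 4 * m₀ * 3 * p 1421 ≤ 3 * (M ∸ m₀)
    cond = begin
        4 * m₀ * 3 * p 1421        ≡⟨ l m₀ (p 1421) ⟩
        3 * (4 * (m₀ * p 1421))    ≡⟨ cong (λ t → 3 * (4 * t)) (trans (cong (_* p 1421) m₀≡) (pow-+ r 2836 1421)) ⟩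
        3 * (4 * p 4257)           ≤⟨ *-monoʳ-≤ 3 (≤-trans (absorb 4257 (small≤r 4 (m≤m+n 4 4996))) (gap m₀≤)) ⟩
        3 * (M ∸ m₀) ∎
      where
      l : ∀ m z → 4 * m * 3 * z ≡ 3 * (4 * (m * z))
      l = solve-∀
    size : n * (n * 1) * k ≤ p 1421 ^ 3
    size = begin
        n * (n * 1) * k        ≡⟨ l n k ⟩
        k * (n * n)            ≤⟨ *-monoʳ-≤ k (*-mono-≤ n-upper n-upper) ⟩
        k * (p 2131 * p 2131)  ≡⟨ cong (k *_) (pow-+ r 2131 2131) ⟩
        k * p 4262             ≤⟨ absorb 4262 k≤r ⟩
        p 4263                 ≡⟨ sym (pow-^ r 1421 3) ⟩
        p 1421 ^ 3 ∎
      where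
      l : ∀ n k → n * (n * 1) * k ≡ k * (n * n)
      l = solve-∀

  -- There are n^(2a) pairs of sets, each avoided with probability at most 2^(-r^1430). As r^1430 =
  -- r^2 a, the comparison is the a-th power of n^2 k ≤ 2^(r^2).
  rare-separated : Rare k 1 (Separated a m₀)
  rare-separated = to-k (m^n>0 2 (p 1430)) size (Rare-Separated a (p 1406) (p 1430) M>0 (<⇒≤ (m<M m₀≤)) cond)
    where
    cond : M ≤ p 1406 * (a * a)
    cond = ≤-trans M-upper (≤-reflexive (sym (trans (cong (p 1406 *_) (pow-+ r 1428 1428)) (pow-+ r 1406 2856))))
    size : n ^ a * (n ^ a * 1) * k ≤ 2 ^ p 1430
    size = begin
        n ^ a * (n ^ a * 1) * k      ≡⟨ cong (λ t → n ^ a * t * k) (*-identityʳ (n ^ a)) ⟩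
        n ^ a * n ^ a * k            ≡⟨ cong (_* k) (sym (^-distribʳ-* n n a)) ⟩
        (n * n) ^ a * k              ≤⟨ *-monoʳ-≤ ((n * n) ^ a) k≤k^ ⟩
        (n * n) ^ a * k ^ a          ≡⟨ sym (^-distribʳ-* (n * n) k a) ⟩
        (n * n * k) ^ a              ≤⟨ ^-monoˡ-≤ a nnk≤2^rr ⟩
        (2 ^ p 2) ^ a                ≡⟨ ^-*-assoc 2 (p 2) a ⟩
        2 ^ (p 2 * a)                ≡⟨ cong (2 ^_) (pow-+ r 2 1428) ⟩
        2 ^ p 1430 ∎
      where
      k≤k^ : k ≤ k ^ p 1428
      k≤k^ = ≤-trans (≤-reflexive (sym (*-identityʳ k))) (^-monoʳ-≤ k {{>-nonZero k>0}} (pow>0 1428 r>0))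

  M≤cg : M ≤ c * g
  M≤cg = ≤-trans M-upper (≤-reflexive (sym (pow-+ r 2843 1419)))

  M≤chh : M ≤ c * (hh * hh)
  M≤chh = ≤-trans M-upper (≤-trans (pow-mono r>0 (m≤m+n 4262 1)) (≤-reflexive (sym (trans (cong (c *_) (pow-+ r 710 710)) (pow-+ r 2843 1420)))))

  groups-fit : (hh + hh) * suc g ≤ n
  groups-fit = begin
      (hh + hh) * suc g        ≤⟨ *-monoʳ-≤ (hh + hh) (+-monoˡ-≤ g (pow>0 1419 r>0)) ⟩
      (hh + hh) * (g + g)      ≡⟨ l hh g ⟩
      4 * (hh * g)             ≡⟨ cong (4 *_) (pow-+ r 710 1419) ⟩
      4 * p 2129               ≤⟨ absorb 2129 (small≤r 4 (m≤m+n 4 4996)) ⟩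
      p 2130                   ≤⟨ n-lower ⟩
      n ∎
    where
    l : ∀ a b → (a + a) * (b + b) ≡ 4 * (a * b)
    l = solve-∀

  rare-misses-group : Rare k 1 (MissesGroup g (hh + hh) half-m₁)
  rare-misses-group = to-k (m^n>0 2 J) size (Rare-MissesGroup g (hh + hh) c J M>0 (≤-trans (m≤m+n (c * J) (c * J)) (<⇒≤ m₁<M)) M≤cg)
    where
    hh+hh≤n : hh + hh ≤ n
    hh+hh≤n = ≤-trans (≤-trans (≤-reflexive (sym (*-identityʳ (hh + hh)))) (*-monoʳ-≤ (hh + hh) (s≤s z≤n))) groups-fit
    size : n * ((hh + hh) * 1) * k ≤ 2 ^ J
    size = ≤-trans (*-monoˡ-≤ k (*-monoʳ-≤ n (≤-trans (≤-reflexive (*-identityʳ (hh + hh))) hh+hh≤n))) nnk≤2^rr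

  rare-no-crossing : Rare k 1 (NoCrossing (hh * suc g) hh half-m₁ half-m₁)
  rare-no-crossing = to-k (m^n>0 2 J) (≤-trans (*-monoˡ-≤ k (*-monoʳ-≤ n n>0)) nnk≤2^rr)
    (Rare-NoCrossing (hh * suc g) hh half-m₁ c J M>0 (<⇒≤ m₁<M) M≤chh)

  rare-high-degree : Rare k 1 (HighDegree m₁ D)
  rare-high-degree = to-k (m^n>0 (p 1) {{>-nonZero (pow>0 1 r>0)}} D) size (Rare-HighDegree m₁ D (p 1) m₁<M cond)
    where
    cond : 4 * m₁ * n * p 1 ≤ D * (M ∸ m₁)
    cond = begin
        4 * m₁ * n * p 1             ≤⟨ *-monoˡ-≤ (p 1) (*-mono-≤ (*-monoʳ-≤ 4 m₁≤2846) n-upper) ⟩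
        4 * p 2846 * p 2131 * p 1    ≡⟨ trans (l (p 2846) (p 2131) (p 1)) (cong (4 *_) (trans (cong (_* p 1) (pow-+ r 2846 2131)) (pow-+ r 4977 1))) ⟩
        4 * p 4978                   ≤⟨ absorb 4978 (small≤r 4 (m≤m+n 4 4996)) ⟩
        p 4979                       ≡⟨ sym (pow-+ r 721 4258) ⟩
        p 721 * p 4258               ≤⟨ *-monoʳ-≤ D (gap m₁≤) ⟩
        D * (M ∸ m₁) ∎
      where
      l : ∀ a b c → 4 * a * b * c ≡ 4 * (a * b * c)
      l = solve-∀
    size : n * 1 * k ≤ p 1 ^ D
    size = begin
      n * 1 * k         ≡⟨ trans (cong (_* k) (*-identityʳ n)) (*-comm n k) ⟩
      k * n             ≤⟨ *-monoʳ-≤ k n-upper ⟩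
      k * p 2131        ≤⟨ absorb 2131 k≤r ⟩
      p 2132            ≤⟨ pow-mono r>0 (≤-trans (small≤r 2132 (m≤m+n 2132 2868)) (≤-trans (r≤p 721 (m≤m+n 1 720)) (m≤m+n D 0))) ⟩
      p (1 * D)         ≡⟨ sym (pow-^ r 1 D) ⟩
      p 1 ^ D ∎

  -- n^10 choices stand against r^(-1411) for each of 16 edges, and 10 * 2131 < 16 * 1411. With 6 in
  -- place of 8 the count would fail: 8 * 2131 > 12 * 1411.
  rare-high-codegree : Rare k 1 (HighCodegree m₁ 8)
  rare-high-codegree = to-k (m^n>0 (p 1411) {{>-nonZero (pow>0 1411 r>0)}} 16) size (Rare-HighCodegree m₁ 8 (p 1411) m₁<M cond)
    where
    cond : 4 * m₁ * 16 * p 1411 ≤ 16 * (M ∸ m₁)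
    cond = begin
        4 * m₁ * 16 * p 1411           ≡⟨ l m₁ (p 1411) ⟩
        16 * (4 * (m₁ * p 1411))       ≤⟨ *-monoʳ-≤ 16 (*-monoʳ-≤ 4 (*-monoˡ-≤ (p 1411) m₁≤2846)) ⟩
        16 * (4 * (p 2846 * p 1411))   ≡⟨ cong (λ t → 16 * (4 * t)) (pow-+ r 2846 1411) ⟩
        16 * (4 * p 4257)              ≤⟨ *-monoʳ-≤ 16 (≤-trans (absorb 4257 (small≤r 4 (m≤m+n 4 4996))) (gap m₁≤)) ⟩
        16 * (M ∸ m₁) ∎
      where
      l : ∀ m z → 4 * m * 16 * z ≡ 16 * (4 * (m * z))
      l = solve-∀
    l′ : ∀ n t k → n * (n * (t * 1)) * k ≡ k * (n * n * t)
    l′ = solve-∀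
    size : n * (n * (n ^ 8 * 1)) * k ≤ p 1411 ^ 16
    size = begin
      n * (n * (n ^ 8 * 1)) * k             ≡⟨ l′ n (n ^ 8) k ⟩
      k * (n * n * n ^ 8)                   ≤⟨ *-monoʳ-≤ k (*-mono-≤ (*-mono-≤ n-upper n-upper) (^-monoˡ-≤ 8 n-upper)) ⟩
      k * (p 2131 * p 2131 * p 2131 ^ 8)    ≡⟨ cong (k *_) (trans (cong₂ _*_ (pow-+ r 2131 2131) (pow-^ r 2131 8)) (pow-+ r 4262 17048)) ⟩
      k * p 21310                           ≤⟨ absorb 21310 k≤r ⟩
      p 21311                               ≤⟨ pow-mono r>0 (m≤m+n 21311 1265) ⟩
      p 22576                               ≡⟨ sym (pow-^ r 1411 16) ⟩
      p 1411 ^ 16 ∎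

  -- Two sets of w ≤ r^b vertices expect about w r^(b + 2846 - 4258) edges at most. The equation
  -- puts r^e w above this by r^2: one r absorbs the constant 4, the other makes the probability at
  -- most r^(-r^e w), which beats n^(2w).
  rare-dense : ∀ e b → 1 ≤ e → b + 2848 ≡ e + 4258 → ∀ w → 1 ≤ w → w ≤ p b → Rare (k * 2 ^ w) 1 (DensePair m₁ (p e) w)
  rare-dense e b e≥1 eq w w≥1 w≤ = Rare-weaken (m^n>0 (p 1) {{>-nonZero (pow>0 1 r>0)}} (p e * w)) (≤-trans size (≤-reflexive (sym (*-identityˡ _))))
      (Rare-DensePair m₁ (p e) w (p 1) m₁<M cond)
    where
    cond : 4 * m₁ * (w * w) * p 1 ≤ p e * w * (M ∸ m₁)
    cond = begin
        4 * m₁ * (w * w) * p 1            ≤⟨ *-monoˡ-≤ (p 1) (*-mono-≤ (*-monoʳ-≤ 4 m₁≤2846) (*-monoʳ-≤ w w≤)) ⟩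
        4 * p 2846 * (w * p b) * p 1      ≡⟨ l (p 2846) w (p b) (p 1) ⟩
        w * (4 * (p b * (p 2846 * p 1)))  ≡⟨ cong (λ t → w * (4 * t)) (trans (cong (p b *_) (pow-+ r 2846 1)) (pow-+ r b 2847)) ⟩
        w * (4 * p (b + 2847))            ≤⟨ *-monoʳ-≤ w (absorb (b + 2847) (small≤r 4 (m≤m+n 4 4996))) ⟩
        w * p (suc (b + 2847))            ≡⟨ cong (λ t → w * p t) (trans (sym (+-suc b 2847)) eq) ⟩
        w * p (e + 4258)                  ≡⟨ cong (w *_) (sym (pow-+ r e 4258)) ⟩
        w * (p e * p 4258)                ≡⟨ l₂ w (p e) (p 4258) ⟩
        p e * w * p 4258                  ≤⟨ *-monoʳ-≤ (p e * w) (gap m₁≤) ⟩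
        p e * w * (M ∸ m₁) ∎
      where
      l : ∀ m w b z → 4 * m * (w * b) * z ≡ w * (4 * (b * (m * z)))
      l = solve-∀
      l₂ : ∀ w a b → w * (a * b) ≡ a * w * b
      l₂ = solve-∀
    k≤k^w : k ≤ k ^ w
    k≤k^w = ≤-trans (≤-reflexive (sym (*-identityʳ k))) (^-monoʳ-≤ k {{>-nonZero k>0}} w≥1)
    base : n * n * (k * 2) ≤ p 1 ^ p e
    base = begin
      n * n * (k * 2)              ≤⟨ *-mono-≤ (*-mono-≤ n-upper n-upper) (≤-trans (≤-reflexive (*-comm k 2)) 2k≤r) ⟩
      p 2131 * p 2131 * r          ≡⟨ trans (cong (_* r) (pow-+ r 2131 2131)) (trans (*-comm (p 4262) r) (pow-suc r 4262)) ⟩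
      p 4263                       ≤⟨ pow-mono r>0 (≤-trans (small≤r 4263 (m≤m+n 4263 737)) (≤-trans (r≤p e e≥1) (m≤m+n (p e) 0))) ⟩
      p (1 * p e)                  ≡⟨ sym (pow-^ r 1 (p e)) ⟩
      p 1 ^ p e ∎
    l₃ : ∀ a k t → a * (a * 1) * (k * t) ≡ a * a * (k * t)
    l₃ = solve-∀
    size : n ^ w * (n ^ w * 1) * (k * 2 ^ w) ≤ p 1 ^ (p e * w)
    size = begin
      n ^ w * (n ^ w * 1) * (k * 2 ^ w)      ≡⟨ l₃ (n ^ w) k (2 ^ w) ⟩
      n ^ w * n ^ w * (k * 2 ^ w)            ≤⟨ *-monoʳ-≤ (n ^ w * n ^ w) (*-monoˡ-≤ (2 ^ w) k≤k^w) ⟩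
      n ^ w * n ^ w * (k ^ w * 2 ^ w)        ≡⟨ cong₂ _*_ (sym (^-distribʳ-* n n w)) (sym (^-distribʳ-* k 2 w)) ⟩
      (n * n) ^ w * (k * 2) ^ w              ≡⟨ sym (^-distribʳ-* (n * n) (k * 2) w) ⟩
      (n * n * (k * 2)) ^ w                  ≤⟨ ^-monoˡ-≤ w base ⟩
      (p 1 ^ p e) ^ w                        ≡⟨ ^-*-assoc (p 1) (p e) w ⟩
      p 1 ^ (p e * w) ∎

  s₀≤ : s₀ ≤ p 1429
  s₀≤ = absorb 1428 (small≤r 4 (m≤m+n 4 4996))

  Dense : ℕ → ℕ → Graph n → Set
  Dense K w₀ σ = ∃[ w ] (1 ≤ w × w ≤ w₀ × DensePair m₁ K w σ)

  rare-denseₛ : Rare k 1 (Dense Kₛ s₀)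
  rare-denseₛ = Rare-geometric s₀ k>0 λ w w≥1 w≤ → rare-dense 19 1429 (s≤s z≤n) refl w w≥1 (≤-trans w≤ s₀≤)

  rare-denseᵤ : Rare k 1 (Dense K w₀)
  rare-denseᵤ = Rare-geometric w₀ k>0 λ w w≥1 w≤ → rare-dense 39 1449 (s≤s z≤n) refl w w≥1 w≤

  w₀-big : 10 * (Kₛ * s₀) ≤ w₀
  w₀-big = begin
      10 * (p 19 * (4 * p 1428))    ≡⟨ l (p 19) (p 1428) ⟩
      40 * (p 19 * p 1428)          ≡⟨ cong (40 *_) (pow-+ r 19 1428) ⟩
      40 * p 1447                   ≤⟨ absorb 1447 (small≤r 40 (m≤m+n 40 4960)) ⟩
      p 1448                        ≤⟨ pow-mono r>0 (m≤m+n 1448 1) ⟩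
      p 1449 ∎
    where
    l : ∀ a b → 10 * (a * (4 * b)) ≡ 40 * (a * b)
    l = solve-∀

  CoverHits : Graph n → Set
  CoverHits σ = ∃[ f ] (1 ≤ f × f ≤ Kₛ * s₀ × CoverHit m₁ 8 K D f σ)

  rare-cover-hits : Rare k 1 CoverHits
  rare-cover-hits = Rare-geometric (Kₛ * s₀) k>0 λ f f≥1 f≤ →
      Rare-weaken (m^n>0 (p 1) {{>-nonZero (pow>0 1 r>0)}} f) (size f f≥1)
        -- With h = 8, u = 10 f and 17 = 1 + 2h. Since u ≤ `w₀`, the u^2 candidates of a plain pick
        -- are at most 10 f `w₀`, so B is `w₀`; z = r^40 is the gain and x = r the resulting decay
        -- per edge.
        (Rare-LabelledHit m₁ f 17 (10 * f * (10 * f)) (10 * f * (4 * K * D)) (insideC₀ (10 * f)) (closingC₁ (10 * f)) 10 w₀ (p 40) (p 1)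
          m₁<M (pow>0 40 r>0) (*-monoʳ-≤ (10 * f) (≤-trans (*-monoʳ-≤ 10 f≤) w₀-big)) (closing-cost f) cond)
    where
    -- 39 + 721 + 17 * 40 = 1440 is below 1449: the quotient of `w₀`, near n^(2/3), by `K * D`, near
    -- n^(1/3), pays for r^40 on 17 picks.
    closing-cost : ∀ f → 10 * f * (4 * K * D) * p 40 ^ 17 ≤ 10 * f * w₀
    closing-cost f = begin
        10 * f * (4 * K * D) * p 40 ^ 17            ≡⟨ l (10 * f) K D (p 40 ^ 17) ⟩
        10 * f * (4 * (p 39 * p 721 * p 40 ^ 17))   ≡⟨ cong (λ t → 10 * f * (4 * t)) (trans (cong₂ _*_ (pow-+ r 39 721) (pow-^ r 40 17)) (pow-+ r 760 680)) ⟩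
        10 * f * (4 * p 1440)                       ≤⟨ *-monoʳ-≤ (10 * f) (≤-trans (absorb 1440 (small≤r 4 (m≤m+n 4 4996))) (pow-mono r>0 (m≤m+n 1441 8))) ⟩
        10 * f * p 1449 ∎
      where
      l : ∀ u a b z → u * (4 * a * b) * z ≡ u * (4 * (a * b * z))
      l = solve-∀
    -- A pick costs m₁ w₀ / M, about r^(2846 + 1449 - 4258) = r^37; the constant 80 and x = r raise
    -- this to r^39, within z = r^40.
    cond : 8 * m₁ * (10 * w₀) * p 1 ≤ (M ∸ m₁) * p 40
    cond = begin
        8 * m₁ * (10 * p 1449) * p 1         ≤⟨ *-monoˡ-≤ (p 1) (*-monoˡ-≤ (10 * p 1449) (*-monoʳ-≤ 8 m₁≤2846)) ⟩
        8 * p 2846 * (10 * p 1449) * p 1     ≡⟨ l (p 2846) (p 1449) (p 1) ⟩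
        80 * (p 2846 * p 1449 * p 1)         ≡⟨ cong (80 *_) (trans (cong (_* p 1) (pow-+ r 2846 1449)) (pow-+ r 4295 1)) ⟩
        80 * p 4296                          ≤⟨ absorb 4296 (small≤r 80 (m≤m+n 80 4920)) ⟩
        p 4297                               ≤⟨ pow-mono r>0 (m≤m+n 4297 1) ⟩
        p 4298                               ≡⟨ sym (pow-+ r 4258 40) ⟩
        p 4258 * p 40                        ≤⟨ *-monoˡ-≤ (p 40) (gap m₁≤) ⟩
        (M ∸ m₁) * p 40 ∎
      where
      l : ∀ m w x → 8 * m * (10 * w) * x ≡ 80 * (m * w * x)
      l = solve-∀
    size : ∀ f → 1 ≤ f → 1 * (k * 2 ^ f) ≤ 1 * p 1 ^ f
    size f f≥1 = *-monoʳ-≤ 1 (begin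
      k * 2 ^ f           ≤⟨ *-monoˡ-≤ (2 ^ f) (≤-trans (≤-reflexive (sym (*-identityʳ k))) (^-monoʳ-≤ k {{>-nonZero k>0}} f≥1)) ⟩
      k ^ f * 2 ^ f       ≡⟨ sym (^-distribʳ-* k 2 f) ⟩
      (k * 2) ^ f         ≤⟨ ^-monoˡ-≤ f (≤-trans (≤-reflexive (*-comm k 2)) (≤-trans 2k≤r (≤-reflexive (sym (pow-1 r))))) ⟩
      p 1 ^ f ∎)

-- Equality of the two hitting times

least : ∀ {P : ℕ → Set} → Decidable P → ∀ m → P m → ∃[ t ] (t ≤ m × P t × (∀ s → s < t → ¬ P s))
least P? zero p = 0 , z≤n , p , λ _ ()
least {P} P? (suc m) p with P? 0
... | yes p₀ = 0 , z≤n , p₀ , λ _ ()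
... | no ¬p₀ with least (P? ∘ suc) m p
...   | t , t≤ , pt , min = suc t , s≤s t≤ , pt , λ { zero _ → ¬p₀ ; (suc s) (s≤s s<) → min s s< }

module Assembly (k r n : ℕ) (k>0 : 0 < k) (r-big : 2 * k + 5000 ≤ r) (n-lower : pow r 2130 ≤ n) (n-upper : n ≤ pow r 2131) where

  open Sizes k r n k>0 r-big n-lower n-upper
  open RareEvents (_≟ᴱ_ {n}) (allEdges n) (allEdges-Unique n)

  v₀ : Fin n
  v₀ = fromℕ< n>0

  Exceptional : List (Edge n) → Set
  Exceptional σ = Covered (take m₀ σ) v₀ ⊎ Separated a m₀ σ ⊎ MissesGroup g (hh + hh) half-m₁ σ ⊎ NoCrossing (hh * suc g) hh half-m₁ half-m₁ σ ⊎
                  HighDegree m₁ D σ ⊎ HighCodegree m₁ 8 σ ⊎ Dense Kₛ s₀ σ ⊎ Dense K w₀ σ ⊎ CoverHits σ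

  rare-exceptional : Rare k 9 Exceptional
  rare-exceptional = Rare-⊎ (rare-early-cover v₀) (Rare-⊎ rare-separated (Rare-⊎ rare-misses-group (Rare-⊎ rare-no-crossing
    (Rare-⊎ rare-high-degree (Rare-⊎ rare-high-codegree (Rare-⊎ rare-denseₛ (Rare-⊎ rare-denseᵤ rare-cover-hits)))))))

  n≥3 : 3 ≤ n
  n≥3 = ≤-trans (≤-trans (small≤r 3 (m≤m+n 3 4997)) (r≤p 2130 (m≤m+n 1 2129))) n-lower

  module _ {σ : List (Edge n)} (σ↭ : σ ↭ allEdges n) (typical : ¬ Exceptional σ) where

    ¬early : ¬ Covered (take m₀ σ) v₀
    ¬early = typical ∘ inj₁

    ¬separated : ¬ Separated a m₀ σ
    ¬separated = typical ∘ inj₂ ∘ inj₁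

    ¬misses : ¬ MissesGroup g (hh + hh) half-m₁ σ
    ¬misses = typical ∘ inj₂ ∘ inj₂ ∘ inj₁

    ¬no-crossing : ¬ NoCrossing (hh * suc g) hh half-m₁ half-m₁ σ
    ¬no-crossing = typical ∘ inj₂ ∘ inj₂ ∘ inj₂ ∘ inj₁

    ¬high-degree : ¬ HighDegree m₁ D σ
    ¬high-degree = typical ∘ inj₂ ∘ inj₂ ∘ inj₂ ∘ inj₂ ∘ inj₁

    ¬high-codegree : ¬ HighCodegree m₁ 8 σ
    ¬high-codegree = typical ∘ inj₂ ∘ inj₂ ∘ inj₂ ∘ inj₂ ∘ inj₂ ∘ inj₁

    ¬denseₛ : ¬ Dense Kₛ s₀ σ
    ¬denseₛ = typical ∘ inj₂ ∘ inj₂ ∘ inj₂ ∘ inj₂ ∘ inj₂ ∘ inj₂ ∘ inj₁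

    ¬denseᵤ : ¬ Dense K w₀ σ
    ¬denseᵤ = typical ∘ inj₂ ∘ inj₂ ∘ inj₂ ∘ inj₂ ∘ inj₂ ∘ inj₂ ∘ inj₂ ∘ inj₁

    ¬cover-hits : ¬ CoverHits σ
    ¬cover-hits = typical ∘ inj₂ ∘ inj₂ ∘ inj₂ ∘ inj₂ ∘ inj₂ ∘ inj₂ ∘ inj₂ ∘ inj₂

    AllCovered : ℕ → Set
    AllCovered t = ∀ v → Covered (take t σ) v

    allCovered? : Decidable AllCovered
    allCovered? t = Fin.all? (covered? (take t σ))

    covered-at-m₁ : AllCovered m₁
    covered-at-m₁ = all-covered {hh = hh} σ↭ ¬misses groups-fit ¬no-crossing

    no-small-closed : ∀ {t} → t ≤ m₁ → AllCovered t → NoSmallClosed (take t σ) (4 * a)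
    no-small-closed t≤ cov S S? (v , v∈S) small closed = ¬cover-hits
      (closed⇒CoverHit σ↭ {m = m₁} {h = 8} {K = K} {D = D} (<⇒≤ m₁<M)
        (λ v → ≮⇒≥ λ deg → ¬high-degree (v , <⇒≤ deg))
        (λ {a} {b} a≢b → ≮⇒≥ λ codeg → ¬high-codegree (a , b , a≢b , <⇒≤ codeg))
        {Kₛ = Kₛ} {s₀ = s₀} {w₀ = w₀} (λ {w} w≥1 w≤ → ¬DensePair⇒Sparse {m = m₁} {K = Kₛ} {w = w} λ d → ¬denseₛ (w , w≥1 , w≤ , d))
        (λ {w} w≥1 w≤ → ¬DensePair⇒Sparse {m = m₁} {K = K} {w = w} λ d → ¬denseᵤ (w , w≥1 , w≤ , d))
        w₀-big t≤ cov S? v v∈S (<⇒≤ small) closed)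

    module _ {t : ℕ} (t≤ : t ≤ m₁) (cov : AllCovered t) where

      G⊆ : take t σ ⊆ᴱ allEdges n
      G⊆ = take-⊆-all t σ↭

      m₀≤t : m₀ ≤ t
      m₀≤t = ≮⇒≥ λ t<m₀ → ¬early (Covered-mono (take-mono-⊆ σ (<⇒≤ t<m₀)) (cov v₀))

      joined : Joined (take t σ) a
      joined = ¬Separated⇒Joined ¬separated (take-mono-⊆ σ m₀≤t)

      connected-at : ¬ ¬ Connected (take t σ)
      connected-at = connected (pow>0 1428 r>0) v₀ G⊆ joined (no-small-closed t≤ cov)

      noNAC-at : ¬ HasNAC (take t σ)
      noNAC-at = noNAC (pow>0 1428 r>0) v₀ G⊆ joined (no-small-closed t≤ cov)

    not-bad : ¬ Bad n σ
    not-bad (_ , never) = at (least allCovered? m₁ covered-at-m₁)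
      where
      at : ¬ (∃[ t ] (t ≤ m₁ × AllCovered t × (∀ s → s < t → ¬ AllCovered s)))
      -- Connectedness is known only under double negation, which suffices since the goal is an
      -- absurdity.
      at (t , t≤ , cov , min) = connected-at t≤ cov λ conn → never
          (t , ((conn , noNAC-at t≤ cov) ,
                λ s s<t good → min s s<t (ConnectedNoNAC⇒triangles n≥3 (take-⊆-all s σ↭) good)) ,
               (everyVertexInTriangle⁺ cov , λ s s<t tri → min s s<t (everyVertexInTriangle⁻ (take-⊆-all s σ↭) tri)))

  few-bad : ∀ L → Unique L → All (Bad n) L → k * length L ≤ 9 * M !
  few-bad L L! bad = ≤-trans (*-monoʳ-≤ k (Unique-⊆-length L! λ {σ} σ∈ → in-cover (All.lookup bad σ∈))) cover-size
    where
    open Rare rare-exceptional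
    in-cover : ∀ {σ} → Bad n σ → σ ∈ cover
    -- `Exceptional` is not decided; membership in the finite list `cover` is, so it may be proved
    -- by contradiction.
    in-cover {σ} b@(σ↭ , _) = decidable-stable (Any.any? (≡-dec _≟ᴱ_ σ) cover) λ σ∉ → not-bad σ↭ (σ∉ ∘ cover-∈ σ↭) b

theorem4p1 : (k : ℕ) → ∃[ N ] ((n : ℕ) → N ≤ n →
    (L : List (List (Edge n))) → Unique L → All (Bad n) L →
    k * length L ≤ numOrderings n)
theorem4p1 k = N , λ n N≤n L L! bad →
    let (r , r-big , lower , upper) = root n N≤n in *-cancelˡ-≤ 9 (begin
      -- Each of the nine exceptional events has probability at most 1/(9(k + 1)); `suc k` keeps the
      -- parameter positive when k = 0.
      9 * (k * length L)              ≤⟨ *-monoʳ-≤ 9 (*-monoˡ-≤ (length L) (n≤1+n k)) ⟩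
      9 * (suc k * length L)          ≡⟨ sym (*-assoc 9 (suc k) (length L)) ⟩
      9 * suc k * length L            ≤⟨ Assembly.few-bad (9 * suc k) r n (s≤s z≤n) r-big lower upper L L! bad ⟩
      9 * length (allEdges n) !       ≡⟨ cong (λ m → 9 * m !) (length-allEdges-C n) ⟩
      9 * numOrderings n ∎)
  where
  open ≤-Reasoning
  choice : ∃[ N ] (∀ n → N ≤ n → ∃[ r ] (2 * (9 * suc k) + 5000 ≤ r × pow r 2130 ≤ n × n ≤ pow r 2131))
  choice = approximate-root 2130 (s≤s z≤n) (2 * (9 * suc k) + 5000)
  N : ℕ
  N = proj₁ choice
  root : ∀ n → N ≤ n → ∃[ r ] (2 * (9 * suc k) + 5000 ≤ r × pow r 2130 ≤ n × n ≤ pow r 2131)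
  root = proj₂ choice
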